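{- Let $K$ be a commutative ring with unit containing $\mathbb{Q}$, let $n$ be an odd positive integer, and for each odd $k$ with $3\le k\le n$ let $y^{[k]}=(y^{[k]}_{\alpha_1\ldots\alpha_k})_{(\alpha_1,\ldots,\alpha_k)\in[n]^k}$ be a completely antisymmetric tensor with entries in $K$. Then the Berezin integral \[ \int\mathrm d\chi_n\cdots\mathrm d\chi_1\ \chi_i\exp\Big(\sum_{\substack{3\le k\le n\\ k\ \mathrm{odd}}}\frac{1}{(k-1)!}\sum_{(\alpha_1,\ldots,\alpha_k)\in[n]^k}y^{[k]}_{\alpha_1\ldots\alpha_k}\chi_{\alpha_2}\chi_{\alpha_3}\cdots\chi_{\alpha_k}\Big) \] is independent of $i\in[n]$ and is equal to $\sum_{\mathcal A}\mathcal Y_{\mathcal A}$, where the sum runs over all odd cacti $\mathcal A$ on $[n]$.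
   Context: The Grassmann algebra $K[\chi_1,\ldots,\chi_n]$ is the quotient of the free noncommutative $K$-algebra on $\chi_1,\ldots,\chi_n$ by the two-sided ideal generated by $\chi_i\chi_j+\chi_j\chi_i$; the argument of the exponential is even and nilpotent, and $\exp(f)=\sum_{p\ge0}f^p/p!$. For $f\in K[\chi]$, $\int\mathrm d\chi_n\cdots\mathrm d\chi_1\,f$ denotes the coefficient of $\chi_1\chi_2\cdots\chi_n$ in $f$. Complete antisymmetry: $y^{[k]}_{\alpha_{\sigma(1)}\ldots\alpha_{\sigma(k)}}=\mathrm{sgn}(\sigma)y^{[k]}_{\alpha_1\ldots\alpha_k}$. Let $\tilde{\mathcal O}_n$ be the set of subsets of $[n]$ of odd cardinality $\ge3$. For $\mathcal A\subseteq\tilde{\mathcal O}_n$, $G(\mathcal A)$ is the bipartite graph on $\mathcal A\sqcup[n]$ with edges $(A,j)$, $j\in A$; $\mathcal A$ is an odd cactus if $G(\mathcal A)$ is a tree (connected and acyclic; e.g. for $n=1$ the empty set is an odd cactus). Let $\mathcal O_n$ be the set of sequences $\alpha=(\alpha_1,\ldots,\alpha_k)$ of distinct elements of $[n]$, $k$ odd, $3\le k\le n$, and $\tilde\alpha=\{\alpha_1,\ldots,\alpha_k\}$. $\mathcal C\subseteq\mathcal O_n$ is a refined cactus if distinct elements have distinct underlying sets and $\mathcal A(\mathcal C)=\{\tilde\alpha:\alpha\in\mathcal C\}$ is an odd cactus. For a root $i\in[n]$ and $\alpha\in\mathcal C$, the local root of $\alpha$ is the first vertex of $[n]$ on the shortest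 path in $G(\mathcal A(\mathcal C))$ from $\tilde\alpha$ to $i$, say $\alpha_s$; the circulation is $\hat\alpha=(\alpha_{s+1},\ldots,\alpha_k,\alpha_1,\ldots,\alpha_{s-1})$. Ordering $\mathcal C$ arbitrarily, let $\pi$ be the concatenation of $(i)$ with all $\hat\alpha$, $\alpha\in\mathcal C$; it is a permutation of $(1,\ldots,n)$, and $\epsilon_{i,\mathcal C}$ is its signature (independent of the ordering). Set $\mathcal Y_{i,\mathcal C}=\epsilon_{i,\mathcal C}\prod_{\alpha\in\mathcal C}y^{[k]}_{\alpha_1\ldots\alpha_k}$. For an odd cactus $\mathcal A$, $\mathcal Y_{\mathcal A}$ denotes the common value of $\mathcal Y_{i,\mathcal C}$ over all $i\in[n]$ and refined cacti $\mathcal C$ with $\mathcal A(\mathcal C)=\mathcal A$ (this value does not depend on these choices). -}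

module Defs where

open import Level using (Level; _⊔_)
open import Data.Bool using (Bool; true; false; if_then_else_; _∧_)
open import Data.Nat using (ℕ; zero; suc; _≤_; _≤ᵇ_; _<ᵇ_; _!)
import Data.Nat as ℕ
open import Data.Nat.Properties using (_!≢0)
open import Data.Fin using (Fin; zero; suc; toℕ)
open import Data.Fin.Subset using (Subset; _∈_; ∣_∣)
open import Data.List using (List; []; _∷_; length; _++_; lookup; map; concat; concatMap; upTo; allFin; foldr; filterᵇ; drop; take)
open import Data.List.Relation.Unary.Unique.Propositional using (Unique)
open import Data.List.Relation.Unary.All using (All)
open import Data.Vec using (Vec; toList; fromList; tail)
import Data.Vec as Vec
open import Data.Product using (Σ; _×_; _,_; ∃)
open import Data.Sum using (_⊎_; inj₁; inj₂)
open import Data.Maybe using (Maybe; just; nothing)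
open import Data.Unit.Polymorphic using (⊤)
open import Data.Empty.Polymorphic using (⊥)
open import Relation.Binary.PropositionalEquality using (_≡_; sym)
open import Data.List.Properties using (length-map)
open import Data.Fin using (cast)
open import Data.Fin.Permutation using (Permutation′; _⟨$⟩ʳ_)
open import Relation.Nullary using (¬_)
open import Algebra.Bundles using (CommutativeRing)
open import Data.Integer using (+_)
open import Data.Rational using (ℚ; _/_)

oddᵇ : ℕ → Bool
oddᵇ zero = false
oddᵇ (suc zero) = true
oddᵇ (suc (suc k)) = oddᵇ k

Odd : ℕ → Set
Odd k = oddᵇ k ≡ true

invFact : ℕ → ℚ
invFact m = ((+ 1) / (m !)) {{m !≢0}}

inversions : ∀ {n} → List (Fin n) → ℕ
inversions [] = 0
inversions (x ∷ xs) = length (filterᵇ (λ y → toℕ y <ᵇ toℕ x) xs) ℕ.+ inversions xs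

toSubset : ∀ {n} → List (Fin n) → Subset n
toSubset {n} xs = Vec.tabulate (λ j → memb j xs)
  where
  open import Data.Fin using (_≟_)
  open import Relation.Nullary using (does)
  memb : Fin n → List (Fin n) → Bool
  memb j [] = false
  memb j (x ∷ xs) = if does (j ≟ x) then true else memb j xs

module Graph {a b : Level} {V : Set a} (E : V → V → Set b) where

  data Walk : V → V → Set (a ⊔ b) where
    here : ∀ {v} → Walk v v
    step : ∀ {u w v} → E u w → Walk w v → Walk u v

  walkLength : ∀ {u v} → Walk u v → ℕ
  walkLength here = 0
  walkLength (step _ w) = suc (walkLength w)

  second : ∀ {u v} → Walk u v → Maybe V
  second here = nothing
  second (step {w = w} _ _) = just w

  Connected : Set (a ⊔ b)
  Connected = ∀ u v → Walk u v

  Chain : List V → Set b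
  Chain [] = ⊤
  Chain (x ∷ []) = ⊤
  Chain (x ∷ y ∷ r) = E x y × Chain (y ∷ r)

  IsCycle : List V → Set (a ⊔ b)
  IsCycle [] = ⊥
  IsCycle (v ∷ vs) = (2 ≤ length vs) × Unique (v ∷ vs) × Chain (v ∷ vs ++ v ∷ [])

  Acyclic : Set (a ⊔ b)
  Acyclic = ∀ vs → ¬ IsCycle vs

  IsTree : Set (a ⊔ b)
  IsTree = Connected × Acyclic

  FirstOnShortestPath : V → V → V → Set (a ⊔ b)
  FirstOnShortestPath u v j =
    Σ (Walk u v) λ w → (second w ≡ just j) × (∀ (w' : Walk u v) → walkLength w ≤ walkLength w')

-- Odd cacti.  A collection 𝒜 of subsets of [n] is represented by a
-- duplicate-free list of subsets; its vertices in G(𝒜) are the positions.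

module _ {n : ℕ} (𝒜 : List (Subset n)) where

  GVertex : Set
  GVertex = Fin (length 𝒜) ⊎ Fin n

  GEdge : GVertex → GVertex → Set
  GEdge (inj₁ p) (inj₂ j) = j ∈ lookup 𝒜 p
  GEdge (inj₂ j) (inj₁ p) = j ∈ lookup 𝒜 p
  GEdge (inj₁ _) (inj₁ _) = ⊥
  GEdge (inj₂ _) (inj₂ _) = ⊥

InÕ : ∀ {n} → Subset n → Set
InÕ A = Odd ∣ A ∣ × (3 ≤ ∣ A ∣)

IsOddCactus : ∀ {n} → List (Subset n) → Set
IsOddCactus 𝒜 = Unique 𝒜 × All InÕ 𝒜 × Graph.IsTree (GEdge 𝒜)

_≋_ : ∀ {n} → List (Subset n) → List (Subset n) → Set
𝒜 ≋ ℬ = ∀ A → (A Data.List.Membership.Propositional.∈ 𝒜 → A Data.List.Membership.Propositional.∈ ℬ)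
             × (A Data.List.Membership.Propositional.∈ ℬ → A Data.List.Membership.Propositional.∈ 𝒜)
  where import Data.List.Membership.Propositional

-- Refined cacti.  A refined cactus is a (arbitrarily ordered) list of
-- sequences α ∈ 𝒪ₙ.

InO : ∀ {n} → List (Fin n) → Set
InO {n} α = Unique α × Odd (length α) × (3 ≤ length α) × (length α ≤ n)

underlying : ∀ {n} → List (List (Fin n)) → List (Subset n)
underlying 𝒞 = map toSubset 𝒞

IsRefinedCactus : ∀ {n} → List (List (Fin n)) → Set
IsRefinedCactus 𝒞 = All InO 𝒞 × IsOddCactus (underlying 𝒞)

seqAt : ∀ {n} (𝒞 : List (List (Fin n))) → Fin (length 𝒞) → List (Fin n)
seqAt 𝒞 p = lookup 𝒞 p

-- A refined cactus together with a choice of local roots w.r.t. the root i: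
-- for each α ∈ 𝒞 (position p), an index s with α_s the local root, i.e.
-- the first vertex of [n] on a shortest path in G(𝒜(𝒞)) from α̃ to i.
record RootedRefinedCactus (n : ℕ) (i : Fin n) : Set where
  field
    cactus     : List (List (Fin n))
    isRefined  : IsRefinedCactus cactus
    localRoot  : (p : Fin (length cactus)) → Fin (length (seqAt cactus p))
    localRootOK : (p : Fin (length cactus)) →
      Graph.FirstOnShortestPath (GEdge (underlying cactus))
        (inj₁ (cast (sym (length-map toSubset cactus)) p))
        (inj₂ i)
        (inj₂ (lookup (seqAt cactus p) (localRoot p)))

circulation : ∀ {n} (α : List (Fin n)) → Fin (length α) → List (Fin n)
circulation α s = drop (suc (toℕ s)) α ++ take (toℕ s) α

rootPermutation : ∀ {n} {i : Fin n} → RootedRefinedCactus n i → List (Fin n)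
rootPermutation {i = i} R =
  i ∷ concat (map (λ p → circulation (seqAt cactus p) (localRoot p)) (allFin (length cactus)))
  where open RootedRefinedCactus R

module OverRing {c ℓ : Level} (K : CommutativeRing c ℓ) (φ : ℚ → CommutativeRing.Carrier K) where

  open CommutativeRing K hiding (zero; _≈_)
  open CommutativeRing K public using (_≈_)

  signK : ℕ → Carrier
  signK zero = 1#
  signK (suc m) = - signK m

  sumK : List Carrier → Carrier
  sumK = foldr _+_ 0#

  productK : List Carrier → Carrier
  productK = foldr _*_ 1#

  -- The Grassmann algebra K[χ₀,…,χ_{n-1}] (generators indexed by Fin n),
  -- realised concretely on its monomial basis: an element of the algebra
  -- on Fin (suc n) is written uniquely as f₀ + χ₀ f₁ with f₀ , f₁ in the
  -- Grassmann algebra of the remaining generators χ₁,…,χₙ.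

  data Grass : ℕ → Set c where
    scalar : Carrier → Grass zero
    split  : ∀ {n} → Grass n → Grass n → Grass (suc n)   -- split f₀ f₁ = f₀ + χ₀ f₁

  gconst : ∀ {n} → Carrier → Grass n
  gconst {zero} a = scalar a
  gconst {suc n} a = split (gconst a) (gconst 0#)

  gzero gone : ∀ {n} → Grass n
  gzero = gconst 0#
  gone = gconst 1#

  gadd : ∀ {n} → Grass n → Grass n → Grass n
  gadd (scalar a) (scalar b) = scalar (a + b)
  gadd (split f₀ f₁) (split g₀ g₁) = split (gadd f₀ g₀) (gadd f₁ g₁)

  gscale : ∀ {n} → Carrier → Grass n → Grass n
  gscale a (scalar b) = scalar (a * b)
  gscale a (split f₀ f₁) = split (gscale a f₀) (gscale a f₁)

  gneg : ∀ {n} → Grass n → Grass n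
  gneg = gscale (- 1#)

  -- parity automorphism: identity on the even part, minus on the odd part
  gpar : ∀ {n} → Grass n → Grass n
  gpar (scalar a) = scalar a
  gpar (split f₀ f₁) = split (gpar f₀) (gneg (gpar f₁))

  -- product, from (f₀ + χ₀f₁)(g₀ + χ₀g₁) = f₀g₀ + χ₀(f₁g₀ + par(f₀)g₁)
  -- (using f₀χ₀ = χ₀ par(f₀) and χ₀χ₀ = 0)
  gmul : ∀ {n} → Grass n → Grass n → Grass n
  gmul (scalar a) (scalar b) = scalar (a * b)
  gmul (split f₀ f₁) (split g₀ g₁) = split (gmul f₀ g₀) (gadd (gmul f₁ g₀) (gmul (gpar f₀) g₁))

  χ : ∀ {n} → Fin n → Grass n
  χ {suc n} zero = split gzero gone
  χ {suc n} (suc j) = split (χ j) gzero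

  gsum : ∀ {n} → List (Grass n) → Grass n
  gsum = foldr gadd gzero

  gprod : ∀ {n} → List (Grass n) → Grass n
  gprod = foldr gmul gone

  gpow : ∀ {n} → Grass n → ℕ → Grass n
  gpow f zero = gone
  gpow f (suc p) = gmul f (gpow f p)

  -- exp f = Σ_p f^p / p! ; the sum is truncated at p = n, which is exact for
  -- f without constant term (then f^p = 0 for p > n), as is the case below.
  gexp : ∀ {n} → Grass n → Grass n
  gexp {n} f = gsum (map (λ p → gscale (φ (invFact p)) (gpow f p)) (upTo (suc n)))

  -- Berezin integral ∫ dχₙ⋯dχ₁ f = coefficient of χ₁χ₂⋯χₙ (the top monomial,
  -- generators in increasing order)
  berezin : ∀ {n} → Grass n → Carrier
  berezin (scalar a) = a
  berezin (split f₀ f₁) = berezin f₁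

  Tensors : ℕ → Set c
  Tensors n = (k : ℕ) → Vec (Fin n) k → Carrier

  allSeqs : ∀ {n} (k : ℕ) → List (Vec (Fin n) k)
  allSeqs zero = Vec.[] ∷ []
  allSeqs {n} (suc k) = concatMap (λ a → map (a Vec.∷_) (allSeqs k)) (allFin n)

  sgnPerm : ∀ {k} → Permutation′ k → Carrier
  sgnPerm {k} σ = signK (inversions (toList (Vec.tabulate (σ ⟨$⟩ʳ_))))

  Antisymmetric : ∀ {n} (k : ℕ) → (Vec (Fin n) k → Carrier) → Set ℓ
  Antisymmetric k t = ∀ (σ : Permutation′ k) α →
    t (Vec.tabulate (λ j → Vec.lookup α (σ ⟨$⟩ʳ j))) ≈ sgnPerm σ * t α

  termK : ∀ {n} → Tensors n → ℕ → Grass n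
  termK y zero = gzero
  termK y (suc k) =
    gscale (φ (invFact k))
      (gsum (map (λ α → gscale (y (suc k) α) (gprod (map χ (toList (tail α))))) (allSeqs (suc k))))

  action : ∀ {n} → Tensors n → Grass n
  action {n} y =
    gsum (map (λ k → if oddᵇ k ∧ (3 ≤ᵇ k) then termK y k else gzero) (upTo (suc n)))

  integral : ∀ {n} → Tensors n → Fin n → Carrier
  integral y i = berezin (gmul (χ i) (gexp (action y)))

  𝒴 : ∀ {n} {i : Fin n} → Tensors n → RootedRefinedCactus n i → Carrier
  𝒴 y R = signK (inversions (rootPermutation R))
          * productK (map (λ α → y (length α) (fromList α)) (RootedRefinedCactus.cactus R))

-- L enumerates the odd cacti: each odd cactus 𝒜 is 𝒜(𝒞) for exactly one
-- entry 𝒞 of L (and every entry of L is a refined cactus, hence 𝒜(𝒞) is an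
-- odd cactus).  Thus Σ over L of 𝒴_{j,𝒞} is Σ over odd cacti 𝒜 of 𝒴_𝒜.

EnumeratesOddCacti : ∀ {n} {j : Fin n} → List (RootedRefinedCactus n j) → Set
EnumeratesOddCacti {n} L =
  ∀ (𝒜 : List (Subset n)) → IsOddCactus 𝒜 →
    Σ (Fin (length L)) λ p →
      (underlying (RootedRefinedCactus.cactus (lookup L p)) ≋ 𝒜)
      × (∀ q → underlying (RootedRefinedCactus.cactus (lookup L q)) ≋ 𝒜 → q ≡ p)

{-# OPTIONS --safe #-}

-- Let ∂ = Σⱼ ∂/∂χⱼ. The action is S = Σ_A y_A ∂χ_A over the odd sets A with
-- |A| ≥ 3, so ∂S = 0, and ∫ χᵢ exp S does not depend on i because
-- (χᵢ − χⱼ) exp S = ∂(χⱼ χᵢ exp S). Each ∂χ_A = ± Π (χ_b − χ_r), b ∈ A ∖ r, is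
-- even with square zero, hence exp S = Σ_𝒜 Π_{A ∈ 𝒜} y_A ∂χ_A over families 𝒜
-- of odd sets. For a family 𝒜, grow the set R of vertices reached from i by
-- attaching hyperedges A that meet R in a single vertex r. The product of χᵢ with
-- the factors used so far is killed by χ_v for every v ∈ R, so the next factor
-- may be replaced by the product of χ_b over b ∈ A ∖ r. If this reaches all of
-- [n], then 𝒜 is a cactus, r is the local root of A, and the product is the top
-- monomial up to the sign ε. If some further hyperedge meets R twice, there is a
-- cycle and the product is zero. If no remaining hyperedge meets R ≠ [n], the
-- graph is disconnected, and the derivation along the complement of R
-- annihilates the product, which therefore has no top coefficient.
module Submission where

open import Defs
open import Level using (Level; _⊔_)
open import Data.Bool using (Bool; true; false; if_then_else_; not; _xor_; _∧_)
open import Data.Bool.Properties as Boolₚ using (not-involutive)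
open import Data.Empty using (⊥-elim)
open import Data.Fin using (Fin; zero; suc; toℕ; cast; _≟_)
import Data.Fin as Fin
open import Data.Fin.Permutation using (Permutation′; lift₀; transpose; _⟨$⟩ʳ_)
import Data.Fin.Properties as Finₚ
open import Data.Fin.Subset using (Subset; inside; outside; ⁅_⁆; _∪_; _∩_; ∣_∣; ⊤; ⊥; Nonempty)
import Data.Fin.Subset as Sub
import Data.Fin.Subset.Properties as Subₚ
open import Data.Fin.Subset.Properties using (_∈?_)
open import Data.Integer using (+_)
import Data.Integer as ℤ
import Data.Integer.Properties as ℤₚ
open import Data.List using (List; []; _∷_; _++_; map; length; lookup; tabulate; allFin; filter; filterᵇ; concat; concatMap; take; drop; upTo)
import Data.List as List
open import Data.List.Membership.Propositional using (_∈_; _∉_)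
open import Data.List.Membership.Propositional.Properties using (∈-++⁺ˡ; ∈-++⁺ʳ; ∈-++⁻; ∈-map⁺; ∈-map⁻; ∈-concatMap⁺; ∈-concatMap⁻; ∈-upTo⁺; ∈-upTo⁻; ∈-filter⁺; ∈-filter⁻; ∈-allFin; ∈-lookup; ∈-∃++)
open import Data.List.Membership.Propositional.Properties.WithK using (unique∧set⇒bag)
open import Data.List.Properties using (++-assoc; ++-identityʳ; length-map; length-tabulate; map-++; map-∘; map-cong; map-id; map-tabulate; tabulate-lookup; ≡-dec)
open import Data.List.Relation.Binary.BagAndSetEquality using (∼bag⇒↭)
open import Data.List.Relation.Binary.Disjoint.Propositional using (Disjoint)
open import Data.List.Relation.Binary.Permutation.Propositional using (_↭_; refl; prep; swap; trans; ↭-sym; ↭-trans; ↭-reflexive)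
import Data.List.Relation.Binary.Permutation.Propositional.Properties as Permₚ
open import Data.List.Relation.Binary.Permutation.Propositional.Properties using (All-resp-↭)
open import Data.List.Relation.Binary.Sublist.Propositional as Sublist using (_⊆_; []; _∷_; _∷ʳ_; minimum)
open import Data.List.Relation.Binary.Sublist.Propositional.Properties using (filter-⊆)
open import Data.List.Relation.Unary.All as All using (All; []; _∷_)
import Data.List.Relation.Unary.All.Properties as Allₚ
open import Data.List.Relation.Unary.AllPairs as AllPairs using ([]; _∷_)
import Data.List.Relation.Unary.AllPairs.Properties as AllPairsₚ
open import Data.List.Relation.Unary.Any as Any using (here; there)
open import Data.List.Relation.Unary.Any.Properties using (lookup-index)
open import Data.List.Relation.Unary.Unique.Propositional using (Unique)
import Data.List.Relation.Unary.Unique.Propositional.Properties as Uniqueₚ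
open import Data.Nat using (ℕ; zero; suc; _≤_; _<_; _≤ᵇ_; _<ᵇ_; _!; NonZero; z≤n; s≤s)
import Data.Nat as ℕ
import Data.Nat.Properties as ℕₚ
open import Data.Nat.Properties using (_!≢0)
open import Data.Product using (Σ; ∃; _×_; _,_; proj₁; proj₂)
open import Data.Rational using (ℚ; 1ℚ; toℚᵘ)
import Data.Rational as ℚ
import Data.Rational.Properties as ℚₚ
open import Data.Rational.Properties using (+-*-rawRing)
open import Data.Rational.Unnormalised using (mkℚᵘ; *≡*; _≃_)
import Data.Rational.Unnormalised.Properties as ℚᵘₚ
open import Data.Sum using (_⊎_; inj₁; inj₂; [_,_]′)
open import Data.Sum.Properties using (inj₂-injective)
open import Data.Unit.Polymorphic using (tt) renaming (⊤ to Unit)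
open import Data.Vec using (Vec; []; _∷_; here; there; toList; fromList)
import Data.Vec as Vec
import Data.Vec.Properties as Vecₚ
open import Function using (_∘_; mk⇔)
open import Relation.Binary.Bundles using (Setoid)
open import Relation.Binary.Definitions using (DecidableEquality)
open import Relation.Binary.PropositionalEquality using (_≡_; _≢_; refl; sym; cong; cong₂; subst)
import Relation.Binary.PropositionalEquality as ≡
import Relation.Binary.Reasoning.Setoid
open import Relation.Binary.Structures using (IsEquivalence)
open import Relation.Nullary using (yes; no; does; ¬_; ¬?)
open import Relation.Nullary.Decidable using (_×-dec_; decidable-stable)
open import Algebra.Bundles using (CommutativeRing; AbelianGroup)
open import Algebra.Morphism.Structures using (IsRingMonomorphism)
import Algebra.Properties.AbelianGroup
import Algebra.Properties.CommutativeSemigroup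
import Algebra.Properties.Ring

-- The two kinds of factorials disappear for different reasons. For alternating y, write 1/(k-1)! =
-- k/k!: the k is what ∂ produces from the full contraction Σ y_α χ_α, since moving any index to the
-- front costs the same sign in y and in χ, and k! counts the orderings of a set. The 1/p! of the
-- exponential cancels the p! orders of p distinct commuting factors of square zero. `gexp` stops at
-- the power n. This loses no cactus, because every attached hyperedge brings a new vertex and so a
-- cactus has fewer than n hyperedges. Local roots are defined by shortest paths, whereas growing a
-- cactus records attachment vertices. A depth function on the grown graph identifies the two, and
-- the same function proves acyclicity. The list `L` may order the hyperedges, and the entries of
-- each, in any way. Its entries are compared with sublists of one fixed list `candidates n` of
-- sorted sets; the comparison costs no sign, as hyperedge factors are even and y_α ∂χ_α is
-- symmetric in α.

-- The Grassmann algebra as a graded-commutative ring.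

module GrassRing {c ℓ : Level} (K : CommutativeRing c ℓ) (φ : ℚ → CommutativeRing.Carrier K) where

  open OverRing K φ
  private
    module K = CommutativeRing K
    module KM = Algebra.Properties.CommutativeSemigroup K.*-commutativeSemigroup
  open CommutativeRing K using (Carrier; _+_; _*_; -_; 0#; 1#)

  infix 4 _≈ᵍ_
  -- An inductive family rather than a recursively computed conjunction, so that a proof determines
  -- both sides and matching on it exposes their shape.
  data _≈ᵍ_ : ∀ {n} → Grass n → Grass n → Set (c ⊔ ℓ) where
    scalar : ∀ {a b} → a ≈ b → scalar a ≈ᵍ scalar b
    split  : ∀ {n} {f₀ f₁ g₀ g₁ : Grass n} → f₀ ≈ᵍ g₀ → f₁ ≈ᵍ g₁ → split f₀ f₁ ≈ᵍ split g₀ g₁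

  ≈ᵍ-refl : ∀ {n} {f : Grass n} → f ≈ᵍ f
  ≈ᵍ-refl {f = scalar a} = scalar K.refl
  ≈ᵍ-refl {f = split f₀ f₁} = split ≈ᵍ-refl ≈ᵍ-refl

  ≈ᵍ-sym : ∀ {n} {f g : Grass n} → f ≈ᵍ g → g ≈ᵍ f
  ≈ᵍ-sym (scalar p) = scalar (K.sym p)
  ≈ᵍ-sym (split p q) = split (≈ᵍ-sym p) (≈ᵍ-sym q)

  ≈ᵍ-trans : ∀ {n} {f g h : Grass n} → f ≈ᵍ g → g ≈ᵍ h → f ≈ᵍ h
  ≈ᵍ-trans (scalar p) (scalar q) = scalar (K.trans p q)
  ≈ᵍ-trans (split p q) (split r s) = split (≈ᵍ-trans p r) (≈ᵍ-trans q s)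

  ≈ᵍ-isEquivalence : ∀ {n} → IsEquivalence (_≈ᵍ_ {n})
  ≈ᵍ-isEquivalence = record { refl = ≈ᵍ-refl ; sym = ≈ᵍ-sym ; trans = ≈ᵍ-trans }

  gsetoid : ℕ → Setoid c (c ⊔ ℓ)
  gsetoid n = record { Carrier = Grass n ; _≈_ = _≈ᵍ_ ; isEquivalence = ≈ᵍ-isEquivalence }

  gconst-cong : ∀ {n} {a b} → a ≈ b → gconst {n} a ≈ᵍ gconst b
  gconst-cong {zero} p = scalar p
  gconst-cong {suc n} p = split (gconst-cong p) ≈ᵍ-refl

  gadd-cong : ∀ {n} {f f' g g' : Grass n} → f ≈ᵍ f' → g ≈ᵍ g' → gadd f g ≈ᵍ gadd f' g'
  gadd-cong (scalar p) (scalar q) = scalar (K.+-cong p q)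
  gadd-cong (split p q) (split r s) = split (gadd-cong p r) (gadd-cong q s)

  gscale-cong : ∀ {n} {a b} {f g : Grass n} → a ≈ b → f ≈ᵍ g → gscale a f ≈ᵍ gscale b g
  gscale-cong p (scalar q) = scalar (K.*-cong p q)
  gscale-cong p (split q r) = split (gscale-cong p q) (gscale-cong p r)

  gneg-cong : ∀ {n} {f g : Grass n} → f ≈ᵍ g → gneg f ≈ᵍ gneg g
  gneg-cong = gscale-cong K.refl

  gpar-cong : ∀ {n} {f g : Grass n} → f ≈ᵍ g → gpar f ≈ᵍ gpar g
  gpar-cong (scalar p) = scalar p
  gpar-cong (split p q) = split (gpar-cong p) (gneg-cong (gpar-cong q))

  gmul-cong : ∀ {n} {f f' g g' : Grass n} → f ≈ᵍ f' → g ≈ᵍ g' → gmul f g ≈ᵍ gmul f' g'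
  gmul-cong (scalar p) (scalar q) = scalar (K.*-cong p q)
  gmul-cong (split p q) (split r s) =
    split (gmul-cong p r) (gadd-cong (gmul-cong q r) (gmul-cong (gpar-cong p) s))

  gadd-assoc : ∀ {n} (f g h : Grass n) → gadd (gadd f g) h ≈ᵍ gadd f (gadd g h)
  gadd-assoc (scalar a) (scalar b) (scalar c) = scalar (K.+-assoc a b c)
  gadd-assoc (split f₀ f₁) (split g₀ g₁) (split h₀ h₁) = split (gadd-assoc f₀ g₀ h₀) (gadd-assoc f₁ g₁ h₁)

  gadd-comm : ∀ {n} (f g : Grass n) → gadd f g ≈ᵍ gadd g f
  gadd-comm (scalar a) (scalar b) = scalar (K.+-comm a b)
  gadd-comm (split f₀ f₁) (split g₀ g₁) = split (gadd-comm f₀ g₀) (gadd-comm f₁ g₁)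

  gadd-identityˡ : ∀ {n} (f : Grass n) → gadd gzero f ≈ᵍ f
  gadd-identityˡ (scalar a) = scalar (K.+-identityˡ a)
  gadd-identityˡ (split f₀ f₁) = split (gadd-identityˡ f₀) (gadd-identityˡ f₁)

  gadd-identityʳ : ∀ {n} (f : Grass n) → gadd f gzero ≈ᵍ f
  gadd-identityʳ f = ≈ᵍ-trans (gadd-comm f gzero) (gadd-identityˡ f)

  gscale-zeroˡ : ∀ {n} (f : Grass n) → gscale 0# f ≈ᵍ gzero
  gscale-zeroˡ (scalar a) = scalar (K.zeroˡ a)
  gscale-zeroˡ (split f₀ f₁) = split (gscale-zeroˡ f₀) (gscale-zeroˡ f₁)

  gscale-zeroʳ : ∀ {n} a → gscale a (gzero {n}) ≈ᵍ gzero
  gscale-zeroʳ {zero} a = scalar (K.zeroʳ a)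
  gscale-zeroʳ {suc n} a = split (gscale-zeroʳ a) (gscale-zeroʳ a)

  gscale-identity : ∀ {n} (f : Grass n) → gscale 1# f ≈ᵍ f
  gscale-identity (scalar a) = scalar (K.*-identityˡ a)
  gscale-identity (split f₀ f₁) = split (gscale-identity f₀) (gscale-identity f₁)

  gscale-distribˡ : ∀ {n} a (f g : Grass n) → gscale a (gadd f g) ≈ᵍ gadd (gscale a f) (gscale a g)
  gscale-distribˡ a (scalar b) (scalar c) = scalar (K.distribˡ a b c)
  gscale-distribˡ a (split f₀ f₁) (split g₀ g₁) = split (gscale-distribˡ a f₀ g₀) (gscale-distribˡ a f₁ g₁)

  gscale-distribʳ : ∀ {n} a b (f : Grass n) → gscale (a + b) f ≈ᵍ gadd (gscale a f) (gscale b f)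
  gscale-distribʳ a b (scalar c) = scalar (K.distribʳ c a b)
  gscale-distribʳ a b (split f₀ f₁) = split (gscale-distribʳ a b f₀) (gscale-distribʳ a b f₁)

  gscale-gscale : ∀ {n} a b (f : Grass n) → gscale a (gscale b f) ≈ᵍ gscale (a * b) f
  gscale-gscale a b (scalar c) = scalar (K.sym (K.*-assoc a b c))
  gscale-gscale a b (split f₀ f₁) = split (gscale-gscale a b f₀) (gscale-gscale a b f₁)

  gscale-comm : ∀ {n} a b (f : Grass n) → gscale a (gscale b f) ≈ᵍ gscale b (gscale a f)
  gscale-comm a b f = ≈ᵍ-trans (gscale-gscale a b f)
    (≈ᵍ-trans (gscale-cong (K.*-comm a b) ≈ᵍ-refl) (≈ᵍ-sym (gscale-gscale b a f)))

  gneg-inverseˡ : ∀ {n} (f : Grass n) → gadd (gneg f) f ≈ᵍ gzero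
  gneg-inverseˡ f = ≈ᵍ-trans (gadd-cong ≈ᵍ-refl (≈ᵍ-sym (gscale-identity f)))
    (≈ᵍ-trans (≈ᵍ-sym (gscale-distribʳ (- 1#) 1# f))
      (≈ᵍ-trans (gscale-cong (K.-‿inverseˡ 1#) ≈ᵍ-refl) (gscale-zeroˡ f)))

  gneg-inverseʳ : ∀ {n} (f : Grass n) → gadd f (gneg f) ≈ᵍ gzero
  gneg-inverseʳ f = ≈ᵍ-trans (gadd-comm f (gneg f)) (gneg-inverseˡ f)

  gaddGroup : ℕ → AbelianGroup c (c ⊔ ℓ)
  gaddGroup n = record
    { Carrier = Grass n ; _≈_ = _≈ᵍ_ ; _∙_ = gadd ; ε = gzero ; _⁻¹ = gneg
    ; isAbelianGroup = record
      { isGroup = record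
        { isMonoid = record
          { isSemigroup = record
            { isMagma = record { isEquivalence = ≈ᵍ-isEquivalence ; ∙-cong = gadd-cong }
            ; assoc = gadd-assoc }
          ; identity = gadd-identityˡ , gadd-identityʳ }
        ; inverse = gneg-inverseˡ , gneg-inverseʳ
        ; ⁻¹-cong = gneg-cong }
      ; comm = gadd-comm } }

  private
    module A {n : ℕ} where
      open Algebra.Properties.AbelianGroup (gaddGroup n) public
      open Algebra.Properties.CommutativeSemigroup (AbelianGroup.commutativeSemigroup (gaddGroup n)) public
      open Relation.Binary.Reasoning.Setoid (gsetoid n) public

  gneg-involutive : ∀ {n} (f : Grass n) → gneg (gneg f) ≈ᵍ f
  gneg-involutive = A.⁻¹-involutive

  gneg-gadd : ∀ {n} (f g : Grass n) → gneg (gadd f g) ≈ᵍ gadd (gneg f) (gneg g)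
  gneg-gadd = gscale-distribˡ (- 1#)

  gadd-cancel-middle : ∀ {n} (f g h : Grass n) → gadd (gadd f h) (gadd (gneg h) g) ≈ᵍ gadd f g
  gadd-cancel-middle f g h = ≈ᵍ-trans (gadd-assoc f h _) (gadd-cong ≈ᵍ-refl
    (≈ᵍ-trans (≈ᵍ-sym (gadd-assoc h (gneg h) g))
      (≈ᵍ-trans (gadd-cong (gneg-inverseʳ h) ≈ᵍ-refl) (gadd-identityˡ g))))

  gpar-gscale : ∀ {n} a (f : Grass n) → gpar (gscale a f) ≈ᵍ gscale a (gpar f)
  gpar-gscale a (scalar b) = ≈ᵍ-refl
  gpar-gscale a (split f₀ f₁) = split (gpar-gscale a f₀)
    (≈ᵍ-trans (gneg-cong (gpar-gscale a f₁)) (gscale-comm (- 1#) a (gpar f₁)))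

  gpar-gadd : ∀ {n} (f g : Grass n) → gpar (gadd f g) ≈ᵍ gadd (gpar f) (gpar g)
  gpar-gadd (scalar a) (scalar b) = ≈ᵍ-refl
  gpar-gadd (split f₀ f₁) (split g₀ g₁) = split (gpar-gadd f₀ g₀)
    (≈ᵍ-trans (gneg-cong (gpar-gadd f₁ g₁)) (gneg-gadd _ _))

  gpar-gconst : ∀ {n} a → gpar (gconst {n} a) ≈ᵍ gconst a
  gpar-gconst {zero} a = ≈ᵍ-refl
  gpar-gconst {suc n} a = split (gpar-gconst a)
    (≈ᵍ-trans (gneg-cong (gpar-gconst 0#)) (gscale-zeroʳ (- 1#)))

  gpar-involutive : ∀ {n} (f : Grass n) → gpar (gpar f) ≈ᵍ f
  gpar-involutive (scalar a) = ≈ᵍ-refl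
  gpar-involutive (split f₀ f₁) = split (gpar-involutive f₀)
    (≈ᵍ-trans (gneg-cong (gpar-gscale (- 1#) (gpar f₁)))
      (≈ᵍ-trans (gneg-involutive _) (gpar-involutive f₁)))

  gmul-gscaleˡ : ∀ {n} a (f g : Grass n) → gmul (gscale a f) g ≈ᵍ gscale a (gmul f g)
  gmul-gscaleˡ a (scalar b) (scalar c) = scalar (K.*-assoc a b c)
  gmul-gscaleˡ a (split f₀ f₁) (split g₀ g₁) = split (gmul-gscaleˡ a f₀ g₀)
    (≈ᵍ-trans (gadd-cong (gmul-gscaleˡ a f₁ g₀)
                (≈ᵍ-trans (gmul-cong (gpar-gscale a f₀) ≈ᵍ-refl) (gmul-gscaleˡ a (gpar f₀) g₁)))
      (≈ᵍ-sym (gscale-distribˡ a _ _)))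

  gmul-gscaleʳ : ∀ {n} a (f g : Grass n) → gmul f (gscale a g) ≈ᵍ gscale a (gmul f g)
  gmul-gscaleʳ a (scalar b) (scalar c) = scalar (KM.x∙yz≈y∙xz b a c)
  gmul-gscaleʳ a (split f₀ f₁) (split g₀ g₁) = split (gmul-gscaleʳ a f₀ g₀)
    (≈ᵍ-trans (gadd-cong (gmul-gscaleʳ a f₁ g₀) (gmul-gscaleʳ a (gpar f₀) g₁))
      (≈ᵍ-sym (gscale-distribˡ a _ _)))

  gmul-distribʳ : ∀ {n} (h f g : Grass n) → gmul (gadd f g) h ≈ᵍ gadd (gmul f h) (gmul g h)
  gmul-distribʳ (scalar c) (scalar a) (scalar b) = scalar (K.distribʳ c a b)
  gmul-distribʳ (split h₀ h₁) (split f₀ f₁) (split g₀ g₁) = split (gmul-distribʳ h₀ f₀ g₀)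
    (≈ᵍ-trans (gadd-cong (gmul-distribʳ h₀ f₁ g₁)
                (≈ᵍ-trans (gmul-cong (gpar-gadd f₀ g₀) ≈ᵍ-refl) (gmul-distribʳ h₁ (gpar f₀) (gpar g₀))))
      (A.interchange _ _ _ _))

  gmul-distribˡ : ∀ {n} (h f g : Grass n) → gmul h (gadd f g) ≈ᵍ gadd (gmul h f) (gmul h g)
  gmul-distribˡ (scalar c) (scalar a) (scalar b) = scalar (K.distribˡ c a b)
  gmul-distribˡ (split h₀ h₁) (split f₀ f₁) (split g₀ g₁) = split (gmul-distribˡ h₀ f₀ g₀)
    (≈ᵍ-trans (gadd-cong (gmul-distribˡ h₁ f₀ g₀) (gmul-distribˡ (gpar h₀) f₁ g₁))
      (A.interchange _ _ _ _))

  gmul-gconstˡ : ∀ {n} a (f : Grass n) → gmul (gconst a) f ≈ᵍ gscale a f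
  gmul-gconstˡ a (scalar b) = ≈ᵍ-refl
  gmul-gconstˡ a (split f₀ f₁) = split (gmul-gconstˡ a f₀)
    (≈ᵍ-trans (gadd-cong (≈ᵍ-trans (gmul-gconstˡ 0# f₀) (gscale-zeroˡ f₀))
                (≈ᵍ-trans (gmul-cong (gpar-gconst a) ≈ᵍ-refl) (gmul-gconstˡ a f₁)))
      (gadd-identityˡ _))

  gmul-gconstʳ : ∀ {n} a (f : Grass n) → gmul f (gconst a) ≈ᵍ gscale a f
  gmul-gconstʳ a (scalar b) = scalar (K.*-comm b a)
  gmul-gconstʳ a (split f₀ f₁) = split (gmul-gconstʳ a f₀)
    (≈ᵍ-trans (gadd-cong (gmul-gconstʳ a f₁)
                (≈ᵍ-trans (gmul-gconstʳ 0# (gpar f₀)) (gscale-zeroˡ _)))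
      (gadd-identityʳ _))

  gpar-gmul : ∀ {n} (f g : Grass n) → gpar (gmul f g) ≈ᵍ gmul (gpar f) (gpar g)
  gpar-gmul (scalar a) (scalar b) = ≈ᵍ-refl
  gpar-gmul (split f₀ f₁) (split g₀ g₁) = split (gpar-gmul f₀ g₀)
    (≈ᵍ-trans (gneg-cong (gpar-gadd _ _)) (≈ᵍ-trans (gneg-gadd _ _)
      (gadd-cong
        (≈ᵍ-trans (gneg-cong (gpar-gmul f₁ g₀)) (≈ᵍ-sym (gmul-gscaleˡ (- 1#) _ _)))
        (≈ᵍ-trans (gneg-cong (gpar-gmul (gpar f₀) g₁)) (≈ᵍ-sym (gmul-gscaleʳ (- 1#) _ _))))))

  gmul-assoc : ∀ {n} (f g h : Grass n) → gmul (gmul f g) h ≈ᵍ gmul f (gmul g h)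
  gmul-assoc (scalar a) (scalar b) (scalar c) = scalar (K.*-assoc a b c)
  gmul-assoc (split f₀ f₁) (split g₀ g₁) (split h₀ h₁) = split (gmul-assoc f₀ g₀ h₀)
    (A.begin
      gadd (gmul (gadd (gmul f₁ g₀) (gmul (gpar f₀) g₁)) h₀) (gmul (gpar (gmul f₀ g₀)) h₁)
        A.≈⟨ gadd-cong (≈ᵍ-trans (gmul-distribʳ h₀ _ _) (gadd-cong (gmul-assoc f₁ g₀ h₀) (gmul-assoc (gpar f₀) g₁ h₀)))
                       (≈ᵍ-trans (gmul-cong (gpar-gmul f₀ g₀) ≈ᵍ-refl) (gmul-assoc (gpar f₀) (gpar g₀) h₁)) ⟩
      gadd (gadd (gmul f₁ (gmul g₀ h₀)) (gmul (gpar f₀) (gmul g₁ h₀))) (gmul (gpar f₀) (gmul (gpar g₀) h₁))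
        A.≈⟨ gadd-assoc _ _ _ ⟩
      gadd (gmul f₁ (gmul g₀ h₀)) (gadd (gmul (gpar f₀) (gmul g₁ h₀)) (gmul (gpar f₀) (gmul (gpar g₀) h₁)))
        A.≈⟨ gadd-cong ≈ᵍ-refl (≈ᵍ-sym (gmul-distribˡ (gpar f₀) _ _)) ⟩
      gadd (gmul f₁ (gmul g₀ h₀)) (gmul (gpar f₀) (gadd (gmul g₁ h₀) (gmul (gpar g₀) h₁))) A.∎)

  Even′ Odd′ : ∀ {n} → Grass n → Set (c ⊔ ℓ)
  Even′ f = gpar f ≈ᵍ f
  Odd′ f = gpar f ≈ᵍ gneg f

  private
    even-of-neg-odd : ∀ {n} {f : Grass n} → gneg (gpar f) ≈ᵍ gneg f → Even′ f
    even-of-neg-odd p = ≈ᵍ-trans (≈ᵍ-sym (gneg-involutive _)) (≈ᵍ-trans (gneg-cong p) (gneg-involutive _))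

    odd-of-neg : ∀ {n} {f : Grass n} → gneg (gpar f) ≈ᵍ f → Odd′ f
    odd-of-neg p = ≈ᵍ-trans (≈ᵍ-sym (gneg-involutive _)) (gneg-cong p)

  -- In `f₀ + χ₀ f₁` the part `f₁` has the opposite parity to the whole, so each of the two
  -- statements calls the other one on `f₁`; hence the mutual induction on the number of generators.
  even-comm : ∀ {n} {f : Grass n} → Even′ f → ∀ g → gmul f g ≈ᵍ gmul g f
  odd-comm : ∀ {n} {f : Grass n} → Odd′ f → ∀ g → gmul f g ≈ᵍ gmul (gpar g) f
  even-comm {f = scalar a} _ (scalar b) = scalar (K.*-comm a b)
  even-comm {f = split f₀ f₁} (split e o) (split g₀ g₁) = split (even-comm e g₀)
    (≈ᵍ-trans (gadd-cong (odd-comm (odd-of-neg o) g₀)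
                (≈ᵍ-trans (gmul-cong e ≈ᵍ-refl) (even-comm e g₁)))
      (gadd-comm _ _))
  odd-comm {f = scalar a} _ (scalar b) = scalar (K.*-comm a b)
  odd-comm {f = split f₀ f₁} (split o e) (split g₀ g₁) = split (odd-comm o g₀)
    (≈ᵍ-trans (gadd-cong
        (≈ᵍ-trans (even-comm (even-of-neg-odd e) g₀) (gmul-cong (≈ᵍ-sym (gpar-involutive g₀)) ≈ᵍ-refl))
        (≈ᵍ-trans (gmul-cong o ≈ᵍ-refl) (≈ᵍ-trans (gmul-gscaleˡ (- 1#) f₀ g₁)
          (≈ᵍ-trans (gneg-cong (odd-comm o g₁)) (≈ᵍ-sym (gmul-gscaleˡ (- 1#) _ _))))))
      (gadd-comm _ _))

-- Weighted antiderivations and the top coefficient.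

module Derivation {c ℓ : Level} (K : CommutativeRing c ℓ) (φ : ℚ → CommutativeRing.Carrier K) where

  open OverRing K φ
  open GrassRing K φ
  private
    module K = CommutativeRing K
    module A {n : ℕ} where
      open Algebra.Properties.CommutativeSemigroup (AbelianGroup.commutativeSemigroup (gaddGroup n)) public
      open Relation.Binary.Reasoning.Setoid (gsetoid n) public
  open CommutativeRing K using (Carrier; _+_; _*_; -_; 0#; 1#)

  gzero-gneg : ∀ {n} → gneg (gzero {n}) ≈ᵍ gzero
  gzero-gneg = gscale-zeroʳ (- 1#)

  gmul-zeroˡ : ∀ {n} (f : Grass n) → gmul gzero f ≈ᵍ gzero
  gmul-zeroˡ f = ≈ᵍ-trans (gmul-gconstˡ 0# f) (gscale-zeroˡ f)

  gmul-zeroʳ : ∀ {n} (f : Grass n) → gmul f gzero ≈ᵍ gzero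
  gmul-zeroʳ f = ≈ᵍ-trans (gmul-gconstʳ 0# f) (gscale-zeroˡ f)

  gmul-gnegˡ : ∀ {n} (f g : Grass n) → gmul (gneg f) g ≈ᵍ gneg (gmul f g)
  gmul-gnegˡ = gmul-gscaleˡ (- 1#)

  gmul-gnegʳ : ∀ {n} (f g : Grass n) → gmul f (gneg g) ≈ᵍ gneg (gmul f g)
  gmul-gnegʳ = gmul-gscaleʳ (- 1#)

  gpar-gneg : ∀ {n} (f : Grass n) → gpar (gneg f) ≈ᵍ gneg (gpar f)
  gpar-gneg = gpar-gscale (- 1#)

  -- D w is the antiderivation Σⱼ wⱼ ∂/∂χⱼ.
  D : ∀ {n} → (Fin n → Carrier) → Grass n → Grass n
  D w (scalar a) = scalar 0#
  D w (split f₀ f₁) = split (gadd (D (w ∘ suc) f₀) (gscale (w zero) f₁)) (gneg (D (w ∘ suc) f₁))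

  D-cong : ∀ {n} w {f g : Grass n} → f ≈ᵍ g → D w f ≈ᵍ D w g
  D-cong w (scalar p) = ≈ᵍ-refl
  D-cong w (split p q) = split (gadd-cong (D-cong _ p) (gscale-cong K.refl q)) (gneg-cong (D-cong _ q))

  D-gadd : ∀ {n} w (f g : Grass n) → D w (gadd f g) ≈ᵍ gadd (D w f) (D w g)
  D-gadd w (scalar a) (scalar b) = scalar (K.sym (K.+-identityˡ 0#))
  D-gadd w (split f₀ f₁) (split g₀ g₁) = split
    (≈ᵍ-trans (gadd-cong (D-gadd _ f₀ g₀) (gscale-distribˡ _ f₁ g₁)) (A.interchange _ _ _ _))
    (≈ᵍ-trans (gneg-cong (D-gadd _ f₁ g₁)) (gneg-gadd _ _))

  D-gscale : ∀ {n} w a (f : Grass n) → D w (gscale a f) ≈ᵍ gscale a (D w f)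
  D-gscale w a (scalar b) = scalar (K.sym (K.zeroʳ a))
  D-gscale w a (split f₀ f₁) = split
    (≈ᵍ-trans (gadd-cong (D-gscale _ a f₀) (gscale-comm _ a f₁)) (≈ᵍ-sym (gscale-distribˡ a _ _)))
    (≈ᵍ-trans (gneg-cong (D-gscale _ a f₁)) (gscale-comm (- 1#) a _))

  D-gconst : ∀ {n} w a → D w (gconst {n} a) ≈ᵍ gzero
  D-gconst {zero} w a = ≈ᵍ-refl
  D-gconst {suc n} w a = split
    (≈ᵍ-trans (gadd-cong (D-gconst _ a) (gscale-zeroʳ (w zero))) (gadd-identityˡ _))
    (≈ᵍ-trans (gneg-cong (D-gconst _ 0#)) gzero-gneg)

  D-χ : ∀ {n} w (j : Fin n) → D w (χ j) ≈ᵍ gconst (w j)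
  D-χ w zero = split
    (≈ᵍ-trans (gadd-cong (D-gconst _ 0#) (≈ᵍ-trans (≈ᵍ-sym (gmul-gconstˡ _ _)) (≈ᵍ-trans (gmul-gconstʳ 1# _) (gscale-identity _)))) (gadd-identityˡ _))
    (≈ᵍ-trans (gneg-cong (D-gconst _ 1#)) gzero-gneg)
  D-χ w (suc j) = split
    (≈ᵍ-trans (gadd-cong (D-χ _ j) (gscale-zeroʳ (w zero))) (gadd-identityʳ _))
    (≈ᵍ-trans (gneg-cong (D-gconst _ 0#)) gzero-gneg)

  -- An antiderivation lowers the degree by one, so it exchanges even and odd parts.
  gpar-D : ∀ {n} w (f : Grass n) → gpar (D w f) ≈ᵍ gneg (D w (gpar f))
  gpar-D w (scalar a) = scalar (K.sym (K.zeroʳ (- 1#)))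
  gpar-D w (split f₀ f₁) = split
    (A.begin
      gpar (gadd (D _ f₀) (gscale (w zero) f₁))
        A.≈⟨ ≈ᵍ-trans (gpar-gadd _ _) (gadd-cong (gpar-D _ f₀) (gpar-gscale _ f₁)) ⟩
      gadd (gneg (D _ (gpar f₀))) (gscale (w zero) (gpar f₁))
        A.≈⟨ gadd-cong ≈ᵍ-refl (≈ᵍ-sym (≈ᵍ-trans (gscale-comm (- 1#) _ _) (gscale-cong K.refl (gneg-involutive _)))) ⟩
      gadd (gneg (D _ (gpar f₀))) (gneg (gscale (w zero) (gneg (gpar f₁))))
        A.≈⟨ ≈ᵍ-sym (gneg-gadd _ _) ⟩
      gneg (gadd (D _ (gpar f₀)) (gscale (w zero) (gneg (gpar f₁)))) A.∎)
    (gneg-cong (≈ᵍ-trans (gpar-gneg _) (≈ᵍ-trans (gneg-cong (gpar-D _ f₁))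
      (≈ᵍ-sym (gneg-cong (D-gscale _ (- 1#) _))))))

  -- The mixed terms are `D (w₀ f₁)` and `w₀` times the χ₀-part `- D f₁`; they cancel because of the
  -- sign with which `D` passes χ₀.
  D-D : ∀ {n} w (f : Grass n) → D w (D w f) ≈ᵍ gzero
  D-D w (scalar a) = ≈ᵍ-refl
  D-D w (split f₀ f₁) = split
    (≈ᵍ-trans (gadd-cong (≈ᵍ-trans (D-gadd _ _ _) (≈ᵍ-trans (gadd-cong (D-D _ f₀) (D-gscale _ _ f₁)) (gadd-identityˡ _)))
                (gscale-comm (w zero) (- 1#) _))
      (gneg-inverseʳ _))
    (≈ᵍ-trans (gneg-cong (≈ᵍ-trans (D-gscale _ (- 1#) _) (gneg-cong (D-D _ f₁))))
      (gneg-involutive _))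

  Leibniz : ∀ {n} w (f g : Grass n) →
    D w (gmul f g) ≈ᵍ gadd (gmul (D w f) g) (gmul (gpar f) (D w g))
  Leibniz w (scalar a) (scalar b) =
    scalar (K.sym (K.trans (K.+-cong (K.zeroˡ b) (K.zeroʳ a)) (K.+-identityˡ 0#)))
  Leibniz w (split f₀ f₁) (split g₀ g₁) = split even odd
    where
    w' = w ∘ suc
    a = w zero
    even = A.begin
      gadd (D w' (gmul f₀ g₀)) (gscale a (gadd (gmul f₁ g₀) (gmul (gpar f₀) g₁)))
        A.≈⟨ gadd-cong (Leibniz w' f₀ g₀) (gscale-distribˡ a _ _) ⟩
      gadd (gadd (gmul (D w' f₀) g₀) (gmul (gpar f₀) (D w' g₀))) (gadd (gscale a (gmul f₁ g₀)) (gscale a (gmul (gpar f₀) g₁)))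
        A.≈⟨ A.interchange _ _ _ _ ⟩
      gadd (gadd (gmul (D w' f₀) g₀) (gscale a (gmul f₁ g₀))) (gadd (gmul (gpar f₀) (D w' g₀)) (gscale a (gmul (gpar f₀) g₁)))
        A.≈⟨ ≈ᵍ-sym (gadd-cong
              (≈ᵍ-trans (gmul-distribʳ _ _ _) (gadd-cong ≈ᵍ-refl (gmul-gscaleˡ a _ _)))
              (≈ᵍ-trans (gmul-distribˡ _ _ _) (gadd-cong ≈ᵍ-refl (gmul-gscaleʳ a _ _)))) ⟩
      gadd (gmul (gadd (D w' f₀) (gscale a f₁)) g₀) (gmul (gpar f₀) (gadd (D w' g₀) (gscale a g₁))) A.∎
    X = gneg (gmul (D w' f₁) g₀)
    Y = gneg (gmul (gpar f₁) (D w' g₀))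
    Z = gmul (gpar (D w' f₀)) g₁
    W = gneg (gmul f₀ (D w' g₁))
    T = gscale a (gmul (gpar f₁) g₁)
    lhs = A.begin
      gneg (D w' (gadd (gmul f₁ g₀) (gmul (gpar f₀) g₁)))
        A.≈⟨ ≈ᵍ-trans (gneg-cong (D-gadd w' _ _)) (gneg-gadd _ _) ⟩
      gadd (gneg (D w' (gmul f₁ g₀))) (gneg (D w' (gmul (gpar f₀) g₁)))
        A.≈⟨ gadd-cong (≈ᵍ-trans (gneg-cong (Leibniz w' f₁ g₀)) (gneg-gadd _ _))
                       (≈ᵍ-trans (gneg-cong (Leibniz w' (gpar f₀) g₁)) (gneg-gadd _ _)) ⟩
      gadd (gadd X Y) (gadd (gneg (gmul (D w' (gpar f₀)) g₁)) (gneg (gmul (gpar (gpar f₀)) (D w' g₁))))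
        A.≈⟨ gadd-cong ≈ᵍ-refl (gadd-cong
               (≈ᵍ-trans (≈ᵍ-sym (gmul-gnegˡ _ _)) (gmul-cong (≈ᵍ-sym (gpar-D w' f₀)) ≈ᵍ-refl))
               (gneg-cong (gmul-cong (gpar-involutive f₀) ≈ᵍ-refl))) ⟩
      gadd (gadd X Y) (gadd Z W)
        A.≈⟨ A.interchange _ _ _ _ ⟩
      gadd (gadd X Z) (gadd Y W)
        -- On the right, differentiating χ₀ in the first factor gives `T` and differentiating it in
        -- the second gives `- T`. The left side has no such term, as χ₀ χ₀ = 0, so both are
        -- inserted here.
        A.≈⟨ ≈ᵍ-sym (gadd-cancel-middle _ _ T) ⟩
      gadd (gadd (gadd X Z) T) (gadd (gneg T) (gadd Y W)) A.∎
    p₁ = A.begin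
      gadd (gmul (gneg (D w' f₁)) g₀) (gmul (gpar (gadd (D w' f₀) (gscale a f₁))) g₁)
        A.≈⟨ gadd-cong (gmul-gnegˡ _ _) (≈ᵍ-trans (gmul-cong (≈ᵍ-trans (gpar-gadd _ _) (gadd-cong ≈ᵍ-refl (gpar-gscale a f₁))) ≈ᵍ-refl)
              (≈ᵍ-trans (gmul-distribʳ _ _ _) (gadd-cong ≈ᵍ-refl (gmul-gscaleˡ a _ _)))) ⟩
      gadd X (gadd Z T)
        A.≈⟨ ≈ᵍ-sym (gadd-assoc _ _ _) ⟩
      gadd (gadd X Z) T A.∎
    p₂ = A.begin
      gadd (gmul (gneg (gpar f₁)) (gadd (D w' g₀) (gscale a g₁))) (gmul (gpar (gpar f₀)) (gneg (D w' g₁)))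
        A.≈⟨ gadd-cong (≈ᵍ-trans (gmul-gnegˡ _ _) (≈ᵍ-trans (gneg-cong (≈ᵍ-trans (gmul-distribˡ _ _ _) (gadd-cong ≈ᵍ-refl (gmul-gscaleʳ a _ _)))) (gneg-gadd _ _)))
              (≈ᵍ-trans (gmul-cong (gpar-involutive f₀) ≈ᵍ-refl) (gmul-gnegʳ _ _)) ⟩
      gadd (gadd Y (gneg T)) W
        A.≈⟨ ≈ᵍ-trans (gadd-cong (gadd-comm _ _) ≈ᵍ-refl) (gadd-assoc _ _ _) ⟩
      gadd (gneg T) (gadd Y W) A.∎
    odd = ≈ᵍ-trans lhs (≈ᵍ-sym (gadd-cong p₁ p₂))

  berezin-cong : ∀ {n} {f g : Grass n} → f ≈ᵍ g → berezin f ≈ berezin g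
  berezin-cong (scalar p) = p
  berezin-cong (split p q) = berezin-cong q

  berezin-gadd : ∀ {n} (f g : Grass n) → berezin (gadd f g) ≈ berezin f + berezin g
  berezin-gadd (scalar a) (scalar b) = K.refl
  berezin-gadd (split f₀ f₁) (split g₀ g₁) = berezin-gadd f₁ g₁

  berezin-gscale : ∀ {n} a (f : Grass n) → berezin (gscale a f) ≈ a * berezin f
  berezin-gscale a (scalar b) = K.refl
  berezin-gscale a (split f₀ f₁) = berezin-gscale a f₁

  berezin-gzero : ∀ {n} → berezin (gzero {n}) ≈ 0#
  berezin-gzero {zero} = K.refl
  berezin-gzero {suc n} = berezin-gzero {n}

  -- The χ₀-part of a derivative is minus a derivative in one generator fewer, and with no
  -- generators left every derivative is 0.
  berezin-D : ∀ {n} w (f : Grass n) → berezin (D w f) ≈ 0#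
  berezin-D w (scalar a) = K.refl
  berezin-D w (split f₀ f₁) = K.trans (berezin-gscale (- 1#) (D (w ∘ suc) f₁))
    (K.trans (K.*-cong K.refl (berezin-D _ f₁)) (K.zeroʳ _))

-- Products of generators and of their differences.

oddᵇ-suc : ∀ k → oddᵇ (suc k) ≡ not (oddᵇ k)
oddᵇ-suc zero = refl
oddᵇ-suc (suc zero) = refl
oddᵇ-suc (suc (suc k)) = oddᵇ-suc k

module GrassProducts {c ℓ : Level} (K : CommutativeRing c ℓ) (φ : ℚ → CommutativeRing.Carrier K) where

  open OverRing K φ renaming (gadd to infixl 6 _⊕_; gmul to infixl 7 _⊗_)
  open GrassRing K φ
  open Derivation K φ
  private
    module K = CommutativeRing K
    module A {n : ℕ} where
      open Relation.Binary.Reasoning.Setoid (gsetoid n) public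
  open CommutativeRing K using (Carrier; _+_; _*_; -_; 0#; 1#)

  χs : ∀ {n} → List (Fin n) → Grass n
  χs xs = gprod (map χ xs)

  θ : ∀ {n} → Fin n → Fin n → Grass n
  θ r b = χ b ⊕ gneg (χ r)

  θs : ∀ {n} → Fin n → List (Fin n) → Grass n
  θs r bs = gprod (map (θ r) bs)

  HasParity : ∀ {n} → Bool → Grass n → Set (c ⊔ ℓ)
  HasParity false = Even′
  HasParity true = Odd′

  ≡⇒≈ᵍ : ∀ {n} {f g : Grass n} → f ≡ g → f ≈ᵍ g
  ≡⇒≈ᵍ refl = ≈ᵍ-refl

  gone-identityˡ : ∀ {n} (f : Grass n) → gone ⊗ f ≈ᵍ f
  gone-identityˡ f = ≈ᵍ-trans (gmul-gconstˡ 1# f) (gscale-identity f)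

  gone-identityʳ : ∀ {n} (f : Grass n) → f ⊗ gone ≈ᵍ f
  gone-identityʳ f = ≈ᵍ-trans (gmul-gconstʳ 1# f) (gscale-identity f)

  χ-odd : ∀ {n} (j : Fin n) → Odd′ (χ j)
  χ-odd zero = split (≈ᵍ-trans (gpar-gconst 0#) (≈ᵍ-sym gzero-gneg)) (gneg-cong (gpar-gconst 1#))
  χ-odd (suc j) = split (χ-odd j) (gneg-cong (gpar-gconst 0#))

  Even′-gscale : ∀ {n} a {f : Grass n} → Even′ f → Even′ (gscale a f)
  Even′-gscale a p = ≈ᵍ-trans (gpar-gscale a _) (gscale-cong K.refl p)

  odd⊗-parity : ∀ {n} {f g : Grass n} b → Odd′ f → HasParity b g → HasParity (not b) (f ⊗ g)
  odd⊗-parity false o e = ≈ᵍ-trans (gpar-gmul _ _) (≈ᵍ-trans (gmul-cong o e) (gmul-gnegˡ _ _))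
  odd⊗-parity true o e = ≈ᵍ-trans (gpar-gmul _ _) (≈ᵍ-trans (gmul-cong o e)
    (≈ᵍ-trans (gmul-gnegˡ _ _) (≈ᵍ-trans (gneg-cong (gmul-gnegʳ _ _)) (gneg-involutive _))))

  gprod-parity : ∀ {n} {a} {X : Set a} (f : X → Grass n) → (∀ x → Odd′ (f x)) →
    ∀ xs → HasParity (oddᵇ (length xs)) (gprod (map f xs))
  gprod-parity f o [] = gpar-gconst 1#
  gprod-parity f o (x ∷ xs) = subst (λ b → HasParity b (f x ⊗ gprod (map f xs))) (≡.sym (oddᵇ-suc (length xs)))
    (odd⊗-parity (oddᵇ (length xs)) (o x) (gprod-parity f o xs))

  gprod-++ : ∀ {n} (fs gs : List (Grass n)) → gprod (fs ++ gs) ≈ᵍ gprod fs ⊗ gprod gs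
  gprod-++ [] gs = ≈ᵍ-sym (gone-identityˡ _)
  gprod-++ (f ∷ fs) gs = ≈ᵍ-trans (gmul-cong ≈ᵍ-refl (gprod-++ fs gs)) (≈ᵍ-sym (gmul-assoc _ _ _))

  χs-++ : ∀ {n} (xs ys : List (Fin n)) → χs (xs ++ ys) ≈ᵍ χs xs ⊗ χs ys
  χs-++ [] ys = ≈ᵍ-sym (gone-identityˡ _)
  χs-++ (x ∷ xs) ys = ≈ᵍ-trans (gmul-cong ≈ᵍ-refl (χs-++ xs ys)) (≈ᵍ-sym (gmul-assoc _ _ _))

  gprod-↭-All : ∀ {n} {a} {X : Set a} (f : X → Grass n) {xs ys} → All (λ x → Even′ (f x)) xs →
    xs ↭ ys → gprod (map f xs) ≈ᵍ gprod (map f ys)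
  gprod-↭-All f es refl = ≈ᵍ-refl
  gprod-↭-All f (_ ∷ es) (prep x p) = gmul-cong ≈ᵍ-refl (gprod-↭-All f es p)
  gprod-↭-All f (e ∷ _ ∷ es) (swap x y p) = ≈ᵍ-trans (≈ᵍ-sym (gmul-assoc _ _ _))
    (≈ᵍ-trans (gmul-cong (even-comm e (f y)) (gprod-↭-All f es p)) (gmul-assoc _ _ _))
  gprod-↭-All f es (trans p q) = ≈ᵍ-trans (gprod-↭-All f es p) (gprod-↭-All f (All-resp-↭ p es) q)

  gprod-↭ : ∀ {n} {a} {X : Set a} (f : X → Grass n) → (∀ x → Even′ (f x)) →
    ∀ {xs ys} → xs ↭ ys → gprod (map f xs) ≈ᵍ gprod (map f ys)
  gprod-↭ f e {xs} = gprod-↭-All f (All.universal e xs)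

  χ-anticomm : ∀ {n} (i j : Fin n) → χ i ⊗ χ j ≈ᵍ gneg (χ j ⊗ χ i)
  χ-anticomm i j = ≈ᵍ-trans (odd-comm (χ-odd i) (χ j))
    (≈ᵍ-trans (gmul-cong (χ-odd j) ≈ᵍ-refl) (gmul-gnegˡ _ _))

  χ-square : ∀ {n} (j : Fin n) → χ j ⊗ χ j ≈ᵍ gzero
  χ-square zero = split (gmul-zeroˡ _) (≈ᵍ-trans
    (gadd-cong (gmul-zeroʳ _) (≈ᵍ-trans (gmul-cong (gpar-gconst 0#) ≈ᵍ-refl) (gmul-zeroˡ _))) (gadd-identityˡ _))
  χ-square (suc j) = split (χ-square j) (≈ᵍ-trans (gadd-cong (gmul-zeroˡ _) (gmul-zeroʳ _)) (gadd-identityˡ _))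

  -- χ b can be moved past Y at the cost of replacing Y by gpar Y.
  kill-extend : ∀ {n} {M : Grass n} {b} → M ⊗ χ b ≈ᵍ gzero → ∀ Y → (M ⊗ Y) ⊗ χ b ≈ᵍ gzero
  kill-extend {M = M} {b} p Y = A.begin
    (M ⊗ Y) ⊗ χ b            A.≈⟨ gmul-assoc _ _ _ ⟩
    M ⊗ (Y ⊗ χ b)            A.≈⟨ gmul-cong ≈ᵍ-refl (gmul-cong (≈ᵍ-sym (gpar-involutive Y)) ≈ᵍ-refl) ⟩
    M ⊗ (gpar (gpar Y) ⊗ χ b) A.≈⟨ gmul-cong ≈ᵍ-refl (≈ᵍ-sym (odd-comm (χ-odd b) (gpar Y))) ⟩
    M ⊗ (χ b ⊗ gpar Y)       A.≈⟨ ≈ᵍ-sym (gmul-assoc _ _ _) ⟩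
    (M ⊗ χ b) ⊗ gpar Y       A.≈⟨ gmul-cong p ≈ᵍ-refl ⟩
    gzero ⊗ gpar Y           A.≈⟨ gmul-zeroˡ _ ⟩
    gzero A.∎

  χs-kill : ∀ {n} {b : Fin n} {bs} → b ∈ bs → χs bs ⊗ χ b ≈ᵍ gzero
  χs-kill (here refl) = kill-extend (χ-square _) _
  χs-kill (there p) = ≈ᵍ-trans (gmul-assoc _ _ _) (≈ᵍ-trans (gmul-cong ≈ᵍ-refl (χs-kill p)) (gmul-zeroʳ _))

  kill-χs : ∀ {n} {M : Grass n} {b bs} → M ⊗ χ b ≈ᵍ gzero → b ∈ bs → M ⊗ χs bs ≈ᵍ gzero
  kill-χs p (here refl) = ≈ᵍ-trans (≈ᵍ-sym (gmul-assoc _ _ _)) (≈ᵍ-trans (gmul-cong p ≈ᵍ-refl) (gmul-zeroˡ _))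
  kill-χs p (there q) = ≈ᵍ-trans (≈ᵍ-sym (gmul-assoc _ _ _)) (kill-χs (kill-extend p _) q)

  -- Induction with `M` replaced by `M ⊗ χ b`, which χ r still annihilates by `kill-extend`; so
  -- every factor χ b - χ r loses its second term in turn.
  θs⇒χs : ∀ {n} {M : Grass n} {r} → M ⊗ χ r ≈ᵍ gzero → ∀ bs → M ⊗ θs r bs ≈ᵍ M ⊗ χs bs
  θs⇒χs p [] = ≈ᵍ-refl
  θs⇒χs {M = M} {r} p (b ∷ bs) = A.begin
    M ⊗ (θ r b ⊗ θs r bs)     A.≈⟨ ≈ᵍ-sym (gmul-assoc _ _ _) ⟩
    (M ⊗ θ r b) ⊗ θs r bs     A.≈⟨ gmul-cong (≈ᵍ-trans (gmul-distribˡ _ _ _)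
                                   (≈ᵍ-trans (gadd-cong ≈ᵍ-refl (≈ᵍ-trans (gmul-gnegʳ _ _)
                                     (≈ᵍ-trans (gneg-cong p) gzero-gneg))) (gadd-identityʳ _))) ≈ᵍ-refl ⟩
    (M ⊗ χ b) ⊗ θs r bs       A.≈⟨ θs⇒χs (kill-extend p _) bs ⟩
    (M ⊗ χ b) ⊗ χs bs         A.≈⟨ gmul-assoc _ _ _ ⟩
    M ⊗ (χ b ⊗ χs bs) A.∎

  D-gmul-closed : ∀ {n} w {f g : Grass n} → D w f ≈ᵍ gzero → D w g ≈ᵍ gzero → D w (f ⊗ g) ≈ᵍ gzero
  D-gmul-closed w p q = ≈ᵍ-trans (Leibniz w _ _) (≈ᵍ-trans
    (gadd-cong (≈ᵍ-trans (gmul-cong p ≈ᵍ-refl) (gmul-zeroˡ _)) (≈ᵍ-trans (gmul-cong ≈ᵍ-refl q) (gmul-zeroʳ _)))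
    (gadd-identityˡ _))

  D-gprod-closed : ∀ {n} {a} {X : Set a} w (f : X → Grass n) → (∀ x → D w (f x) ≈ᵍ gzero) →
    ∀ xs → D w (gprod (map f xs)) ≈ᵍ gzero
  D-gprod-closed w f p [] = D-gconst w 1#
  D-gprod-closed w f p (x ∷ xs) = D-gmul-closed w (p x) (D-gprod-closed w f p xs)

  gconst-difference : ∀ {n} {a b} → a ≈ b → gconst {n} a ⊕ gneg (gconst b) ≈ᵍ gzero
  gconst-difference p = ≈ᵍ-trans (gadd-cong (gconst-cong p) ≈ᵍ-refl) (gneg-inverseʳ _)

  D-θ : ∀ {n} w {r b : Fin n} → w b ≈ w r → D w (θ r b) ≈ᵍ gzero
  D-θ w p = ≈ᵍ-trans (D-gadd w _ _) (≈ᵍ-trans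
    (gadd-cong (D-χ w _) (≈ᵍ-trans (D-gscale w (- 1#) _) (gneg-cong (D-χ w _)))) (gconst-difference p))

  D-θs : ∀ {n} w {r : Fin n} bs → (∀ {b} → b ∈ bs → w b ≈ w r) → D w (θs r bs) ≈ᵍ gzero
  D-θs w [] p = D-gconst w 1#
  D-θs w (b ∷ bs) p = D-gmul-closed w (D-θ w (p (here refl))) (D-θs w bs (p ∘ there))

  ∂ : ∀ {n} → Grass n → Grass n
  ∂ = D (λ _ → 1#)

  -- A contracting homotopy: on closed elements, multiplication by a generator of weight 1 is a
  -- section of `D w`, so closed elements are exact.
  D-χ⊗ : ∀ {n} w {v : Fin n} {P} → w v ≈ 1# → D w P ≈ᵍ gzero → D w (χ v ⊗ P) ≈ᵍ P
  D-χ⊗ w {v} {P} p q = A.begin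
    D w (χ v ⊗ P) A.≈⟨ Leibniz w _ _ ⟩
    (D w (χ v) ⊗ P) ⊕ (gpar (χ v) ⊗ D w P)
      A.≈⟨ gadd-cong (≈ᵍ-trans (gmul-cong (≈ᵍ-trans (D-χ w v) (gconst-cong p)) ≈ᵍ-refl) (gone-identityˡ _))
                     (≈ᵍ-trans (gmul-cong ≈ᵍ-refl q) (gmul-zeroʳ _)) ⟩
    P ⊕ gzero A.≈⟨ gadd-identityʳ _ ⟩
    P A.∎

  -- `P` is the derivative of `χ v ⊗ P`, and derivatives have no top coefficient.
  berezin-closed : ∀ {n} w {v : Fin n} {P} → w v ≈ 1# → D w P ≈ᵍ gzero → berezin P ≈ 0#
  berezin-closed w {v} {P} p q = K.trans (berezin-cong (≈ᵍ-sym (D-χ⊗ w {v} p q))) (berezin-D w (χ v ⊗ P))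

  -- After χ a the other factors may be replaced by the differences χ b - χ a, as χ a squares to
  -- zero. The differences are closed under `∂`, which therefore only strips χ a.
  ∂-χs : ∀ {n} (a : Fin n) bs → ∂ (χs (a ∷ bs)) ≈ᵍ θs a bs
  ∂-χs a bs = ≈ᵍ-trans (D-cong _ (≈ᵍ-sym (θs⇒χs (χ-square a) bs)))
    (D-χ⊗ _ K.refl (D-θs _ bs (λ _ → K.refl)))

  oddᵇ-++ : ∀ {a} {X : Set a} (xs ys : List X) → oddᵇ (length (xs ++ ys)) ≡ oddᵇ (length xs) xor oddᵇ (length ys)
  oddᵇ-++ [] ys = refl
  oddᵇ-++ (x ∷ xs) ys
    rewrite oddᵇ-suc (length (xs ++ ys)) | oddᵇ-suc (length xs) | oddᵇ-++ xs ys
    with oddᵇ (length xs)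
  ... | true = not-involutive _
  ... | false = refl

  -- One of the two pieces of an odd word has even length, and its product is central.
  χs-rotate : ∀ {n} (xs ys : List (Fin n)) → Odd (length (xs ++ ys)) → χs (xs ++ ys) ≈ᵍ χs (ys ++ xs)
  χs-rotate xs ys o = ≈ᵍ-trans (χs-++ xs ys) (≈ᵍ-trans swapped (≈ᵍ-sym (χs-++ ys xs)))
    where
    swapped : χs xs ⊗ χs ys ≈ᵍ χs ys ⊗ χs xs
    swapped with oddᵇ (length xs) | oddᵇ (length ys) | ≡.trans (≡.sym (oddᵇ-++ xs ys)) o
               | gprod-parity χ χ-odd xs | gprod-parity χ χ-odd ys
    ... | false | true | _ | e | _ = even-comm e (χs ys)
    ... | true | false | _ | _ | e = ≈ᵍ-sym (even-comm e (χs xs))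

  -- The origin of the circulation: rotating r to the front costs no sign, and what follows r is
  -- then `ys ++ xs`.
  ∂-χs-rotate : ∀ {n} xs (r : Fin n) ys → Odd (length (xs ++ r ∷ ys)) → ∂ (χs (xs ++ r ∷ ys)) ≈ᵍ θs r (ys ++ xs)
  ∂-χs-rotate xs r ys o = ≈ᵍ-trans (D-cong _ (χs-rotate xs (r ∷ ys) o)) (∂-χs r (ys ++ xs))

  ∂-χs-even : ∀ {n} (xs : List (Fin n)) → Odd (length xs) → Even′ (∂ (χs xs))
  ∂-χs-even xs o with oddᵇ (length xs) | o | gprod-parity χ χ-odd xs
  ... | true | _ | p = ≈ᵍ-trans (gpar-D _ _) (≈ᵍ-trans (gneg-cong (D-cong _ p))
          (≈ᵍ-trans (gneg-cong (D-gscale _ (- 1#) _)) (gneg-involutive _)))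

  θ-square : ∀ {n} (r b : Fin n) → θ r b ⊗ θ r b ≈ᵍ gzero
  θ-square r b = A.begin
    (χ b ⊕ gneg (χ r)) ⊗ θ r b
      A.≈⟨ gmul-distribʳ _ _ _ ⟩
    χ b ⊗ θ r b ⊕ gneg (χ r) ⊗ θ r b
      A.≈⟨ gadd-cong (gmul-distribˡ _ _ _) (≈ᵍ-trans (gmul-gnegˡ _ _) (gneg-cong (gmul-distribˡ _ _ _))) ⟩
    (χ b ⊗ χ b ⊕ χ b ⊗ gneg (χ r)) ⊕ gneg (χ r ⊗ χ b ⊕ χ r ⊗ gneg (χ r))
      A.≈⟨ gadd-cong (≈ᵍ-trans (gadd-cong (χ-square b) (≈ᵍ-trans (gmul-gnegʳ _ _)
                       (≈ᵍ-trans (gneg-cong (χ-anticomm b r)) (gneg-involutive _)))) (gadd-identityˡ _))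
                     (gneg-cong (≈ᵍ-trans (gadd-cong ≈ᵍ-refl (≈ᵍ-trans (gmul-gnegʳ _ _)
                       (≈ᵍ-trans (gneg-cong (χ-square r)) gzero-gneg))) (gadd-identityʳ _))) ⟩
    χ r ⊗ χ b ⊕ gneg (χ r ⊗ χ b)
      A.≈⟨ gneg-inverseʳ _ ⟩
    gzero A.∎

  -- The factor is even, so its second copy can be moved next to the leading θ a b of the first; θ a
  -- b then occurs twice in a row.
  ∂-χs-square : ∀ {n} (a b : Fin n) bs → Odd (length (a ∷ b ∷ bs)) →
    ∂ (χs (a ∷ b ∷ bs)) ⊗ ∂ (χs (a ∷ b ∷ bs)) ≈ᵍ gzero
  ∂-χs-square a b bs o = A.begin
    S ⊗ S                                    A.≈⟨ gmul-cong (∂-χs a (b ∷ bs)) ≈ᵍ-refl ⟩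
    (θ a b ⊗ T) ⊗ S                          A.≈⟨ gmul-assoc _ _ _ ⟩
    θ a b ⊗ (T ⊗ S)                          A.≈⟨ gmul-cong ≈ᵍ-refl (≈ᵍ-sym (even-comm (∂-χs-even (a ∷ b ∷ bs) o) T)) ⟩
    θ a b ⊗ (S ⊗ T)                          A.≈⟨ ≈ᵍ-sym (gmul-assoc _ _ _) ⟩
    (θ a b ⊗ S) ⊗ T                          A.≈⟨ gmul-cong (gmul-cong ≈ᵍ-refl (∂-χs a (b ∷ bs))) ≈ᵍ-refl ⟩
    (θ a b ⊗ (θ a b ⊗ T)) ⊗ T                A.≈⟨ gmul-cong (≈ᵍ-trans (≈ᵍ-sym (gmul-assoc _ _ _))
                                                   (≈ᵍ-trans (gmul-cong (θ-square a b) ≈ᵍ-refl) (gmul-zeroˡ _))) ≈ᵍ-refl ⟩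
    gzero ⊗ T                                A.≈⟨ gmul-zeroˡ _ ⟩
    gzero A.∎
    where
    S = ∂ (χs (a ∷ b ∷ bs))
    T = θs a bs

-- Inversion counts of lifted permutations and of a transposition.

inversions-step-suc : ∀ {n} (x : Fin n) (xs : List (Fin n)) →
  length (filterᵇ (λ y → toℕ y <ᵇ toℕ (Fin.suc x)) (map Fin.suc xs)) ≡ length (filterᵇ (λ y → toℕ y <ᵇ toℕ x) xs)
inversions-step-suc x [] = refl
inversions-step-suc x (y ∷ ys) with toℕ y <ᵇ toℕ x
... | true = cong suc (inversions-step-suc x ys)
... | false = inversions-step-suc x ys

inversions-map-suc : ∀ {n} (xs : List (Fin n)) → inversions (map Fin.suc xs) ≡ inversions xs
inversions-map-suc [] = refl
inversions-map-suc {n} (x ∷ xs) = cong₂ Data.Nat._+_ (inversions-step-suc x xs) (inversions-map-suc xs)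

filter-<0 : ∀ {n} (xs : List (Fin n)) → length (filterᵇ (λ y → toℕ y <ᵇ 0) xs) ≡ 0
filter-<0 [] = refl
filter-<0 (x ∷ xs) = filter-<0 xs

inversions-zero∷ : ∀ {n} (xs : List (Fin n)) → inversions (zero ∷ map Fin.suc xs) ≡ inversions xs
inversions-zero∷ xs = cong₂ Data.Nat._+_ (filter-<0 (map Fin.suc xs)) (inversions-map-suc xs)

toList-tabulate-suc : ∀ {k m} (f : Fin k → Fin m) →
  toList (Vec.tabulate (λ j → Fin.suc (f j))) ≡ map Fin.suc (toList (Vec.tabulate f))
toList-tabulate-suc {zero} f = refl
toList-tabulate-suc {suc k} f = cong (λ l → Fin.suc (f zero) List.∷ l) (toList-tabulate-suc (λ j → f (suc j)))

inversions-lift₀ : ∀ {k} (σ : Permutation′ k) →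
  inversions (toList (Vec.tabulate (lift₀ σ ⟨$⟩ʳ_))) ≡ inversions (toList (Vec.tabulate (σ ⟨$⟩ʳ_)))
inversions-lift₀ {k} σ = ≡.trans (cong (λ l → inversions {suc k} (zero ∷ l)) (toList-tabulate-suc (σ ⟨$⟩ʳ_)))
  (inversions-zero∷ (toList (Vec.tabulate (σ ⟨$⟩ʳ_))))

inversions-allFin : ∀ k → inversions (toList (Vec.tabulate {n = k} (λ j → j))) ≡ 0
inversions-allFin zero = refl
inversions-allFin (suc k) = ≡.trans
  (≡.trans (cong (λ l → inversions {suc k} (zero ∷ l)) (toList-tabulate-suc {k} (λ j → j)))
    (inversions-zero∷ (toList (Vec.tabulate {n = k} (λ j → j)))))
  (inversions-allFin k)

inversions-transpose : ∀ k → inversions (toList (Vec.tabulate {n = suc (suc k)} (transpose zero (suc zero) ⟨$⟩ʳ_))) ≡ 1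
inversions-transpose k = ≡.trans (cong (λ l → inversions {suc (suc k)} (suc zero ∷ zero ∷ l)) step)
  (cong₂ Data.Nat._+_ (cong suc (≡.trans (inversions-step-suc {suc k} zero (map Fin.suc l)) (filter-<0 {suc k} (map Fin.suc l))))
    (≡.trans (inversions-zero∷ (map Fin.suc l)) (≡.trans (inversions-map-suc l) (inversions-allFin k))))
  where
  l = toList (Vec.tabulate {n = k} (λ j → j))
  step : toList (Vec.tabulate {n = k} (λ j → Fin.suc (Fin.suc j))) ≡ map Fin.suc (map Fin.suc l)
  step = ≡.trans (toList-tabulate-suc {k} {suc k} Fin.suc) (cong (map Fin.suc) (toList-tabulate-suc {k} {k} (λ j → j)))

-- Contractions of alternating tensors as sums over subsets.

elems : ∀ {n} → Subset n → List (Fin n)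
elems [] = []
elems (true ∷ A) = zero ∷ map suc (elems A)
elems (false ∷ A) = map suc (elems A)

subsets : ∀ n → ℕ → List (Subset n)
subsets zero zero = [] ∷ []
subsets zero (suc k) = []
subsets (suc n) zero = map (outside ∷_) (subsets n zero)
subsets (suc n) (suc k) = map (outside ∷_) (subsets n (suc k)) ++ map (inside ∷_) (subsets n k)

module Alternating {c ℓ : Level} (K : CommutativeRing c ℓ) (φ : ℚ → CommutativeRing.Carrier K) where

  open OverRing K φ renaming (gadd to infixl 6 _⊕_; gmul to infixl 7 _⊗_)
  open GrassRing K φ
  open Derivation K φ
  open GrassProducts K φ
  private
    module K = CommutativeRing K
    module KP = Algebra.Properties.Ring K.ring
    module A {n : ℕ} where
      open Relation.Binary.Reasoning.Setoid (gsetoid n) public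
      open Algebra.Properties.CommutativeSemigroup (AbelianGroup.commutativeSemigroup (gaddGroup n)) public
  open CommutativeRing K using (Carrier; _+_; _*_; -_; 0#; 1#)

  gsum-++ : ∀ {n} (fs gs : List (Grass n)) → gsum (fs ++ gs) ≈ᵍ gsum fs ⊕ gsum gs
  gsum-++ [] gs = ≈ᵍ-sym (gadd-identityˡ _)
  gsum-++ (f ∷ fs) gs = ≈ᵍ-trans (gadd-cong ≈ᵍ-refl (gsum-++ fs gs)) (≈ᵍ-sym (gadd-assoc _ _ _))

  gsum-cong : ∀ {n} {a} {X : Set a} {f g : X → Grass n} → (∀ x → f x ≈ᵍ g x) →
    ∀ xs → gsum (map f xs) ≈ᵍ gsum (map g xs)
  gsum-cong p [] = ≈ᵍ-refl
  gsum-cong p (x ∷ xs) = gadd-cong (p x) (gsum-cong p xs)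

  gmul-gsumˡ : ∀ {n} {a} {X : Set a} h (f : X → Grass n) xs →
    h ⊗ gsum (map f xs) ≈ᵍ gsum (map (λ x → h ⊗ f x) xs)
  gmul-gsumˡ h f [] = gmul-zeroʳ h
  gmul-gsumˡ h f (x ∷ xs) = ≈ᵍ-trans (gmul-distribˡ _ _ _) (gadd-cong ≈ᵍ-refl (gmul-gsumˡ h f xs))

  D-gsum : ∀ {n} {a} {X : Set a} w (f : X → Grass n) xs →
    D w (gsum (map f xs)) ≈ᵍ gsum (map (λ x → D w (f x)) xs)
  D-gsum w f [] = D-gconst w 0#
  D-gsum w f (x ∷ xs) = ≈ᵍ-trans (D-gadd w _ _) (gadd-cong ≈ᵍ-refl (D-gsum w f xs))

  gsum-concatMap : ∀ {n} {a b} {X : Set a} {Y : Set b} (f : Y → Grass n) (g : X → List Y) xs →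
    gsum (map f (concatMap g xs)) ≈ᵍ gsum (map (λ x → gsum (map f (g x))) xs)
  gsum-concatMap f g [] = ≈ᵍ-refl
  gsum-concatMap f g (x ∷ xs) = ≈ᵍ-trans (≡⇒≈ᵍ (cong gsum (map-++ f (g x) (concatMap g xs))))
    (≈ᵍ-trans (gsum-++ (map f (g x)) _) (gadd-cong ≈ᵍ-refl (gsum-concatMap f g xs)))

  gsum-map-map : ∀ {n} {a b} {X : Set a} {Y : Set b} (f : Y → Grass n) (g : X → Y) xs →
    gsum (map f (map g xs)) ≈ᵍ gsum (map (f ∘ g) xs)
  gsum-map-map f g xs = ≡⇒≈ᵍ (cong gsum (≡.sym (map-∘ xs)))

  abstract
    -- Sums over `Fin m` allow exchange of summation and splitting off the index 0. They are
    -- abstract, so that they unfold only through `∑-zero` and `∑-suc`.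
    ∑ : ∀ {m n} → (Fin m → Grass n) → Grass n
    ∑ {zero} f = gzero
    ∑ {suc m} f = f zero ⊕ ∑ (f ∘ suc)

    ∑-tabulate : ∀ {a} {X : Set a} {m n} (f : X → Grass n) (g : Fin m → X) → gsum (map f (tabulate g)) ≡ ∑ (f ∘ g)
    ∑-tabulate {m = zero} f g = refl
    ∑-tabulate {m = suc m} f g = cong (f (g zero) ⊕_) (∑-tabulate f (g ∘ suc))

    ∑-zero : ∀ {n} (f : Fin zero → Grass n) → ∑ f ≡ gzero
    ∑-zero f = refl

    ∑-suc : ∀ {m n} (f : Fin (suc m) → Grass n) → ∑ f ≡ f zero ⊕ ∑ (f ∘ suc)
    ∑-suc f = refl

    ∑-cong : ∀ {m n} {f g : Fin m → Grass n} → (∀ a → f a ≈ᵍ g a) → ∑ f ≈ᵍ ∑ g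
    ∑-cong {zero} p = ≈ᵍ-refl
    ∑-cong {suc m} p = gadd-cong (p zero) (∑-cong (p ∘ suc))

    ∑-gzero : ∀ m {n} → ∑ {m} {n} (λ _ → gzero) ≈ᵍ gzero
    ∑-gzero zero = ≈ᵍ-refl
    ∑-gzero (suc m) = ≈ᵍ-trans (gadd-identityˡ _) (∑-gzero m)

    ∑-gadd : ∀ {m n} (f g : Fin m → Grass n) → ∑ (λ a → f a ⊕ g a) ≈ᵍ ∑ f ⊕ ∑ g
    ∑-gadd {zero} f g = ≈ᵍ-sym (gadd-identityˡ _)
    ∑-gadd {suc m} f g = ≈ᵍ-trans (gadd-cong ≈ᵍ-refl (∑-gadd (f ∘ suc) (g ∘ suc))) (A.interchange _ _ _ _)

    ∑-gscale : ∀ {m n} a (f : Fin m → Grass n) → ∑ (λ j → gscale a (f j)) ≈ᵍ gscale a (∑ f)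
    ∑-gscale {zero} a f = ≈ᵍ-sym (gscale-zeroʳ a)
    ∑-gscale {suc m} a f = ≈ᵍ-trans (gadd-cong ≈ᵍ-refl (∑-gscale a (f ∘ suc))) (≈ᵍ-sym (gscale-distribˡ a _ _))

    ∑-gmulˡ : ∀ {m n} h (f : Fin m → Grass n) → ∑ (λ j → h ⊗ f j) ≈ᵍ h ⊗ ∑ f
    ∑-gmulˡ {zero} h f = ≈ᵍ-sym (gmul-zeroʳ h)
    ∑-gmulˡ {suc m} h f = ≈ᵍ-trans (gadd-cong ≈ᵍ-refl (∑-gmulˡ h (f ∘ suc))) (≈ᵍ-sym (gmul-distribˡ h _ _))

    ∑-swap : ∀ {m k n} (f : Fin m → Fin k → Grass n) → ∑ (λ a → ∑ (λ b → f a b)) ≈ᵍ ∑ (λ b → ∑ (λ a → f a b))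
    ∑-swap {zero} {k} f = ≈ᵍ-sym (∑-gzero k)
    ∑-swap {suc m} f = ≈ᵍ-trans (gadd-cong ≈ᵍ-refl (∑-swap (f ∘ suc)))
      (≈ᵍ-sym (∑-gadd (f zero) (λ b → ∑ (λ a → f (suc a) b))))

    ∑-split : ∀ {m n} (f g : Fin m → Grass n) → ∑ (λ a → split (f a) (g a)) ≈ᵍ split (∑ f) (∑ g)
    ∑-split {zero} f g = ≈ᵍ-refl
    ∑-split {suc m} f g = gadd-cong ≈ᵍ-refl (∑-split (f ∘ suc) (g ∘ suc))

    D-∑ : ∀ {m n} w (f : Fin m → Grass n) → D w (∑ f) ≈ᵍ ∑ (λ a → D w (f a))
    D-∑ {zero} w f = D-gconst w 0#
    D-∑ {suc m} w f = ≈ᵍ-trans (D-gadd w _ _) (gadd-cong ≈ᵍ-refl (D-∑ w (f ∘ suc)))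

  -- Alternation under exchanges of neighbours, for the values of T on lists of length k.
  Alt : ∀ {n} → ℕ → (List (Fin n) → Carrier) → Set ℓ
  Alt zero T = Unit
  Alt (suc k) T = (∀ a → Alt k (T ∘ (a ∷_)))
                × (∀ a b l → suc (length l) ≡ k → T (a ∷ b ∷ l) ≈ - T (b ∷ a ∷ l))

  Antisymmetric-∷ : ∀ {n k} {t : Vec (Fin n) (suc k) → Carrier} →
    Antisymmetric (suc k) t → ∀ a → Antisymmetric k (t ∘ (a ∷_))
  Antisymmetric-∷ as a σ α = K.trans (as (lift₀ σ) (a ∷ α))
    (K.*-cong (K.reflexive (cong signK (inversions-lift₀ σ))) K.refl)

  Antisymmetric-swap : ∀ {n k} {t : Vec (Fin n) (suc (suc k)) → Carrier} →
    Antisymmetric (suc (suc k)) t → ∀ a b α → t (a ∷ b ∷ α) ≈ - t (b ∷ a ∷ α)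
  Antisymmetric-swap {k = k} {t} as a b α = K.trans
    (K.reflexive (cong (λ v → t (a ∷ b ∷ v)) (≡.sym (Vecₚ.tabulate∘lookup α))))
    (K.trans (as (transpose zero (suc zero)) (b ∷ a ∷ α))
      (K.trans (K.*-cong (K.reflexive (cong signK (inversions-transpose k))) K.refl) (KP.-1*x≈-x _)))

  -- Fixing the first entry keeps antisymmetry, by permutations that fix the first position, and the
  -- first two positions are exchanged by a transposition with one inversion. Recursion under the
  -- first entry yields every other exchange of neighbours.
  Antisymmetric⇒Alt : ∀ {n} k {t : Vec (Fin n) k → Carrier} {T} →
    Antisymmetric k t → (∀ v → T (toList v) ≈ t v) → Alt k T
  Antisymmetric⇒Alt zero as p = tt
  Antisymmetric⇒Alt (suc k) {t} {T} as p =
    (λ a → Antisymmetric⇒Alt k (Antisymmetric-∷ {t = t} as a) (p ∘ (a ∷_))) , swap′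
    where
    at : ∀ a b l → T (a ∷ b ∷ l) ≈ T (toList (a ∷ b ∷ fromList l))
    at a b l = K.reflexive (cong (λ l → T (a ∷ b ∷ l)) (≡.sym (Vecₚ.toList∘fromList l)))
    swap′ : ∀ a b l → suc (length l) ≡ k → T (a ∷ b ∷ l) ≈ - T (b ∷ a ∷ l)
    swap′ a b l refl = K.trans (at a b l) (K.trans (p _) (K.trans (Antisymmetric-swap {t = t} as a b (fromList l))
      (K.-‿cong (K.sym (K.trans (at b a l) (p _))))))

  Alt-map-suc : ∀ {n} k (T : List (Fin (suc n)) → Carrier) → Alt k T → Alt k (T ∘ map suc)
  Alt-map-suc zero T _ = tt
  Alt-map-suc (suc k) T (p , q) = (λ a → Alt-map-suc k (T ∘ (suc a ∷_)) (p (suc a)))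
    , λ a b l e → q (suc a) (suc b) (map suc l) (≡.trans (cong suc (length-map suc l)) e)

  natK : ℕ → Carrier
  natK zero = 0#
  natK (suc k) = 1# + natK k

  factK : ℕ → Carrier
  factK zero = 1#
  factK (suc k) = natK (suc k) * factK k

  -- The full contraction Σ T(α) χ_α over all α ∈ [n]ᵏ.
  contract : ∀ {n} → ℕ → (List (Fin n) → Carrier) → Grass n
  contract zero T = gconst (T [])
  contract (suc k) T = ∑ (λ a → χ a ⊗ contract k (T ∘ (a ∷_)))

  contract-cong : ∀ {n} k {T T′ : List (Fin n) → Carrier} →
    (∀ l → length l ≡ k → T l ≈ T′ l) → contract k T ≈ᵍ contract k T′
  contract-cong zero p = gconst-cong (p [] refl)
  contract-cong (suc k) p = ∑-cong (λ a → gmul-cong ≈ᵍ-refl (contract-cong k (λ l e → p (a ∷ l) (cong suc e))))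

  gconst-gscale : ∀ {n} a b → gconst {n} (a * b) ≈ᵍ gscale a (gconst b)
  gconst-gscale {zero} a b = ≈ᵍ-refl
  gconst-gscale {suc n} a b = split (gconst-gscale a b) (≈ᵍ-sym (gscale-zeroʳ a))

  contract-neg : ∀ {n} k (T : List (Fin n) → Carrier) → contract k (λ l → - T l) ≈ᵍ gneg (contract k T)
  contract-neg zero T = ≈ᵍ-trans (gconst-cong (K.sym (KP.-1*x≈-x _))) (gconst-gscale _ _)
  contract-neg (suc k) T = ≈ᵍ-trans
    (∑-cong (λ a → ≈ᵍ-trans (gmul-cong ≈ᵍ-refl (contract-neg k (T ∘ (a ∷_)))) (gmul-gnegʳ _ _)))
    (∑-gscale (- 1#) _)

  contract-allSeqs : ∀ {n} k (T : List (Fin n) → Carrier) →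
    gsum (map (λ α → gscale (T (toList α)) (χs (toList α))) (allSeqs k)) ≈ᵍ contract k T
  contract-allSeqs zero T = ≈ᵍ-trans (gadd-identityʳ _)
    (≈ᵍ-trans (≈ᵍ-sym (gmul-gconstˡ _ _)) (gone-identityʳ _))
  contract-allSeqs {n} (suc k) T = A.begin
    gsum (map F (concatMap (λ a → map (a ∷_) (allSeqs k)) (allFin n)))
      A.≈⟨ gsum-concatMap F _ (allFin n) ⟩
    gsum (map (λ a → gsum (map F (map (a ∷_) (allSeqs k)))) (allFin n))
      A.≈⟨ ≡⇒≈ᵍ (∑-tabulate (λ a → gsum (map F (map (a ∷_) (allSeqs k)))) (λ a → a)) ⟩
    ∑ (λ a → gsum (map F (map (a ∷_) (allSeqs k))))
      A.≈⟨ ∑-cong (λ a → A.begin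
        gsum (map F (map (a ∷_) (allSeqs k)))
          A.≈⟨ gsum-map-map F _ (allSeqs k) ⟩
        gsum (map (λ α → gscale (T (a ∷ toList α)) (χ a ⊗ χs (toList α))) (allSeqs k))
          A.≈⟨ gsum-cong (λ α → ≈ᵍ-sym (gmul-gscaleʳ _ _ _)) (allSeqs k) ⟩
        gsum (map (λ α → χ a ⊗ gscale (T (a ∷ toList α)) (χs (toList α))) (allSeqs k))
          A.≈⟨ ≈ᵍ-sym (gmul-gsumˡ (χ a) _ (allSeqs k)) ⟩
        χ a ⊗ gsum (map (λ α → gscale (T (a ∷ toList α)) (χs (toList α))) (allSeqs k))
          A.≈⟨ gmul-cong ≈ᵍ-refl (contract-allSeqs k (T ∘ (a ∷_))) ⟩
        χ a ⊗ contract k (T ∘ (a ∷_)) A.∎) ⟩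
    ∑ (λ a → χ a ⊗ contract k (T ∘ (a ∷_))) A.∎
    where
    F : Vec (Fin n) (suc k) → Grass n
    F α = gscale (T (toList α)) (χs (toList α))

  -- In each word `∂` removes one generator at a time. Moving the removed index to the front gives
  -- the same sign in T and in the product of generators, so the `suc k` contributions agree. In the
  -- induction this is the exchange of a and b, whose sign cancels the one from passing χ a.
  ∂-contract : ∀ {n} k (T : List (Fin n) → Carrier) → Alt (suc k) T →
    ∂ (contract (suc k) T) ≈ᵍ gscale (natK (suc k)) (∑ (λ a → contract k (T ∘ (a ∷_))))
  ∂-contract zero T _ = A.begin
    ∂ (∑ (λ a → χ a ⊗ gconst (T (a ∷ []))))
      A.≈⟨ ≈ᵍ-trans (D-∑ _ _) (∑-cong (λ a → D-χ⊗ (λ _ → 1#) K.refl (D-gconst _ (T (a ∷ []))))) ⟩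
    ∑ (λ a → gconst (T (a ∷ [])))
      A.≈⟨ ≈ᵍ-sym (≈ᵍ-trans (gscale-cong (K.+-identityʳ 1#) ≈ᵍ-refl) (gscale-identity _)) ⟩
    gscale (1# + 0#) (∑ (λ a → gconst (T (a ∷ [])))) A.∎
  ∂-contract (suc k) T (alt , sw) = A.begin
    ∂ (∑ (λ a → χ a ⊗ G a))
      A.≈⟨ ≈ᵍ-trans (D-∑ _ _) (∑-cong (λ a → ≈ᵍ-trans (Leibniz _ _ _) (gadd-cong
             (≈ᵍ-trans (gmul-cong (D-χ _ a) ≈ᵍ-refl) (gone-identityˡ _))
             (step a)))) ⟩
    ∑ (λ a → G a ⊕ gscale (natK (suc k)) (∑ (λ b → χ a ⊗ H b a)))
      A.≈⟨ ≈ᵍ-trans (∑-gadd _ _) (gadd-cong ≈ᵍ-refl (∑-gscale (natK (suc k)) _)) ⟩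
    ∑ G ⊕ gscale (natK (suc k)) (∑ (λ a → ∑ (λ b → χ a ⊗ H b a)))
      A.≈⟨ gadd-cong (≈ᵍ-sym (gscale-identity _)) (gscale-cong K.refl (∑-swap (λ a b → χ a ⊗ H b a))) ⟩
    gscale 1# (∑ G) ⊕ gscale (natK (suc k)) (∑ G)
      A.≈⟨ ≈ᵍ-sym (gscale-distribʳ _ _ _) ⟩
    gscale (natK (suc (suc k))) (∑ G) A.∎
    where
    G = λ a → contract (suc k) (T ∘ (a ∷_))
    H = λ a b → contract k (λ l → T (a ∷ b ∷ l))
    step : ∀ a → gpar (χ a) ⊗ ∂ (G a) ≈ᵍ gscale (natK (suc k)) (∑ (λ b → χ a ⊗ H b a))
    step a = A.begin
      gpar (χ a) ⊗ ∂ (G a)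
        A.≈⟨ gmul-cong (χ-odd a) (∂-contract k (T ∘ (a ∷_)) (alt a)) ⟩
      gneg (χ a) ⊗ gscale (natK (suc k)) (∑ (H a))
        A.≈⟨ gmul-gscaleʳ _ _ _ ⟩
      gscale (natK (suc k)) (gneg (χ a) ⊗ ∑ (H a))
        A.≈⟨ gscale-cong K.refl (≈ᵍ-sym (∑-gmulˡ _ _)) ⟩
      gscale (natK (suc k)) (∑ (λ b → gneg (χ a) ⊗ H a b))
        A.≈⟨ gscale-cong K.refl (∑-cong (λ b → ≈ᵍ-trans
               (gmul-cong ≈ᵍ-refl (≈ᵍ-trans (contract-cong k (λ l e → sw a b l (cong suc e))) (contract-neg k _)))
               (≈ᵍ-trans (gmul-gnegˡ _ _) (≈ᵍ-trans (gneg-cong (gmul-gnegʳ _ _)) (gneg-involutive _))))) ⟩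
      gscale (natK (suc k)) (∑ (λ b → χ a ⊗ H b a)) A.∎

  χzero⊗ : ∀ {n} (f₀ f₁ : Grass n) → χ zero ⊗ split f₀ f₁ ≈ᵍ split gzero f₀
  χzero⊗ f₀ f₁ = split (gmul-zeroˡ _) (≈ᵍ-trans
    (gadd-cong (gone-identityˡ f₀) (≈ᵍ-trans (gmul-cong (gpar-gconst 0#) ≈ᵍ-refl) (gmul-zeroˡ _))) (gadd-identityʳ _))

  χsuc⊗ : ∀ {n} (a : Fin n) (f₀ f₁ : Grass n) → χ (suc a) ⊗ split f₀ f₁ ≈ᵍ split (χ a ⊗ f₀) (gneg (χ a ⊗ f₁))
  χsuc⊗ a f₀ f₁ = split ≈ᵍ-refl (≈ᵍ-trans
    (gadd-cong (gmul-zeroˡ f₀) (≈ᵍ-trans (gmul-cong (χ-odd a) ≈ᵍ-refl) (gmul-gnegˡ _ _))) (gadd-identityˡ _))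

  -- Only the sequences with at most one entry 0 contribute, and its position does not matter.
  contract-split : ∀ {n} k (T : List (Fin (suc n)) → Carrier) → Alt (suc k) T →
    contract (suc k) T ≈ᵍ split (contract (suc k) (T ∘ map suc))
                                (gscale (natK (suc k)) (contract k (λ l → T (zero ∷ map suc l))))
  contract-split zero T _ = ≈ᵍ-trans (≡⇒≈ᵍ (∑-suc _)) (≈ᵍ-trans
    (gadd-cong (χzero⊗ _ _) (≈ᵍ-trans
      (∑-cong (λ a → ≈ᵍ-trans (χsuc⊗ a _ _) (split ≈ᵍ-refl (≈ᵍ-trans (gneg-cong (gmul-zeroʳ _)) gzero-gneg))))
      (∑-split _ _)))
    (split (gadd-identityˡ _) (≈ᵍ-trans (gadd-cong ≈ᵍ-refl (∑-gzero _)) (≈ᵍ-trans (gadd-identityʳ _)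
      (≈ᵍ-sym (≈ᵍ-trans (gscale-cong (K.+-identityʳ 1#) ≈ᵍ-refl) (gscale-identity _)))))))
  contract-split (suc k) T (alt , sw) = A.begin
    contract (suc (suc k)) T
      A.≈⟨ ≡⇒≈ᵍ (∑-suc _) ⟩
    (χ zero ⊗ contract (suc k) (T ∘ (zero ∷_))) ⊕ ∑ (λ a → χ (suc a) ⊗ contract (suc k) (T ∘ (suc a ∷_)))
      A.≈⟨ gadd-cong (≈ᵍ-trans (gmul-cong ≈ᵍ-refl (contract-split k (T ∘ (zero ∷_)) (alt zero))) (χzero⊗ _ _))
             (≈ᵍ-trans (∑-cong term) (∑-split _ _)) ⟩
    split (gzero ⊕ contract (suc (suc k)) (T ∘ map suc)) (Z ⊕ ∑ (λ a → gscale (natK (suc k)) (χ a ⊗ contract k (λ l → T (zero ∷ suc a ∷ map suc l)))))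
      A.≈⟨ split (gadd-identityˡ _) (≈ᵍ-trans (gadd-cong (≈ᵍ-sym (gscale-identity Z)) (∑-gscale _ _))
             (≈ᵍ-sym (gscale-distribʳ _ _ _))) ⟩
    split (contract (suc (suc k)) (T ∘ map suc)) (gscale (natK (suc (suc k))) Z) A.∎
    where
    Z = contract (suc k) (λ l → T (zero ∷ map suc l))
    term : ∀ a → χ (suc a) ⊗ contract (suc k) (T ∘ (suc a ∷_)) ≈ᵍ
      split (χ a ⊗ contract (suc k) (λ l → T (suc a ∷ map suc l)))
            (gscale (natK (suc k)) (χ a ⊗ contract k (λ l → T (zero ∷ suc a ∷ map suc l))))
    term a = ≈ᵍ-trans (gmul-cong ≈ᵍ-refl (contract-split k (T ∘ (suc a ∷_)) (alt (suc a)))) (≈ᵍ-trans (χsuc⊗ a _ _) (split ≈ᵍ-refl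
      (≈ᵍ-trans (gneg-cong (≈ᵍ-trans (gmul-gscaleʳ _ _ _) (gscale-cong K.refl
        (≈ᵍ-trans (gmul-cong ≈ᵍ-refl (≈ᵍ-trans (contract-cong k (λ l e → sw (suc a) zero (map suc l) (cong suc (≡.trans (length-map suc l) e)))) (contract-neg k _)))
          (gmul-gnegʳ _ _)))))
        (≈ᵍ-trans (gneg-cong (gscale-comm _ _ _)) (gneg-involutive _)))))

  -- The sum of T(α) χ_α over increasing α of length k, written in the coordinates f₀ + χ₀ f₁ so
  -- that it can be compared with `contract-split` coordinate by coordinate.
  sortedSum : ∀ n → ℕ → (List (Fin n) → Carrier) → Grass n
  sortedSum zero zero T = scalar (T [])
  sortedSum zero (suc k) T = gzero
  sortedSum (suc n) zero T = split (sortedSum n zero (T ∘ map suc)) gzero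
  sortedSum (suc n) (suc k) T =
    split (sortedSum n (suc k) (T ∘ map suc)) (sortedSum n k (λ l → T (zero ∷ map suc l)))

  -- Each element of an increasing sequence contributes, through `contract-split`, the number of
  -- places still open to it; these numbers multiply to k!.
  contract-sortedSum : ∀ n k (T : List (Fin n) → Carrier) → Alt k T →
    contract k T ≈ᵍ gscale (factK k) (sortedSum n k T)
  contract-sortedSum zero zero T _ = scalar (K.sym (K.*-identityˡ _))
  contract-sortedSum zero (suc k) T _ = ≈ᵍ-trans (≡⇒≈ᵍ (∑-zero _)) (≈ᵍ-sym (gscale-zeroʳ _))
  contract-sortedSum (suc n) zero T p = split (contract-sortedSum n zero (T ∘ map suc) tt) (≈ᵍ-sym (gscale-zeroʳ _))
  contract-sortedSum (suc n) (suc k) T p = ≈ᵍ-trans (contract-split k T p) (split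
    (contract-sortedSum n (suc k) (T ∘ map suc) (Alt-map-suc (suc k) T p))
    (≈ᵍ-trans (gscale-cong K.refl (contract-sortedSum n k (λ l → T (zero ∷ map suc l)) (Alt-map-suc k (T ∘ (zero ∷_)) (proj₁ p zero)))) (gscale-gscale _ _ _)))

  χs-map-suc : ∀ {n} (l : List (Fin n)) → χs (map suc l) ≈ᵍ split (χs l) gzero
  χs-map-suc [] = ≈ᵍ-refl
  χs-map-suc (a ∷ l) = ≈ᵍ-trans (gmul-cong ≈ᵍ-refl (χs-map-suc l)) (≈ᵍ-trans (χsuc⊗ a _ _)
    (split ≈ᵍ-refl (≈ᵍ-trans (gneg-cong (gmul-zeroʳ _)) gzero-gneg)))

  gsum-split : ∀ {n} {a} {X : Set a} (f g : X → Grass n) xs →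
    gsum (map (λ x → split (f x) (g x)) xs) ≈ᵍ split (gsum (map f xs)) (gsum (map g xs))
  gsum-split f g [] = ≈ᵍ-refl
  gsum-split f g (x ∷ xs) = gadd-cong ≈ᵍ-refl (gsum-split f g xs)

  gsum-gzero : ∀ {n} {a} {X : Set a} (xs : List X) → gsum {n} (map (λ _ → gzero) xs) ≈ᵍ gzero
  gsum-gzero [] = ≈ᵍ-refl
  gsum-gzero (x ∷ xs) = ≈ᵍ-trans (gadd-identityˡ _) (gsum-gzero xs)

  sortedTerm : ∀ {n} → (List (Fin n) → Carrier) → Subset n → Grass n
  sortedTerm T A = gscale (T (elems A)) (χs (elems A))

  sortedTerm-outside : ∀ {n} (T : List (Fin (suc n)) → Carrier) As →
    gsum (map (sortedTerm T) (map (outside ∷_) As)) ≈ᵍ split (gsum (map (sortedTerm (T ∘ map suc)) As)) gzero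
  sortedTerm-outside T As = ≈ᵍ-trans (gsum-map-map (sortedTerm T) _ As) (≈ᵍ-trans
    (gsum-cong (λ A → gscale-cong K.refl (χs-map-suc (elems A))) As)
    (≈ᵍ-trans (gsum-split _ _ As) (split ≈ᵍ-refl
      (≈ᵍ-trans (gsum-cong (λ A → gscale-zeroʳ _) As) (gsum-gzero As)))))

  sortedTerm-inside : ∀ {n} (T : List (Fin (suc n)) → Carrier) As →
    gsum (map (sortedTerm T) (map (inside ∷_) As)) ≈ᵍ split gzero (gsum (map (sortedTerm (λ l → T (zero ∷ map suc l))) As))
  sortedTerm-inside T As = ≈ᵍ-trans (gsum-map-map (sortedTerm T) _ As) (≈ᵍ-trans
    (gsum-cong (λ A → gscale-cong K.refl (≈ᵍ-trans (gmul-cong ≈ᵍ-refl (χs-map-suc (elems A))) (χzero⊗ _ _))) As)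
    (≈ᵍ-trans (gsum-split _ _ As) (split
      (≈ᵍ-trans (gsum-cong (λ A → gscale-zeroʳ _) As) (gsum-gzero As)) ≈ᵍ-refl)))

  sortedSum-subsets : ∀ n k (T : List (Fin n) → Carrier) →
    sortedSum n k T ≈ᵍ gsum (map (sortedTerm T) (subsets n k))
  sortedSum-subsets zero zero T = scalar (K.sym (K.trans (K.+-identityʳ _) (K.*-identityʳ _)))
  sortedSum-subsets zero (suc k) T = ≈ᵍ-refl
  sortedSum-subsets (suc n) zero T = ≈ᵍ-sym (≈ᵍ-trans (sortedTerm-outside T (subsets n zero))
    (split (≈ᵍ-sym (sortedSum-subsets n zero _)) ≈ᵍ-refl))
  sortedSum-subsets (suc n) (suc k) T = ≈ᵍ-sym (≈ᵍ-trans
    (≡⇒≈ᵍ (cong gsum (map-++ (sortedTerm T) (map (outside ∷_) (subsets n (suc k))) _)))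
    (≈ᵍ-trans (gsum-++ (map (sortedTerm T) (map (outside ∷_) (subsets n (suc k)))) _)
      (≈ᵍ-trans (gadd-cong (sortedTerm-outside T (subsets n (suc k))) (sortedTerm-inside T (subsets n k)))
        (split (≈ᵍ-trans (gadd-identityʳ _) (≈ᵍ-sym (sortedSum-subsets n (suc k) _)))
               (≈ᵍ-trans (gadd-identityˡ _) (≈ᵍ-sym (sortedSum-subsets n k _)))))))

-- The action and its exponential as sums over odd sets.

ratℕ : ℕ → ℚ
ratℕ k = (+ k) ℚ./ 1

toℚᵘ-ratℕ : ∀ k → toℚᵘ (ratℕ k) ≃ mkℚᵘ (+ k) 0
toℚᵘ-ratℕ k = ℚₚ.toℚᵘ-fromℚᵘ (mkℚᵘ (+ k) 0)

ratℕ-suc : ∀ k → ratℕ (suc k) ≡ 1ℚ ℚ.+ ratℕ k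
ratℕ-suc k = ℚₚ.toℚᵘ-injective (ℚᵘₚ.≃-trans (toℚᵘ-ratℕ (suc k)) (ℚᵘₚ.≃-sym
  (ℚᵘₚ.≃-trans (ℚₚ.toℚᵘ-homo-+ 1ℚ (ratℕ k)) (ℚᵘₚ.≃-trans (ℚᵘₚ.+-congʳ (toℚᵘ 1ℚ) (toℚᵘ-ratℕ k))
    (*≡* (cong (ℤ._* + 1) (cong (λ z → + 1 ℤ.+ z) (ℤₚ.*-identityʳ (+ k)))))))))

ratℕ-* : ∀ j k → ratℕ (j ℕ.* k) ≡ ratℕ j ℚ.* ratℕ k
ratℕ-* j k = ℚₚ.toℚᵘ-injective (ℚᵘₚ.≃-trans (toℚᵘ-ratℕ (j ℕ.* k)) (ℚᵘₚ.≃-sym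
  (ℚᵘₚ.≃-trans (ℚₚ.toℚᵘ-homo-* (ratℕ j) (ratℕ k)) (ℚᵘₚ.≃-trans (ℚᵘₚ.*-cong (toℚᵘ-ratℕ j) (toℚᵘ-ratℕ k))
    (*≡* (cong (ℤ._* + 1) (≡.sym (ℤₚ.pos-* j k))))))))

unitFraction-* : ∀ d .{{_ : NonZero d}} → ((+ 1) ℚ./ d) ℚ.* ratℕ d ≡ 1ℚ
unitFraction-* (suc d) = ℚₚ.toℚᵘ-injective
  (ℚᵘₚ.≃-trans (ℚₚ.toℚᵘ-homo-* ((+ 1) ℚ./ suc d) (ratℕ (suc d)))
    (ℚᵘₚ.≃-trans (ℚᵘₚ.*-cong (ℚₚ.toℚᵘ-fromℚᵘ (mkℚᵘ (+ 1) d)) (toℚᵘ-ratℕ (suc d)))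
      (*≡* (≡.trans (ℤₚ.*-identityʳ _) (≡.trans (ℤₚ.*-identityˡ (+ suc d)) (≡.sym
        (≡.trans (ℤₚ.*-identityˡ _) (cong +_ (ℕₚ.*-identityʳ (suc d))))))))))

choose : ∀ {a} {X : Set a} → ℕ → List X → List (List X)
choose zero xs = [] ∷ []
choose (suc p) [] = []
choose (suc p) (x ∷ xs) = choose (suc p) xs ++ map (x ∷_) (choose p xs)

oddSubsets : ∀ n → ℕ → List (Subset n)
oddSubsets n k = if oddᵇ k ∧ (3 ≤ᵇ k) then subsets n k else []

candidates : ∀ n → List (Subset n)
candidates n = concatMap (oddSubsets n) (upTo (suc n))

-- The bound n on the length is the power at which `gexp` is truncated.
sublists : ∀ {a} {X : Set a} → ℕ → List X → List (List X)
sublists n xs = concatMap (λ p → choose p xs) (upTo (suc n))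

module Exponential {c ℓ : Level} (K : CommutativeRing c ℓ) (φ : ℚ → CommutativeRing.Carrier K)
    (φ-mono : IsRingMonomorphism +-*-rawRing (CommutativeRing.rawRing K) φ) where

  open OverRing K φ renaming (gadd to infixl 6 _⊕_; gmul to infixl 7 _⊗_)
  open GrassRing K φ
  open Derivation K φ
  open GrassProducts K φ
  open Alternating K φ
  private
    module K = CommutativeRing K
    module KR = Relation.Binary.Reasoning.Setoid K.setoid
    module KM = Algebra.Properties.CommutativeSemigroup K.*-commutativeSemigroup
    module A {n : ℕ} where
      open Relation.Binary.Reasoning.Setoid (gsetoid n) public
    module φ = IsRingMonomorphism φ-mono
  open CommutativeRing K using (Carrier; _+_; _*_; -_; 0#; 1#)

  φ-ratℕ : ∀ k → φ (ratℕ k) ≈ natK k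
  φ-ratℕ zero = φ.0#-homo
  φ-ratℕ (suc k) = K.trans (K.reflexive (cong φ (ratℕ-suc k)))
    (K.trans (φ.+-homo 1ℚ (ratℕ k)) (K.+-cong φ.1#-homo (φ-ratℕ k)))

  φ-factorial : ∀ k → φ (ratℕ (k !)) ≈ factK k
  φ-factorial zero = φ.1#-homo
  φ-factorial (suc k) = K.trans (K.reflexive (cong φ (ratℕ-* (suc k) (k !))))
    (K.trans (φ.*-homo (ratℕ (suc k)) (ratℕ (k !))) (K.*-cong (φ-ratℕ (suc k)) (φ-factorial k)))

  φ-invFact : ∀ k → φ (invFact k) * factK k ≈ 1#
  φ-invFact k = K.trans (K.*-cong K.refl (K.sym (φ-factorial k)))
    (K.trans (K.sym (φ.*-homo (invFact k) (ratℕ (k !))))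
      (K.trans (K.reflexive (cong φ (unitFraction-* (k !) {{k !≢0}}))) φ.1#-homo))

  -- Prepares the coefficient of the action: the factor `natK (suc k)` is absorbed by `∂-contract`,
  -- and the remaining inverse factorial by `contract-sortedSum`.
  φ-invFact-pred : ∀ k → φ (invFact k) ≈ φ (invFact (suc k)) * natK (suc k)
  φ-invFact-pred k = KR.begin
    u                        KR.≈⟨ K.sym (K.*-identityʳ u) ⟩
    u * 1#                   KR.≈⟨ K.*-cong K.refl (K.sym (φ-invFact (suc k))) ⟩
    u * (v * (m * factK k))  KR.≈⟨ K.*-cong K.refl (K.sym (K.*-assoc v m _)) ⟩
    u * ((v * m) * factK k)  KR.≈⟨ KM.x∙yz≈y∙xz u (v * m) (factK k) ⟩
    (v * m) * (u * factK k)  KR.≈⟨ K.*-cong K.refl (φ-invFact k) ⟩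
    (v * m) * 1#             KR.≈⟨ K.*-identityʳ _ ⟩
    v * m KR.∎
    where
    u = φ (invFact k)
    v = φ (invFact (suc k))
    m = natK (suc k)

  module _ {n : ℕ} (y : Tensors n) where

    weight : List (Fin n) → Carrier
    weight α = y (length α) (fromList α)

    weight-toList : ∀ {k} (v : Vec (Fin n) k) → weight (toList v) ≡ y k v
    weight-toList v = go y v
      where
      -- Removing the first entry changes the tensor, so the induction runs over all tensors at
      -- once.
      go : ∀ (y : Tensors n) {k} (v : Vec (Fin n) k) → y (length (toList v)) (fromList (toList v)) ≡ y k v
      go y [] = refl
      go y (x ∷ v) = go (λ k w → y (suc k) (x ∷ w)) v

    edge : List (Fin n) → Grass n
    edge α = gscale (weight α) (∂ (χs α))

    module _ (y-antisym : ∀ k → Odd k → 3 ≤ k → k ≤ n → Antisymmetric k (y k)) where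

      weight-Alt : ∀ k → Odd k → 3 ≤ k → k ≤ n → Alt k weight
      weight-Alt k o l u = Antisymmetric⇒Alt k (y-antisym k o l u) (λ v → K.reflexive (weight-toList v))

      -- `termK` leaves out the generator of the first index, as does `∂` applied to the full
      -- contraction. So the term is `∂` of a contraction divided by (k+1)!, and the contraction is
      -- (k+1)! times a sum over sets.
      termK-edges : ∀ k → Alt (suc k) weight → termK y (suc k) ≈ᵍ gsum (map (edge ∘ elems) (subsets n (suc k)))
      termK-edges k alt = A.begin
        gscale u (gsum (map t (allSeqs (suc k))))
          A.≈⟨ gscale-cong K.refl (A.begin
            gsum (map t (concatMap (λ a → map (a ∷_) (allSeqs k)) (allFin n)))
              A.≈⟨ gsum-concatMap t _ (allFin n) ⟩
            gsum (map (λ a → gsum (map t (map (a ∷_) (allSeqs k)))) (allFin n))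
              A.≈⟨ ≡⇒≈ᵍ (∑-tabulate (λ a → gsum (map t (map (a ∷_) (allSeqs k)))) (λ a → a)) ⟩
            ∑ (λ a → gsum (map t (map (a ∷_) (allSeqs k))))
              A.≈⟨ ∑-cong (λ a → ≈ᵍ-trans (gsum-map-map t _ (allSeqs k)) (≈ᵍ-trans
                     (gsum-cong (λ v → gscale-cong (K.reflexive (≡.sym (weight-toList (a ∷ v)))) ≈ᵍ-refl) (allSeqs k))
                     (contract-allSeqs k (weight ∘ (a ∷_))))) ⟩
            ∑ G A.∎) ⟩
        gscale u (∑ G)                          A.≈⟨ gscale-cong (φ-invFact-pred k) ≈ᵍ-refl ⟩
        gscale (v * natK (suc k)) (∑ G)         A.≈⟨ ≈ᵍ-sym (gscale-gscale _ _ _) ⟩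
        gscale v (gscale (natK (suc k)) (∑ G))  A.≈⟨ gscale-cong K.refl (≈ᵍ-sym (∂-contract k weight alt)) ⟩
        gscale v (∂ (contract (suc k) weight))
          A.≈⟨ gscale-cong K.refl (≈ᵍ-trans (D-cong _ (contract-sortedSum n (suc k) weight alt)) (D-gscale _ _ _)) ⟩
        gscale v (gscale (factK (suc k)) (∂ (sortedSum n (suc k) weight)))
          A.≈⟨ ≈ᵍ-trans (gscale-gscale _ _ _) (≈ᵍ-trans (gscale-cong (φ-invFact (suc k)) ≈ᵍ-refl) (gscale-identity _)) ⟩
        ∂ (sortedSum n (suc k) weight)
          A.≈⟨ ≈ᵍ-trans (D-cong _ (sortedSum-subsets n (suc k) weight)) (D-gsum _ (sortedTerm weight) (subsets n (suc k))) ⟩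
        gsum (map (λ A → ∂ (sortedTerm weight A)) (subsets n (suc k)))
          A.≈⟨ gsum-cong (λ A → D-gscale _ _ _) (subsets n (suc k)) ⟩
        gsum (map (edge ∘ elems) (subsets n (suc k))) A.∎
        where
        u = φ (invFact k)
        v = φ (invFact (suc k))
        G : Fin n → Grass n
        G a = contract k (weight ∘ (a ∷_))
        t : Vec (Fin n) (suc k) → Grass n
        t α = gscale (y (suc k) α) (gprod (map χ (toList (Vec.tail α))))

      gsum-cong-All : ∀ {a} {X : Set a} {f g : X → Grass n} {xs} → All (λ x → f x ≈ᵍ g x) xs →
        gsum (map f xs) ≈ᵍ gsum (map g xs)
      gsum-cong-All [] = ≈ᵍ-refl
      gsum-cong-All (p ∷ ps) = gadd-cong p (gsum-cong-All ps)

      action-edges : action y ≈ᵍ gsum (map (edge ∘ elems) (candidates n))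
      action-edges = ≈ᵍ-sym (≈ᵍ-trans (gsum-concatMap (edge ∘ elems) (oddSubsets n) (upTo (suc n)))
        (gsum-cong-All (ok (upTo (suc n)) (λ {k} k∈ → ℕₚ.≤-pred (∈-upTo⁻ k∈)))))
        where
        ok : ∀ ks → (∀ {k} → k ∈ ks → k ≤ n) → All (λ k →
          gsum (map (edge ∘ elems) (oddSubsets n k))
            ≈ᵍ (if oddᵇ k ∧ (3 ≤ᵇ k) then termK y k else gzero)) ks
        ok [] _ = []
        ok (k ∷ ks) b = term k (b (here refl)) ∷ ok ks (b ∘ there)
          where
          term : ∀ k → k ≤ n →
            gsum (map (edge ∘ elems) (oddSubsets n k))
              ≈ᵍ (if oddᵇ k ∧ (3 ≤ᵇ k) then termK y k else gzero)
          term zero _ = ≈ᵍ-refl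
          term (suc k) k≤n with oddᵇ (suc k) in o | 3 ≤ᵇ suc k in l
          ... | false | _ = ≈ᵍ-refl
          ... | true | false = ≈ᵍ-refl
          ... | true | true = ≈ᵍ-sym (termK-edges k (weight-Alt (suc k) o
            (ℕₚ.≤ᵇ⇒≤ 3 (suc k) (subst Data.Bool.T (≡.sym l) _)) k≤n))

      ∂-action : ∂ (action y) ≈ᵍ gzero
      ∂-action = ≈ᵍ-trans (D-cong _ action-edges) (≈ᵍ-trans (D-gsum _ (edge ∘ elems) (candidates n))
        (≈ᵍ-trans (gsum-cong (λ A → ≈ᵍ-trans (D-gscale _ _ _) (≈ᵍ-trans (gscale-cong K.refl (D-D _ _)) (gscale-zeroʳ _))) (candidates n))
          (gsum-gzero (candidates n))))

      ∂-gpow : ∀ {f : Grass n} → ∂ f ≈ᵍ gzero → ∀ p → ∂ (gpow f p) ≈ᵍ gzero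
      ∂-gpow q zero = D-gconst _ 1#
      ∂-gpow q (suc p) = D-gmul-closed _ q (∂-gpow q p)

      ∂-gexp : ∀ {f : Grass n} → ∂ f ≈ᵍ gzero → ∂ (gexp f) ≈ᵍ gzero
      ∂-gexp {f} q = ≈ᵍ-trans (D-gsum _ (λ p → gscale (φ (invFact p)) (gpow f p)) (upTo (suc n)))
        (≈ᵍ-trans (gsum-cong (λ p → ≈ᵍ-trans (D-gscale _ _ _) (≈ᵍ-trans (gscale-cong K.refl (∂-gpow q p)) (gscale-zeroʳ _))) (upTo (suc n)))
          (gsum-gzero (upTo (suc n))))

      -- ∂ annihilates the exponential E, so (χ i − χ j) E = ∂ (χ j χ i E) has no top coefficient.
      integral-independent : ∀ i j → integral y i ≈ integral y j
      integral-independent i j = KR.begin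
        berezin X                                 KR.≈⟨ berezin-cong (≈ᵍ-sym difference) ⟩
        berezin (∂ (χ j ⊗ X) ⊕ Y)                 KR.≈⟨ berezin-gadd (∂ (χ j ⊗ X)) Y ⟩
        berezin (∂ (χ j ⊗ X)) + berezin Y         KR.≈⟨ K.+-cong (berezin-D _ (χ j ⊗ X)) K.refl ⟩
        0# + berezin Y                            KR.≈⟨ K.+-identityˡ _ ⟩
        berezin Y KR.∎
        where
        E = gexp (action y)
        X = χ i ⊗ E
        Y = χ j ⊗ E
        difference : ∂ (χ j ⊗ X) ⊕ Y ≈ᵍ X
        difference = A.begin
          ∂ (χ j ⊗ X) ⊕ Y
            A.≈⟨ gadd-cong (≈ᵍ-trans (Leibniz _ _ _) (gadd-cong
                   (≈ᵍ-trans (gmul-cong (D-χ _ j) ≈ᵍ-refl) (gone-identityˡ _))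
                   (≈ᵍ-trans (gmul-cong (χ-odd j) (D-χ⊗ _ K.refl (∂-gexp ∂-action))) (gmul-gnegˡ _ _)))) ≈ᵍ-refl ⟩
          (X ⊕ gneg Y) ⊕ Y   A.≈⟨ gadd-assoc _ _ _ ⟩
          X ⊕ (gneg Y ⊕ Y)   A.≈⟨ gadd-cong ≈ᵍ-refl (gneg-inverseˡ Y) ⟩
          X ⊕ gzero          A.≈⟨ gadd-identityʳ X ⟩
          X A.∎

  gpow-cong : ∀ {n} {f g : Grass n} → f ≈ᵍ g → ∀ p → gpow f p ≈ᵍ gpow g p
  gpow-cong q zero = ≈ᵍ-refl
  gpow-cong q (suc p) = gmul-cong q (gpow-cong q p)

  -- The binomial theorem for the commuting elements t and S, of which only the terms of degree 0
  -- and 1 in t survive.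
  gpow-gadd-nilsquare : ∀ {n} {t : Grass n} S → Even′ t → t ⊗ t ≈ᵍ gzero → ∀ p →
    gpow (t ⊕ S) (suc p) ≈ᵍ gpow S (suc p) ⊕ gscale (natK (suc p)) (t ⊗ gpow S p)
  gpow-gadd-nilsquare {t = t} S e sq zero = ≈ᵍ-trans (gmul-distribʳ _ _ _) (≈ᵍ-trans (gadd-comm _ _)
    (gadd-cong ≈ᵍ-refl (≈ᵍ-sym (≈ᵍ-trans (gscale-cong (K.+-identityʳ 1#) ≈ᵍ-refl) (gscale-identity _)))))
  gpow-gadd-nilsquare {t = t} S e sq (suc p) = A.begin
    (t ⊕ S) ⊗ gpow (t ⊕ S) (suc p)
      A.≈⟨ gmul-cong ≈ᵍ-refl (gpow-gadd-nilsquare S e sq p) ⟩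
    (t ⊕ S) ⊗ (S¹ ⊕ gscale m tS)
      A.≈⟨ gmul-distribˡ _ _ _ ⟩
    (t ⊕ S) ⊗ S¹ ⊕ (t ⊕ S) ⊗ gscale m tS
      A.≈⟨ gadd-cong (≈ᵍ-trans (gmul-distribʳ _ _ _) (gadd-comm _ _))
             (≈ᵍ-trans (gmul-gscaleʳ _ _ _) (gscale-cong K.refl (gmul-distribʳ _ _ _))) ⟩
    (S ⊗ S¹ ⊕ t ⊗ S¹) ⊕ gscale m (t ⊗ tS ⊕ S ⊗ tS)
      A.≈⟨ gadd-cong ≈ᵍ-refl (gscale-cong K.refl (gadd-cong
             (≈ᵍ-trans (≈ᵍ-sym (gmul-assoc _ _ _)) (≈ᵍ-trans (gmul-cong sq ≈ᵍ-refl) (gmul-zeroˡ _)))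
             (≈ᵍ-trans (≈ᵍ-sym (gmul-assoc _ _ _)) (≈ᵍ-trans (gmul-cong (≈ᵍ-sym (even-comm e S)) ≈ᵍ-refl) (gmul-assoc _ _ _))))) ⟩
    (S ⊗ S¹ ⊕ t ⊗ S¹) ⊕ gscale m (gzero ⊕ t ⊗ S¹)
      A.≈⟨ ≈ᵍ-trans (gadd-cong ≈ᵍ-refl (gscale-cong K.refl (gadd-identityˡ _))) (gadd-assoc _ _ _) ⟩
    S ⊗ S¹ ⊕ (t ⊗ S¹ ⊕ gscale m (t ⊗ S¹))
      A.≈⟨ gadd-cong ≈ᵍ-refl (≈ᵍ-trans (gadd-cong (≈ᵍ-sym (gscale-identity _)) ≈ᵍ-refl) (≈ᵍ-sym (gscale-distribʳ _ _ _))) ⟩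
    S ⊗ S¹ ⊕ gscale (natK (suc (suc p))) (t ⊗ S¹) A.∎
    where
    S¹ = gpow S (suc p)
    tS = t ⊗ gpow S p
    m = natK (suc p)

  elementary : ∀ {n} {a} {X : Set a} (f : X → Grass n) → ℕ → List X → Grass n
  elementary f p xs = gsum (map (λ s → gprod (map f s)) (choose p xs))

  elementary-∷ : ∀ {n} {a} {X : Set a} (f : X → Grass n) p x xs →
    elementary f (suc p) (x ∷ xs) ≈ᵍ elementary f (suc p) xs ⊕ f x ⊗ elementary f p xs
  elementary-∷ f p x xs = ≈ᵍ-trans (≡⇒≈ᵍ (cong gsum (map-++ F (choose (suc p) xs) _)))
    (≈ᵍ-trans (gsum-++ (map F (choose (suc p) xs)) _) (gadd-cong ≈ᵍ-refl
      (≈ᵍ-trans (gsum-map-map F (x ∷_) (choose p xs)) (≈ᵍ-sym (gmul-gsumˡ (f x) F (choose p xs))))))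
    where
    F = λ s → gprod (map f s)

  -- Only products of p distinct terms survive in the expansion, each in p! orders. The recursion
  -- `elementary-∷` of elementary symmetric polynomials is the truncated binomial theorem with the
  -- factorials divided out.
  gpow-gsum : ∀ {n} {a} {X : Set a} (f : X → Grass n) {xs} → All (λ x → Even′ (f x)) xs → All (λ x → f x ⊗ f x ≈ᵍ gzero) xs →
    ∀ p → gpow (gsum (map f xs)) p ≈ᵍ gscale (factK p) (elementary f p xs)
  gpow-gsum f es sqs zero = ≈ᵍ-sym (≈ᵍ-trans (gscale-identity _) (gadd-identityʳ _))
  gpow-gsum f [] [] (suc p) = ≈ᵍ-trans (gmul-zeroˡ _) (≈ᵍ-sym (gscale-zeroʳ _))
  gpow-gsum f {x ∷ xs} (e ∷ es) (sq ∷ sqs) (suc p) = A.begin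
    gpow (f x ⊕ gsum (map f xs)) (suc p)
      A.≈⟨ gpow-gadd-nilsquare _ e sq p ⟩
    gpow (gsum (map f xs)) (suc p) ⊕ gscale (natK (suc p)) (f x ⊗ gpow (gsum (map f xs)) p)
      A.≈⟨ gadd-cong (gpow-gsum f es sqs (suc p)) (≈ᵍ-trans (gscale-cong K.refl
             (≈ᵍ-trans (gmul-cong ≈ᵍ-refl (gpow-gsum f es sqs p)) (gmul-gscaleʳ _ _ _))) (gscale-gscale _ _ _)) ⟩
    gscale (factK (suc p)) (elementary f (suc p) xs) ⊕ gscale (factK (suc p)) (f x ⊗ elementary f p xs)
      A.≈⟨ ≈ᵍ-trans (≈ᵍ-sym (gscale-distribˡ _ _ _)) (gscale-cong K.refl (≈ᵍ-sym (elementary-∷ f p x xs))) ⟩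
    gscale (factK (suc p)) (elementary f (suc p) (x ∷ xs)) A.∎

  gexp-gsum : ∀ {n} {a} {X : Set a} (f : X → Grass n) {xs} → All (λ x → Even′ (f x)) xs → All (λ x → f x ⊗ f x ≈ᵍ gzero) xs →
    gexp (gsum (map f xs)) ≈ᵍ gsum (map (λ s → gprod (map f s)) (sublists n xs))
  gexp-gsum {n} f {xs} es sqs = ≈ᵍ-sym (≈ᵍ-trans (gsum-concatMap (λ s → gprod (map f s)) (λ p → choose p xs) (upTo (suc n)))
    (gsum-cong (λ p → ≈ᵍ-sym (≈ᵍ-trans (gscale-cong K.refl (gpow-gsum f es sqs p))
      (≈ᵍ-trans (gscale-gscale _ _ _) (≈ᵍ-trans (gscale-cong (φ-invFact p) ≈ᵍ-refl) (gscale-identity _))))) (upTo (suc n))))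

  gexp-cong : ∀ {n} {f g : Grass n} → f ≈ᵍ g → gexp f ≈ᵍ gexp g
  gexp-cong {n} q = gsum-cong (λ p → gscale-cong K.refl (gpow-cong q p)) (upTo (suc n))

  berezin-gsum : ∀ {n} {a} {X : Set a} (f : X → Grass n) xs →
    berezin (gsum (map f xs)) ≈ sumK (map (λ x → berezin (f x)) xs)
  berezin-gsum {n} f [] = berezin-gzero {n}
  berezin-gsum f (x ∷ xs) = K.trans (berezin-gadd (f x) _) (K.+-cong K.refl (berezin-gsum f xs))

-- Subsets and the lists that represent them.

unique-set⇒↭ : ∀ {a} {X : Set a} {xs ys : List X} → Unique xs → Unique ys →
  (∀ {x} → x ∈ xs → x ∈ ys) → (∀ {x} → x ∈ ys → x ∈ xs) → xs ↭ ys
unique-set⇒↭ u v f g = ∼bag⇒↭ (unique∧set⇒bag u v (mk⇔ f g))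

∈-elems⁺ : ∀ {n} {A : Subset n} {x} → x Sub.∈ A → x ∈ elems A
∈-elems⁺ {A = true ∷ A} here = here refl
∈-elems⁺ {A = true ∷ A} (there p) = there (∈-map⁺ Fin.suc (∈-elems⁺ p))
∈-elems⁺ {A = false ∷ A} (there p) = ∈-map⁺ Fin.suc (∈-elems⁺ p)

∈-elems⁻ : ∀ {n} {A : Subset n} {x} → x ∈ elems A → x Sub.∈ A
∈-elems⁻ {A = true ∷ A} (here refl) = here
∈-elems⁻ {A = true ∷ A} (there p) with ∈-map⁻ Fin.suc p
... | y , q , refl = there (∈-elems⁻ q)
∈-elems⁻ {A = false ∷ A} p with ∈-map⁻ Fin.suc p
... | y , q , refl = there (∈-elems⁻ q)

length-elems : ∀ {n} (A : Subset n) → length (elems A) ≡ ∣ A ∣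
length-elems [] = refl
length-elems (true ∷ A) = cong suc (≡.trans (length-map Fin.suc (elems A)) (length-elems A))
length-elems (false ∷ A) = ≡.trans (length-map Fin.suc (elems A)) (length-elems A)

elems-unique : ∀ {n} (A : Subset n) → Unique (elems A)
elems-unique [] = []
elems-unique (true ∷ A) = All.tabulate (λ p → λ { refl → zero∉ p }) ∷ Uniqueₚ.map⁺ Finₚ.suc-injective (elems-unique A)
  where
  zero∉ : zero ∉ map Fin.suc (elems A)
  zero∉ p with ∈-map⁻ Fin.suc p
  ... | _ , _ , ()
elems-unique (false ∷ A) = Uniqueₚ.map⁺ Finₚ.suc-injective (elems-unique A)

-- The unfolding law of `toSubset`, whose membership test is a local function.
lookup-toSubset : ∀ {n} (x : Fin n) xs j →
  Vec.lookup (toSubset (x ∷ xs)) j ≡ (if does (j ≟ x) then true else Vec.lookup (toSubset xs) j)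
lookup-toSubset x xs j = ≡.trans (Vecₚ.lookup∘tabulate _ j)
  (cong (if does (j ≟ x) then true else_) (≡.sym (Vecₚ.lookup∘tabulate _ j)))

∈-toSubset⁺ : ∀ {n} {x : Fin n} {xs} → x ∈ xs → x Sub.∈ toSubset xs
∈-toSubset⁺ p = Vecₚ.lookup⇒[]= _ _ (go p)
  where
  go : ∀ {n} {x : Fin n} {xs} → x ∈ xs → Vec.lookup (toSubset xs) x ≡ true
  go {x = x} {y ∷ xs} p with x ≟ y | lookup-toSubset y xs x
  ... | yes _ | e = e
  go {x = x} {y ∷ xs} (here q) | no ¬q | e = ⊥-elim (¬q q)
  go {x = x} {y ∷ xs} (there p) | no _ | e = ≡.trans e (go p)

∈-toSubset⁻ : ∀ {n} {x : Fin n} {xs} → x Sub.∈ toSubset xs → x ∈ xs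
∈-toSubset⁻ {n} {x} p = go _ (Vecₚ.[]=⇒lookup p)
  where
  go : ∀ xs → Vec.lookup (toSubset xs) x ≡ true → x ∈ xs
  go [] e with ≡.trans (≡.sym (Vecₚ.lookup∘tabulate (λ _ → false) x)) e
  ... | ()
  go (y ∷ xs) e with x ≟ y | lookup-toSubset y xs x
  ... | yes q | _ = here q
  ... | no _ | e′ = there (go xs (≡.trans (≡.sym e′) e))

↭-elems-toSubset : ∀ {n} {α : List (Fin n)} → Unique α → α ↭ elems (toSubset α)
↭-elems-toSubset {α = α} u = unique-set⇒↭ u (elems-unique (toSubset α)) (∈-elems⁺ ∘ ∈-toSubset⁺) (∈-toSubset⁻ ∘ ∈-elems⁻)

-- The number of generators that χ x has to pass to reach its place in the increasing monomial of A.
below : ∀ {n} → Fin n → Subset n → ℕ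
below zero A = 0
below (suc x) (true ∷ A) = suc (below x A)
below (suc x) (false ∷ A) = below x A

insert : ∀ {n} → Fin n → Subset n → Subset n
insert x A = A Vec.[ x ]≔ inside

-- Unlike `toSubset`, which tabulates, this follows the list one `insert` at a time, as
-- multiplication by one generator after another does.
setOf : ∀ {n} → List (Fin n) → Subset n
setOf [] = ⊥
setOf (x ∷ xs) = insert x (setOf xs)

∈-insert⁻ : ∀ {n} {x y : Fin n} {A} → x Sub.∈ insert y A → x ≡ y ⊎ x Sub.∈ A
∈-insert⁻ {x = zero} {zero} {b ∷ A} here = inj₁ refl
∈-insert⁻ {x = suc x} {zero} {b ∷ A} (there p) = inj₂ (there p)
∈-insert⁻ {x = zero} {suc y} {b ∷ A} here = inj₂ here
∈-insert⁻ {x = suc x} {suc y} {b ∷ A} (there p) with ∈-insert⁻ p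
... | inj₁ q = inj₁ (cong suc q)
... | inj₂ q = inj₂ (there q)

∈-insert-there : ∀ {n} {x y : Fin n} {A} → x Sub.∈ A → x Sub.∈ insert y A
∈-insert-there {y = zero} here = here
∈-insert-there {y = suc y} here = here
∈-insert-there {y = zero} (there p) = there p
∈-insert-there {y = suc y} (there p) = there (∈-insert-there p)

∈-setOf⁺ : ∀ {n} {x : Fin n} {xs} → x ∈ xs → x Sub.∈ setOf xs
∈-setOf⁺ {xs = y ∷ xs} (here refl) = Vecₚ.[]≔-updates (setOf xs) y
∈-setOf⁺ (there p) = ∈-insert-there (∈-setOf⁺ p)

∈-setOf⁻ : ∀ {n} {x : Fin n} {xs} → x Sub.∈ setOf xs → x ∈ xs
∈-setOf⁻ {xs = []} p = ⊥-elim (Subₚ.∉⊥ p)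
∈-setOf⁻ {xs = y ∷ xs} p with ∈-insert⁻ p
... | inj₁ q = here q
... | inj₂ q = there (∈-setOf⁻ q)

below-insert : ∀ {n} (x y : Fin n) {A} → y Sub.∉ A →
  below x (insert y A) ≡ (if toℕ y <ᵇ toℕ x then suc (below x A) else below x A)
below-insert zero y _ = refl
below-insert (suc x) zero {true ∷ A} y∉ = ⊥-elim (y∉ here)
below-insert (suc x) zero {false ∷ A} y∉ = refl
below-insert (suc x) (suc y) {true ∷ A} y∉ rewrite below-insert x y (y∉ ∘ there) with toℕ y <ᵇ toℕ x
... | true = refl
... | false = refl
below-insert (suc x) (suc y) {false ∷ A} y∉ = below-insert x y (y∉ ∘ there)

-- Matches one step of `inversions` with the sign of one multiplication by a generator.
below-setOf : ∀ {n} (x : Fin n) {xs : List (Fin n)} → Unique xs →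
  length (filterᵇ (λ y → toℕ y <ᵇ toℕ x) xs) ≡ below x (setOf xs)
below-setOf x [] = go x
  where
  go : ∀ {n} (x : Fin n) → 0 ≡ below x ⊥
  go zero = refl
  go (suc x) = go x
below-setOf x {y ∷ ys} (y∉ ∷ u)
  rewrite below-insert x y {setOf ys} (λ p → All.lookup y∉ (∈-setOf⁻ p) refl)
  with toℕ y <ᵇ toℕ x
... | true = cong suc (below-setOf x u)
... | false = below-setOf x u

-- Sorting a product of generators.

module TopCoefficient {c ℓ : Level} (K : CommutativeRing c ℓ) (φ : ℚ → CommutativeRing.Carrier K) where

  open OverRing K φ renaming (gadd to infixl 6 _⊕_; gmul to infixl 7 _⊗_)
  open GrassRing K φ
  open Derivation K φ
  open GrassProducts K φ
  open Alternating K φ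
  private
    module K = CommutativeRing K
    module KP = Algebra.Properties.Ring K.ring
    module A {n : ℕ} where
      open Relation.Binary.Reasoning.Setoid (gsetoid n) public
  open CommutativeRing K using (Carrier; _+_; _*_; -_; 0#; 1#)

  monomial : ∀ {n} → Subset n → Grass n
  monomial [] = scalar 1#
  monomial (false ∷ A) = split (monomial A) gzero
  monomial (true ∷ A) = split gzero (monomial A)

  gneg-gscale : ∀ {n} a (f : Grass n) → gneg (gscale a f) ≈ᵍ gscale (- a) f
  gneg-gscale a f = ≈ᵍ-trans (gscale-gscale _ _ _) (gscale-cong (KP.-1*x≈-x a) ≈ᵍ-refl)

  χ-monomial : ∀ {n} (x : Fin n) {A} → x Sub.∉ A →
    χ x ⊗ monomial A ≈ᵍ gscale (signK (below x A)) (monomial (insert x A))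
  χ-monomial zero {true ∷ A} x∉ = ⊥-elim (x∉ here)
  χ-monomial zero {false ∷ A} x∉ = ≈ᵍ-trans (χzero⊗ _ _) (≈ᵍ-sym (gscale-identity _))
  χ-monomial (suc x) {false ∷ A} x∉ = ≈ᵍ-trans (χsuc⊗ x _ _) (split (χ-monomial x (x∉ ∘ there))
    (≈ᵍ-trans (gneg-cong (gmul-zeroʳ _)) (≈ᵍ-trans gzero-gneg (≈ᵍ-sym (gscale-zeroʳ _)))))
  χ-monomial (suc x) {true ∷ A} x∉ = ≈ᵍ-trans (χsuc⊗ x _ _) (split
    (≈ᵍ-trans (gmul-zeroʳ _) (≈ᵍ-sym (gscale-zeroʳ _)))
    (≈ᵍ-trans (gneg-cong (χ-monomial x (x∉ ∘ there))) (gneg-gscale _ _)))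

  signK-+ : ∀ a b → signK (a ℕ.+ b) ≈ signK a * signK b
  signK-+ zero b = K.sym (K.*-identityˡ _)
  signK-+ (suc a) b = K.trans (K.-‿cong (signK-+ a b)) (KP.-‿distribˡ-* _ _)

  monomial-⊥ : ∀ {n} → gone ≈ᵍ monomial {n} ⊥
  monomial-⊥ {zero} = ≈ᵍ-refl
  monomial-⊥ {suc n} = split monomial-⊥ ≈ᵍ-refl

  χs-monomial : ∀ {n} {xs : List (Fin n)} → Unique xs →
    χs xs ≈ᵍ gscale (signK (inversions xs)) (monomial (setOf xs))
  χs-monomial [] = ≈ᵍ-trans monomial-⊥ (≈ᵍ-sym (gscale-identity _))
  χs-monomial {xs = x ∷ xs} (x∉ ∷ u) = A.begin
    χ x ⊗ χs xs
      A.≈⟨ gmul-cong ≈ᵍ-refl (χs-monomial u) ⟩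
    χ x ⊗ gscale (signK (inversions xs)) (monomial (setOf xs))
      A.≈⟨ ≈ᵍ-trans (gmul-gscaleʳ _ _ _) (gscale-cong K.refl (χ-monomial x (λ p → All.lookup x∉ (∈-setOf⁻ p) refl))) ⟩
    gscale (signK (inversions xs)) (gscale (signK (below x (setOf xs))) (monomial (setOf (x ∷ xs))))
      A.≈⟨ ≈ᵍ-trans (gscale-gscale _ _ _) (gscale-cong (K.trans (K.*-comm _ _)
             (K.trans (K.*-cong (K.reflexive (cong signK (≡.sym (below-setOf x u)))) K.refl)
               (K.sym (signK-+ (length (filterᵇ (λ y → toℕ y <ᵇ toℕ x) xs)) (inversions xs))))) ≈ᵍ-refl) ⟩
    gscale (signK (inversions (x ∷ xs))) (monomial (setOf (x ∷ xs))) A.∎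

  berezin-monomial-⊤ : ∀ {n} → berezin (monomial {n} ⊤) ≈ 1#
  berezin-monomial-⊤ {zero} = K.refl
  berezin-monomial-⊤ {suc n} = berezin-monomial-⊤ {n}

  -- Sorting a list of all vertices gives the top monomial with the sign of the list; this is where
  -- the signature ε of a refined cactus comes from.
  berezin-χs : ∀ {n} {xs : List (Fin n)} → Unique xs → (∀ x → x ∈ xs) → berezin (χs xs) ≈ signK (inversions xs)
  berezin-χs {n} {xs} u full = K.trans (berezin-cong (χs-monomial u)) (K.trans (berezin-gscale _ (monomial (setOf xs)))
    (K.trans (K.*-cong K.refl (K.trans (K.reflexive (cong (λ A → berezin (monomial A)) top)) (berezin-monomial-⊤ {n})))
      (K.*-identityʳ _)))
    where
    top : setOf xs ≡ ⊤
    top = Subₚ.⊆-antisym Subₚ.⊆⊤ (λ {x} _ → ∈-setOf⁺ (full x))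

-- Independence of hyperedge terms from the order of their entries.

module EdgeSymmetry {c ℓ : Level} (K : CommutativeRing c ℓ) (φ : ℚ → CommutativeRing.Carrier K)
    (φ-mono : IsRingMonomorphism +-*-rawRing (CommutativeRing.rawRing K) φ)
    {n : ℕ} (y : OverRing.Tensors K φ n)
    (y-antisym : ∀ k → Odd k → 3 ≤ k → k ≤ n → OverRing.Antisymmetric K φ k (y k)) where

  open OverRing K φ renaming (gadd to infixl 6 _⊕_; gmul to infixl 7 _⊗_)
  open GrassRing K φ
  open Derivation K φ
  open GrassProducts K φ
  open Alternating K φ
  open Exponential K φ φ-mono
  private
    module K = CommutativeRing K
    module KP = Algebra.Properties.Ring K.ring
    module A {n : ℕ} where
      open Relation.Binary.Reasoning.Setoid (gsetoid n) public
  open CommutativeRing K using (Carrier; _+_; _*_; -_; 0#; 1#)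

  wt : List (Fin n) → Carrier
  wt = weight y

  hyperedge : List (Fin n) → Grass n
  hyperedge = edge y

  Alt-adjacent : ∀ {n k} {T : List (Fin n) → Carrier} → Alt k T → ∀ us a b l → length (us ++ a ∷ b ∷ l) ≡ k →
    T (us ++ a ∷ b ∷ l) ≈ - T (us ++ b ∷ a ∷ l)
  Alt-adjacent (_ , sw) [] a b l refl = sw a b l refl
  Alt-adjacent {T = T} (alt , _) (u ∷ us) a b l refl = Alt-adjacent {T = T ∘ (u ∷_)} (alt u) us a b l refl

  χs-adjacent : ∀ us (a b : Fin n) l → χs (us ++ a ∷ b ∷ l) ≈ᵍ gneg (χs (us ++ b ∷ a ∷ l))
  χs-adjacent [] a b l = ≈ᵍ-trans (≈ᵍ-sym (gmul-assoc _ _ _)) (≈ᵍ-trans (gmul-cong (χ-anticomm a b) ≈ᵍ-refl)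
    (≈ᵍ-trans (gmul-gnegˡ _ _) (gneg-cong (gmul-assoc _ _ _))))
  χs-adjacent (u ∷ us) a b l = ≈ᵍ-trans (gmul-cong ≈ᵍ-refl (χs-adjacent us a b l)) (gmul-gnegʳ _ _)

  InRange : ℕ → Set
  InRange k = Odd k × 3 ≤ k × k ≤ n

  -- The sign from the tensor and the sign from the generators cancel.
  hyperedge-adjacent : ∀ us a b l → InRange (length (us ++ a ∷ b ∷ l)) →
    hyperedge (us ++ a ∷ b ∷ l) ≈ᵍ hyperedge (us ++ b ∷ a ∷ l)
  hyperedge-adjacent us a b l (o , lo , hi) = A.begin
    gscale (wt (us ++ a ∷ b ∷ l)) (∂ (χs (us ++ a ∷ b ∷ l)))
      A.≈⟨ gscale-cong (K.trans (Alt-adjacent {T = wt} (weight-Alt y y-antisym _ o lo hi) us a b l refl) (K.sym (KP.-1*x≈-x _)))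
             (≈ᵍ-trans (D-cong _ (χs-adjacent us a b l)) (D-gscale _ _ _)) ⟩
    gscale (- 1# * w) (gneg d)
      A.≈⟨ ≈ᵍ-trans (≈ᵍ-sym (gscale-gscale _ _ _)) (gneg-cong (gscale-comm w (- 1#) d)) ⟩
    gneg (gneg (gscale w d))
      A.≈⟨ gneg-involutive _ ⟩
    gscale w d A.∎
    where
    w = wt (us ++ b ∷ a ∷ l)
    d = ∂ (χs (us ++ b ∷ a ∷ l))

  -- The prefix `us` collects the entries that the permutation has already passed, so that the
  -- induction can go under a common head.
  hyperedge-↭-after : ∀ us {xs ys} → xs ↭ ys → InRange (length (us ++ xs)) →
    hyperedge (us ++ xs) ≈ᵍ hyperedge (us ++ ys)
  hyperedge-↭-after us refl r = ≈ᵍ-refl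
  hyperedge-↭-after us (prep {xs} {ys} x p) r
    rewrite ≡.sym (++-assoc us (x ∷ []) xs) | ≡.sym (++-assoc us (x ∷ []) ys) = hyperedge-↭-after (us ++ x ∷ []) p r
  hyperedge-↭-after us (swap {xs} {ys} x y p) r = ≈ᵍ-trans (hyperedge-adjacent us x y xs r) rest
    where
    r′ : InRange (length (us ++ y ∷ x ∷ xs))
    r′ = subst InRange (Permₚ.↭-length (Permₚ.++⁺ˡ us (swap x y refl))) r
    rest : hyperedge (us ++ y ∷ x ∷ xs) ≈ᵍ hyperedge (us ++ y ∷ x ∷ ys)
    rest with r′
    ... | r″ rewrite ≡.sym (++-assoc us (y ∷ x ∷ []) xs) | ≡.sym (++-assoc us (y ∷ x ∷ []) ys) =
      hyperedge-↭-after (us ++ y ∷ x ∷ []) p r″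
  hyperedge-↭-after us (trans p q) r = ≈ᵍ-trans (hyperedge-↭-after us p r)
    (hyperedge-↭-after us q (subst InRange (Permₚ.↭-length (Permₚ.++⁺ˡ us p)) r))

  hyperedge-↭ : ∀ {xs ys} → xs ↭ ys → InRange (length xs) → hyperedge xs ≈ᵍ hyperedge ys
  hyperedge-↭ = hyperedge-↭-after []

-- Acyclicity from a depth function; simple paths and cycles.

unique-resp-↭ : ∀ {a} {X : Set a} {xs ys : List X} → xs ↭ ys → Unique xs → Unique ys
unique-resp-↭ refl u = u
unique-resp-↭ (prep x p) (x∉ ∷ u) = Permₚ.All-resp-↭ p x∉ ∷ unique-resp-↭ p u
unique-resp-↭ (swap x y p) ((x≢y ∷ x∉) ∷ y∉ ∷ u) =
  ((x≢y ∘ sym) ∷ Permₚ.All-resp-↭ p y∉) ∷ Permₚ.All-resp-↭ p x∉ ∷ unique-resp-↭ p u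
unique-resp-↭ (trans p q) u = unique-resp-↭ q (unique-resp-↭ p u)

unique-++⇒∉ : ∀ {a} {X : Set a} (xs : List X) {x ys} → Unique (xs ++ x ∷ ys) → x ∉ xs
unique-++⇒∉ (x ∷ xs) (x∉ ∷ u) (here refl) = All.lookup x∉ (∈-++⁺ʳ xs (here refl)) refl
unique-++⇒∉ (x ∷ xs) (x∉ ∷ u) (there p) = unique-++⇒∉ xs u p

two-elements : ∀ {n} (A : Subset n) → 2 ≤ ∣ A ∣ → Σ (Fin n) λ a → Σ (Fin n) λ b → a Sub.∈ A × b Sub.∈ A × a ≢ b
two-elements A l with elems A in eq | elems-unique A | subst (2 ≤_) (sym (length-elems A)) l
... | a ∷ b ∷ _ | (a≢b ∷ _) ∷ _ | _ = a , b
  , ∈-elems⁻ (subst (a ∈_) (sym eq) (here refl)) , ∈-elems⁻ (subst (b ∈_) (sym eq) (there (here refl))) , a≢b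
... | _ ∷ [] | _ | s≤s ()

-- A graph in which every edge changes the depth and every vertex has at most
-- one neighbour of smaller depth has no cycle: along a cycle the depth can only
-- decrease and then increase, so both neighbours of its starting point would be
-- its shallower neighbour.
module Depth {a b : Level} {V : Set a} (E : V → V → Set b) (E-sym : ∀ {u v} → E u v → E v u) (d : V → ℕ)
    (monotone : ∀ {u v} → E u v → d u < d v ⊎ d v < d u)
    (parent-unique : ∀ {u v w} → E u v → E u w → d v < d u → d w < d u → v ≡ w) where

  open Graph E

  lastOf : V → List V → V
  lastOf x [] = x
  lastOf x (y ∷ l) = lastOf y l

  lastOf-∈ : ∀ x l → lastOf x l ∈ x ∷ l
  lastOf-∈ x [] = here refl
  lastOf-∈ x (y ∷ l) = there (lastOf-∈ y l)

  -- If x were followed by a shallower w, then u and w would both be its one shallower neighbour.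
  turn-up : ∀ {u x w} → E u x → E x w → d u < d x → u ≢ w → d x < d w
  turn-up e f lt ne with monotone f
  ... | inj₁ up = up
  ... | inj₂ down = ⊥-elim (ne (parent-unique (E-sym e) f lt down))

  -- By `turn-up`, a path that has made one ascending step ascends to its end, the final step into z
  -- included.
  up : ∀ u x ws z → E u x → d u < d x → Unique (u ∷ x ∷ ws) → z ∉ u ∷ x ∷ ws → Chain (x ∷ ws ++ z ∷ []) →
    d (lastOf x ws) < d z × d x < d z
  up u x [] z e lt _ z∉ (f , _) = let lt′ = turn-up e f lt (λ q → z∉ (here (sym q))) in lt′ , lt′
  up u x (w ∷ ws) z e lt ((_ ∷ u≢w ∷ _) ∷ un) z∉ (f , ch) =
    let lt′ = turn-up e f lt u≢w
        p , q = up x w ws z f lt′ un (z∉ ∘ there) ch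
    in p , ℕₚ.<-trans lt′ q

  -- Either some step ascends, and then so does the last one, or the path descends all the way to z.
  down : ∀ x ws z → Unique (x ∷ ws) → z ∉ x ∷ ws → Chain (x ∷ ws ++ z ∷ []) →
    d (lastOf x ws) < d z ⊎ d z < d x
  down x [] z _ _ (f , _) = monotone f
  down x (w ∷ ws) z un@(_ ∷ un′) z∉ (f , ch) with monotone f
  ... | inj₁ lt = inj₁ (proj₁ (up x w ws z f lt un z∉ ch))
  ... | inj₂ lt with down w ws z un′ (z∉ ∘ there) ch
  ...   | inj₁ q = inj₁ q
  ...   | inj₂ q = inj₂ (ℕₚ.<-trans q lt)

  last-edge : ∀ x ws z → Chain (x ∷ ws ++ z ∷ []) → E (lastOf x ws) z
  last-edge x [] z (f , _) = f
  last-edge x (w ∷ ws) z (_ , ch) = last-edge w ws z ch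

  depth-acyclic : Acyclic
  depth-acyclic (v ∷ x ∷ []) (s≤s () , _)
  depth-acyclic (v ∷ x ∷ w ∷ ws) (_ , (v∉@(v≢x ∷ v≢w ∷ _) ∷ un@(x∉ ∷ un′)) , (e , ch@(f , ch′))) with monotone e
  ... | inj₁ lt = ℕₚ.<-asym (ℕₚ.<-trans lt (turn-up e f lt v≢w))
    (proj₂ (up x w ws v f (turn-up e f lt v≢w) un v∉′ ch′))
    where
    v∉′ : v ∉ x ∷ w ∷ ws
    v∉′ p = All.lookup v∉ p refl
  ... | inj₂ lt with down x (w ∷ ws) v un (λ p → All.lookup v∉ p refl) ch
  ...   | inj₁ q = All.lookup x∉ (lastOf-∈ w ws)
                     (parent-unique e (E-sym (last-edge x (w ∷ ws) v ch)) lt q)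
  ...   | inj₂ q = ℕₚ.<-asym lt q

module Walks {a b : Level} {V : Set a} (E : V → V → Set b) where

  open Graph E

  _++ʷ_ : ∀ {u v w} → Walk u v → Walk v w → Walk u w
  here ++ʷ q = q
  step e p ++ʷ q = step e (p ++ʷ q)

  -- SimplePath u v l: u ∷ l is a path from u to v without repeated vertices.
  data SimplePath : V → V → List V → Set (a ⊔ b) where
    here : ∀ {v} → SimplePath v v []
    step : ∀ {u w v l} → E u w → SimplePath w v l → u ∉ w ∷ l → SimplePath u v (w ∷ l)

  snoc : ∀ {u v z l} → SimplePath u v l → E v z → z ∉ u ∷ l → SimplePath u z (l ++ z ∷ [])
  snoc here e z∉ = step e here (λ { (here q) → z∉ (here (sym q)) })
  snoc {u} {z = z} (step {w = w} {l = l} f p u∉) e z∉ = step f (snoc p e (z∉ ∘ there)) u∉′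
    where
    u∉′ : u ∉ w ∷ l ++ z ∷ []
    u∉′ q with ∈-++⁻ (w ∷ l) q
    ... | inj₁ q′ = u∉ q′
    ... | inj₂ (here q′) = z∉ (here (sym q′))

  path-walk : ∀ {u v l} → SimplePath u v l → Walk u v
  path-walk here = here
  path-walk (step e p _) = step e (path-walk p)

  path-unique : ∀ {u v l} → SimplePath u v l → Unique (u ∷ l)
  path-unique here = [] ∷ []
  path-unique (step e p u∉) = All.tabulate (λ q → λ { refl → u∉ q }) ∷ path-unique p

  path-chain : ∀ {u v z l} → SimplePath u v l → E v z → Chain (u ∷ l ++ z ∷ [])
  path-chain here e = e , tt
  path-chain (step f p _) e = f , path-chain p e

  path-cycle : ∀ {x u v l} → SimplePath u v l → u ≢ v → E x u → E v x → x ∉ u ∷ l → IsCycle (x ∷ u ∷ l)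
  path-cycle here u≢v _ _ _ = ⊥-elim (u≢v refl)
  path-cycle p@(step _ _ _) u≢v e f x∉ = s≤s (s≤s z≤n)
    , (All.tabulate (λ q → λ { refl → x∉ q }) ∷ path-unique p) , e , path-chain p f

-- Growing a cactus from the root i: (p , r) is recorded when the hyperedge p is
-- attached to the set R of vertices reached so far at its only vertex r in R.
module Growth {n : ℕ} (𝒜 : List (Subset n)) (i : Fin n) where

  m : ℕ
  m = length 𝒜

  A : Fin m → Subset n
  A = lookup 𝒜

  open Graph (GEdge 𝒜)
  open Walks (GEdge 𝒜)

  GEdge-sym : ∀ {u v} → GEdge 𝒜 u v → GEdge 𝒜 v u
  GEdge-sym {inj₁ _} {inj₂ _} e = e
  GEdge-sym {inj₂ _} {inj₁ _} e = e

  data Grown : Subset n → List (Fin m × Fin n) → Set where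
    base : Grown ⁅ i ⁆ []
    grow : ∀ {R ps} → Grown R ps → ∀ p r → r Sub.∈ R → r Sub.∈ A p → (∀ b → b Sub.∈ A p → b Sub.∈ R → b ≡ r) →
           p ∉ map proj₁ ps → Grown (R ∪ A p) ((p , r) ∷ ps)

  used : List (Fin m × Fin n) → List (Fin m)
  used = map proj₁

  root∈ : ∀ {R ps} → Grown R ps → i Sub.∈ R
  root∈ base = Subₚ.x∈⁅x⁆ i
  root∈ (grow g p r _ _ _ _) = Subₚ.x∈p∪q⁺ (inj₁ (root∈ g))

  used⊆ : ∀ {R ps} → Grown R ps → ∀ {p b} → p ∈ used ps → b Sub.∈ A p → b Sub.∈ R
  used⊆ (grow g p r _ _ _ _) (here refl) b∈ = Subₚ.x∈p∪q⁺ (inj₂ b∈)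
  used⊆ (grow g p r _ _ _ _) (there q) b∈ = Subₚ.x∈p∪q⁺ (inj₁ (used⊆ g q b∈))

  ∈-grow⁻ : ∀ {R p v} → v Sub.∈ R ∪ A p → v Sub.∉ R → v Sub.∈ A p
  ∈-grow⁻ {R} {p} v∈ v∉ with Subₚ.x∈p∪q⁻ R (A p) v∈
  ... | inj₁ q = ⊥-elim (v∉ q)
  ... | inj₂ q = q

  Zone : Subset n → List (Fin m × Fin n) → GVertex 𝒜 → Set
  Zone R ps (inj₁ p) = p ∈ used ps
  Zone R ps (inj₂ v) = v Sub.∈ R

  zone-grow : ∀ {R ps p r} v → Zone R ps v → Zone (R ∪ A p) ((p , r) ∷ ps) v
  zone-grow (inj₁ _) q = there q
  zone-grow (inj₂ _) q = Subₚ.x∈p∪q⁺ (inj₁ q)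

  zone-avoid : ∀ {R ps v l} → ¬ Zone R ps v → All (Zone R ps) l → v ∉ l
  zone-avoid ¬z zs q = ¬z (All.lookup zs q)

  -- A vertex new in `A p` is joined to the older ones through p and then r. The path between older
  -- vertices is thus prolonged at its start or its end, and it stays simple because p and the new
  -- vertex lie outside the older zone.
  zonePath : ∀ {R ps} → Grown R ps → ∀ {a b} → a Sub.∈ R → b Sub.∈ R →
    ∃ λ l → SimplePath (inj₂ a) (inj₂ b) l × All (Zone R ps) (inj₂ a ∷ l)
  zonePath base a∈ b∈ with Subₚ.x∈⁅y⁆⇒x≡y i a∈ | Subₚ.x∈⁅y⁆⇒x≡y i b∈
  ... | refl | refl = [] , here , a∈ ∷ []
  zonePath (grow {R} {ps} g p r r∈ r∈A only p∉) {a} {b} a∈ b∈ with a ∈? R | b ∈? R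
  ... | yes a∈R | yes b∈R =
    let l , s , z = zonePath g a∈R b∈R in l , s , All.map (λ {v} → zone-grow v) z
  ... | no a∉R | yes b∈R =
    let l , s , z = zonePath g r∈ b∈R
        a∈A = ∈-grow⁻ {R} a∈ a∉R
    in inj₁ p ∷ inj₂ r ∷ l
     , step a∈A (step r∈A s (zone-avoid {R} {ps} p∉ z))
         (λ { (there q) → zone-avoid {R} {ps} a∉R z q })
     , a∈ ∷ here refl ∷ All.map (λ {v} → zone-grow v) z
  ... | yes a∈R | no b∉R =
    let l , s , z = zonePath g a∈R r∈
        b∈A = ∈-grow⁻ {R} b∈ b∉R
        s₁ = snoc s r∈A (zone-avoid {R} {ps} p∉ z)
        s₂ = snoc s₁ b∈A (λ q → [ zone-avoid {R} {ps} b∉R z , (λ { (here ()) }) ]′ (∈-++⁻ (inj₂ a ∷ l) q))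
        z′ = All.map (λ {v} → zone-grow v) z
    in (l ++ inj₁ p ∷ []) ++ inj₂ b ∷ [] , s₂
     , Allₚ.++⁺ (Allₚ.++⁺ z′ (here refl ∷ [])) (b∈ ∷ [])
  ... | no a∉R | no b∉R with a ≟ b
  ...   | yes refl = [] , here , a∈ ∷ []
  ...   | no a≢b = inj₁ p ∷ inj₂ b ∷ []
          , step (∈-grow⁻ {R} a∈ a∉R) (step (∈-grow⁻ {R} b∈ b∉R) here (λ { (here ()) }))
              (λ { (there (here q)) → a≢b (inj₂-injective q) })
          , a∈ ∷ here refl ∷ b∈ ∷ []

  -- The path from a to b inside the zone closes up through p, which is not in the zone.
  excess-cycle : ∀ {R ps} → Grown R ps → ∀ {p a b} → p ∉ used ps → a Sub.∈ A p → a Sub.∈ R → b Sub.∈ A p → b Sub.∈ R → a ≢ b →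
    ¬ Acyclic
  excess-cycle {R} {ps} g p∉ a∈A a∈R b∈A b∈R a≢b acyclic =
    let l , s , z = zonePath g a∈R b∈R
    in acyclic _ (path-cycle s (a≢b ∘ inj₂-injective) a∈A b∈A (zone-avoid {R} {ps} p∉ z))

  closed-disconnected : ∀ {R ps todo} → Grown R ps → used ps ++ todo ↭ allFin m →
    (∀ {p b} → p ∈ todo → b Sub.∈ A p → b Sub.∉ R) → ∀ {v} → v Sub.∉ R → ¬ Connected
  closed-disconnected {R} {ps} {todo} g perm apart {v} v∉ conn = v∉ (go (conn (inj₂ i) (inj₂ v)) (root∈ g))
    where
    go : ∀ {u w} → Walk u w → Zone R ps u → Zone R ps w
    go here z = z
    go (step {inj₁ p} {inj₂ b} e w) z = go w (used⊆ g z e)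
    go (step {inj₂ b} {inj₁ p} e w) z with ∈-++⁻ (used ps) (Permₚ.∈-resp-↭ (↭-sym perm) (∈-allFin p))
    ... | inj₁ q = go w q
    ... | inj₂ q = ⊥-elim (apart q e z)

  -- For a fully grown family this is the distance to i in G(𝒜), fixed when a vertex is first
  -- reached; the two steps lead to the hyperedge and on to its attachment vertex. Values outside R
  -- are placeholders.
  vertexDepth : ∀ {R ps} → Grown R ps → Fin n → ℕ
  vertexDepth base v = 0
  vertexDepth (grow {R} g p r _ _ _ _) v = if does (v ∈? R) then vertexDepth g v else suc (suc (vertexDepth g r))

  edgeDepth : ∀ {R ps} → Grown R ps → Fin m → ℕ
  edgeDepth base q = 0
  edgeDepth (grow g p r _ _ _ _) q = if does (q ≟ p) then suc (vertexDepth g r) else edgeDepth g q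

  attached∈ : ∀ {R ps q r} → Grown R ps → (q , r) ∈ ps → r Sub.∈ R × r Sub.∈ A q
  attached∈ (grow g p r r∈ r∈A _ _) (here refl) = Subₚ.x∈p∪q⁺ (inj₁ r∈) , r∈A
  attached∈ (grow g p r _ _ _ _) (there q) = let r∈ , r∈A = attached∈ g q in Subₚ.x∈p∪q⁺ (inj₁ r∈) , r∈A

  edgeDepth-attached : ∀ {R ps q r} (g : Grown R ps) → (q , r) ∈ ps → edgeDepth g q ≡ suc (vertexDepth g r)
  edgeDepth-attached (grow {R} g p r r∈ _ _ p∉) (here refl) with p ≟ p | r ∈? R
  ... | yes _ | yes _ = refl
  ... | no p≢p | _ = ⊥-elim (p≢p refl)
  ... | _ | no r∉ = ⊥-elim (r∉ r∈)
  edgeDepth-attached {q = q} {s} (grow {R} g p r r∈ _ _ p∉) (there e) with q ≟ p | s ∈? R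
  ... | yes refl | _ = ⊥-elim (p∉ (∈-map⁺ proj₁ e))
  ... | no _ | yes _ = edgeDepth-attached g e
  ... | no _ | no s∉ = ⊥-elim (s∉ (proj₁ (attached∈ g e)))

  vertexDepth-child : ∀ {R ps q r b} (g : Grown R ps) → (q , r) ∈ ps → b Sub.∈ A q → b ≢ r →
    vertexDepth g b ≡ suc (edgeDepth g q)
  vertexDepth-child {b = b} (grow {R} g p r r∈ _ only p∉) (here refl) b∈ b≢r with p ≟ p | b ∈? R
  ... | yes _ | no _ = refl
  ... | no p≢p | _ = ⊥-elim (p≢p refl)
  ... | _ | yes b∈R = ⊥-elim (b≢r (only b b∈ b∈R))
  vertexDepth-child {q = q} {b = b} (grow {R} g p r r∈ _ only p∉) (there e) b∈ b≢r with q ≟ p | b ∈? R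
  ... | yes refl | _ = ⊥-elim (p∉ (∈-map⁺ proj₁ e))
  ... | no _ | yes _ = vertexDepth-child g e b∈ b≢r
  ... | no _ | no b∉ = ⊥-elim (b∉ (used⊆ g (∈-map⁺ proj₁ e) b∈))

  vertexDepth-root : ∀ {R ps} (g : Grown R ps) → vertexDepth g i ≡ 0
  vertexDepth-root base = refl
  vertexDepth-root (grow {R} g p r _ _ _ _) with i ∈? R
  ... | yes _ = vertexDepth-root g
  ... | no i∉ = ⊥-elim (i∉ (root∈ g))

  -- A hyperedge attached later shares only its attachment vertex with the earlier ones, so a vertex
  -- lies below at most one hyperedge.
  child-unique : ∀ {R ps v q r q′ r′} → Grown R ps → (q , r) ∈ ps → (q′ , r′) ∈ ps →
    v Sub.∈ A q → v Sub.∈ A q′ → v ≢ r → v ≢ r′ → q ≡ q′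
  child-unique (grow g p r _ _ _ _) (here refl) (here refl) _ _ _ _ = refl
  child-unique (grow g p r _ _ only _) (here refl) (there e) v∈ v∈′ v≢r _ =
    ⊥-elim (v≢r (only _ v∈ (used⊆ g (∈-map⁺ proj₁ e) v∈′)))
  child-unique (grow g p r _ _ only _) (there e) (here refl) v∈ v∈′ _ v≢r =
    ⊥-elim (v≢r (only _ v∈′ (used⊆ g (∈-map⁺ proj₁ e) v∈)))
  child-unique (grow g p r _ _ _ _) (there e) (there e′) v∈ v∈′ v≢r v≢r′ = child-unique g e e′ v∈ v∈′ v≢r v≢r′

  rootWalk : ∀ {R ps} (g : Grown R ps) {v} → v Sub.∈ R →
    Σ (Walk (inj₂ v) (inj₂ i)) λ w → walkLength w ≡ vertexDepth g v
  rootWalk base v∈ with Subₚ.x∈⁅y⁆⇒x≡y i v∈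
  ... | refl = here , refl
  rootWalk (grow {R} g p r r∈ r∈A _ _) {v} v∈ with v ∈? R
  ... | yes v∈R = rootWalk g v∈R
  ... | no v∉R = let w , e = rootWalk g r∈ in
        step {w = inj₁ p} (∈-grow⁻ {R} v∈ v∉R) (step {w = inj₂ r} r∈A w) , cong (λ k → suc (suc k)) e

  -- Of the at least two vertices of an attached hyperedge only one is in R, so R gains a vertex
  -- each time. This bounds the number of hyperedges of a cactus below n.
  size-grown : (∀ p → 2 ≤ ∣ A p ∣) → ∀ {R ps} → Grown R ps → suc (length ps) ≤ ∣ R ∣
  size-grown big base = ℕₚ.≤-reflexive (sym (Subₚ.∣⁅x⁆∣≡1 i))
  size-grown big (grow {R} g p r r∈ r∈A only _) = ℕₚ.≤-trans (s≤s (size-grown big g))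
    (Subₚ.p⊂q⇒∣p∣<∣q∣ ((λ q → Subₚ.x∈p∪q⁺ (inj₁ q)) , new))
    where
    new : ∃ λ x → x Sub.∈ R ∪ A p × x Sub.∉ R
    new with two-elements (A p) (big p)
    ... | a , b , a∈ , b∈ , a≢b with a ∈? R | b ∈? R
    ...   | no a∉ | _ = a , Subₚ.x∈p∪q⁺ (inj₂ a∈) , a∉
    ...   | yes _ | no b∉ = b , Subₚ.x∈p∪q⁺ (inj₂ b∈) , b∉
    ...   | yes a∈R | yes b∈R = ⊥-elim (a≢b (≡.trans (only a a∈ a∈R) (sym (only b b∈ b∈R))))

  FullyGrown : Set
  FullyGrown = ∃ λ ps → Grown ⊤ ps × used ps ↭ allFin m

  record Excess : Set where
    field
      {R}           : Subset n
      {ps}          : List (Fin m × Fin n)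
      {p}           : Fin m
      {todo}        : List (Fin m)
      {a b}         : Fin n
      grown         : Grown R ps
      cover         : used ps ++ p ∷ todo ↭ allFin m
      a∈A           : a Sub.∈ A p
      a∈R           : a Sub.∈ R
      b∈A           : b Sub.∈ A p
      b∈R           : b Sub.∈ R
      b≢a           : b ≢ a

  record Closed : Set where
    field
      {R}           : Subset n
      {ps}          : List (Fin m × Fin n)
      {todo}        : List (Fin m)
      {v}           : Fin n
      grown         : Grown R ps
      cover         : used ps ++ todo ↭ allFin m
      v∉R           : v Sub.∉ R
      apart         : ∀ {p b} → p ∈ todo → b Sub.∈ A p → b Sub.∉ R

  data Outcome : Set where
    full   : FullyGrown → Outcome
    excess : Excess → Outcome
    closed : Closed → Outcome

  find-touching : ∀ R todo →
    (∃ λ p → ∃ λ todo′ → todo ↭ p ∷ todo′ × Nonempty (A p ∩ R)) ⊎ (∀ {p b} → p ∈ todo → b Sub.∈ A p → b Sub.∉ R)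
  find-touching R [] = inj₂ (λ ())
  find-touching R (q ∷ todo) with Subₚ.nonempty? (A q ∩ R) | find-touching R todo
  ... | yes ne | _ = inj₁ (q , todo , refl , ne)
  ... | no _ | inj₁ (p , todo′ , perm , ne) = inj₁ (p , q ∷ todo′ , trans (prep q perm) (swap q p refl) , ne)
  ... | no ¬ne | inj₂ none = inj₂ λ { (here refl) b∈A b∈R → ¬ne (_ , Subₚ.x∈p∩q⁺ (b∈A , b∈R)) ; (there e) → none e }

  module _ (nonempty : ∀ p → Nonempty (A p)) where

    grow-all : ∀ k {R ps} todo → length todo ≡ k → Grown R ps → used ps ++ todo ↭ allFin m → Outcome
    grow-all k {R} {ps} todo len g cover with find-touching R todo
    grow-all k {R} {ps} todo len g cover | inj₂ none with Finₚ.any? (λ v → ¬? (v ∈? R))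
    ... | yes (v , v∉) = closed (record { grown = g ; cover = cover ; v∉R = v∉ ; apart = none })
    ... | no all∈ with todo
    -- All vertices are reached, so a hyperedge that avoids R would be empty.
    ...   | p ∷ _ = let b , b∈ = nonempty p in ⊥-elim (all∈ (b , none (here refl) b∈))
    ...   | [] = full (ps , subst (λ S → Grown S ps) R≡⊤ g , subst (_↭ allFin m) (++-identityʳ (used ps)) cover)
      where
      R≡⊤ : R ≡ ⊤
      R≡⊤ = Subₚ.⊆-antisym Subₚ.⊆⊤ λ {x} _ → decidable-stable (x ∈? R) (λ q → all∈ (x , q))
    grow-all k {R} {ps} todo len g cover | inj₁ (p , todo′ , perm , r , r∈) with Subₚ.x∈p∩q⁻ (A p) R r∈
    ... | r∈A , r∈R with Finₚ.any? (λ b → (b ∈? A p) ×-dec (b ∈? R) ×-dec ¬? (b ≟ r))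
    ...   | yes (b , b∈A , b∈R , b≢r) = excess (record
              { grown = g ; cover = ↭-trans (Permₚ.++⁺ˡ (used ps) (↭-sym perm)) cover
              ; a∈A = r∈A ; a∈R = r∈R ; b∈A = b∈A ; b∈R = b∈R ; b≢a = b≢r })
    ...   | no none with k | ≡.trans (sym (Permₚ.↭-length perm)) len
    ...     | suc k′ | len′ = grow-all k′ todo′ (ℕₚ.suc-injective len′)
                (grow g p r r∈R r∈A only (unique-++⇒∉ (used ps) (unique-resp-↭ (↭-sym cover′) (Uniqueₚ.allFin⁺ m))))
                (↭-trans (↭-sym (Permₚ.shift p (used ps) todo′)) cover′)
      where
      cover′ : used ps ++ p ∷ todo′ ↭ allFin m
      cover′ = ↭-trans (Permₚ.++⁺ˡ (used ps) (↭-sym perm)) cover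
      only : ∀ b → b Sub.∈ A p → b Sub.∈ R → b ≡ r
      only b b∈A b∈R with b ≟ r
      ... | yes e = e
      ... | no ne = ⊥-elim (none (b , b∈A , b∈R , ne))

    outcome : Outcome
    outcome = grow-all m (allFin m) (length-tabulate _) base refl

    tree⇒fullyGrown : IsTree → FullyGrown
    tree⇒fullyGrown (conn , acyclic) with outcome
    ... | full f = f
    ... | excess x = let open Excess x in ⊥-elim (excess-cycle grown
            (unique-++⇒∉ (used ps) (unique-resp-↭ (↭-sym cover) (Uniqueₚ.allFin⁺ m))) b∈A b∈R a∈A a∈R b≢a acyclic)
    ... | closed x = let open Closed x in ⊥-elim (closed-disconnected grown cover apart v∉R conn)

  module FullyGrownTree {ps} (g : Grown ⊤ ps) (cover : used ps ↭ allFin m) where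

    attached : ∀ q → ∃ λ r → (q , r) ∈ ps
    attached q with ∈-map⁻ proj₁ (Permₚ.∈-resp-↭ (↭-sym cover) (∈-allFin q))
    ... | (_ , r) , e , refl = r , e

    depth : GVertex 𝒜 → ℕ
    depth (inj₁ q) = edgeDepth g q
    depth (inj₂ v) = vertexDepth g v

    -- Each edge of the grown graph leads from a hyperedge either up to its attachment vertex or
    -- down to another vertex, with a depth change of exactly one. All the conditions of `Depth` are
    -- read off from this.
    edge-cases : ∀ {q v} → v Sub.∈ A q → let r = proj₁ (attached q) in
      (v ≡ r × edgeDepth g q ≡ suc (vertexDepth g v)) ⊎ (v ≢ r × vertexDepth g v ≡ suc (edgeDepth g q))
    edge-cases {q} {v} v∈ with attached q
    ... | r , e with v ≟ r
    ...   | yes refl = inj₁ (refl , edgeDepth-attached g e)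
    ...   | no v≢r = inj₂ (v≢r , vertexDepth-child g e v∈ v≢r)

    <-of-suc : ∀ {a b} → b ≡ suc a → a < b
    <-of-suc refl = ℕₚ.≤-refl

    depth-monotone : ∀ {u v} → GEdge 𝒜 u v → depth u < depth v ⊎ depth v < depth u
    depth-monotone {inj₁ q} {inj₂ v} e with edge-cases {q} e
    ... | inj₁ (_ , p) = inj₂ (<-of-suc p)
    ... | inj₂ (_ , p) = inj₁ (<-of-suc p)
    depth-monotone {inj₂ v} {inj₁ q} e with edge-cases {q} e
    ... | inj₁ (_ , p) = inj₁ (<-of-suc p)
    ... | inj₂ (_ , p) = inj₂ (<-of-suc p)

    shallow-is-root : ∀ {q v} → v Sub.∈ A q → vertexDepth g v < edgeDepth g q → v ≡ proj₁ (attached q)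
    shallow-is-root {q} v∈ lt with edge-cases {q} v∈
    ... | inj₁ (p , _) = p
    ... | inj₂ (_ , p) = ⊥-elim (ℕₚ.<-asym lt (<-of-suc p))

    deep-not-root : ∀ {q v} → v Sub.∈ A q → edgeDepth g q < vertexDepth g v → v ≢ proj₁ (attached q)
    deep-not-root {q} v∈ lt with edge-cases {q} v∈
    ... | inj₁ (_ , p) = ⊥-elim (ℕₚ.<-asym lt (<-of-suc p))
    ... | inj₂ (p , _) = p

    -- The shallower neighbour of a hyperedge is its attachment vertex; that of a vertex is the
    -- hyperedge that brought it in, unique by `child-unique`.
    depth-parent-unique : ∀ {u v w} → GEdge 𝒜 u v → GEdge 𝒜 u w → depth v < depth u → depth w < depth u → v ≡ w
    depth-parent-unique {inj₁ q} {inj₂ v} {inj₂ w} e f lt lt′ =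
      cong inj₂ (≡.trans (shallow-is-root e lt) (sym (shallow-is-root f lt′)))
    depth-parent-unique {inj₂ v} {inj₁ q} {inj₁ q′} e f lt lt′ = cong inj₁
      (child-unique g (proj₂ (attached q)) (proj₂ (attached q′)) e f (deep-not-root e lt) (deep-not-root f lt′))

    connected : Connected
    connected u v = toVertex u ++ʷ (path-walk (proj₁ (proj₂ (zonePath g Subₚ.∈⊤ Subₚ.∈⊤))) ++ʷ fromVertex v)
      where
      rep : GVertex 𝒜 → Fin n
      rep (inj₁ q) = proj₁ (attached q)
      rep (inj₂ v) = v
      toVertex : ∀ u → Walk u (inj₂ (rep u))
      toVertex (inj₁ q) = step (proj₂ (attached∈ g (proj₂ (attached q)))) here
      toVertex (inj₂ v) = here
      fromVertex : ∀ u → Walk (inj₂ (rep u)) u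
      fromVertex (inj₁ q) = step (proj₂ (attached∈ g (proj₂ (attached q)))) here
      fromVertex (inj₂ v) = here

    isTree : IsTree
    isTree = connected
      , Depth.depth-acyclic (GEdge 𝒜) GEdge-sym depth depth-monotone depth-parent-unique

    -- The depth is 1-Lipschitz along edges and 0 at the root, hence a lower bound for the distance
    -- to the root; `rootWalk` attains it.
    depth-edge : ∀ {u v} → GEdge 𝒜 u v → depth u ≤ suc (depth v)
    depth-edge {inj₁ q} {inj₂ v} e with edge-cases {q} e
    ... | inj₁ (_ , p) = ℕₚ.≤-reflexive p
    ... | inj₂ (_ , p) = ℕₚ.m≤n⇒m≤1+n (ℕₚ.<⇒≤ (<-of-suc p))
    depth-edge {inj₂ v} {inj₁ q} e with edge-cases {q} e
    ... | inj₁ (_ , p) = ℕₚ.m≤n⇒m≤1+n (ℕₚ.<⇒≤ (<-of-suc p))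
    ... | inj₂ (_ , p) = ℕₚ.≤-reflexive p

    depth-walk : ∀ {u v} (w : Walk u v) → depth u ≤ walkLength w ℕ.+ depth v
    depth-walk here = ℕₚ.≤-refl
    depth-walk (step e w) = ℕₚ.≤-trans (depth-edge e) (s≤s (depth-walk w))

    depth-rootWalk : ∀ {u} (w : Walk u (inj₂ i)) → depth u ≤ walkLength w
    depth-rootWalk w = ℕₚ.≤-trans (depth-walk w)
      (ℕₚ.≤-reflexive (≡.trans (cong (walkLength w ℕ.+_) (vertexDepth-root g)) (ℕₚ.+-identityʳ _)))

    -- A first vertex j other than r lies one deeper than q, so a walk through j has at least two
    -- more edges than the depth of q, while the walk through r has exactly that depth as its
    -- length.
    localRoot≡attached : ∀ {q r j} → (q , r) ∈ ps → FirstOnShortestPath (inj₁ q) (inj₂ i) (inj₂ j) → j ≡ r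
    localRoot≡attached {q} {r} {j} e (step {w = inj₂ v} f w , refl , shortest) with j ≟ r
    ... | yes p = p
    ... | no j≢r = ⊥-elim (ℕₚ.<-irrefl refl (ℕₚ.≤-trans (s≤s (depth-rootWalk w)) (ℕₚ.≤-trans (shortest s) bound)))
      where
      r-walk = rootWalk g {r} Subₚ.∈⊤
      s : Walk (inj₁ q) (inj₂ i)
      s = step (proj₂ (attached∈ g e)) (proj₁ r-walk)
      bound : walkLength s ≤ vertexDepth g j
      bound = ℕₚ.≤-trans (ℕₚ.≤-reflexive (≡.trans (cong suc (proj₂ r-walk)) (sym (edgeDepth-attached g e))))
        (ℕₚ.<⇒≤ (<-of-suc (vertexDepth-child g e f j≢r)))

-- Circulations of a sequence.

decompose : ∀ {a} {X : Set a} (α : List X) s → α ≡ take (toℕ s) α ++ lookup α s ∷ drop (suc (toℕ s)) α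
decompose (x ∷ α) zero = refl
decompose (x ∷ α) (suc s) = cong (x ∷_) (decompose α s)

circulation-↭ : ∀ {n} (α : List (Fin n)) s → α ↭ lookup α s ∷ circulation α s
circulation-↭ α s = ↭-trans (↭-reflexive (decompose α s))
  (Permₚ.++-comm (take (toℕ s) α) (lookup α s ∷ drop (suc (toℕ s)) α))

concat-map-↭ : ∀ {a b} {X : Set a} {Y : Set b} (f : X → List Y) {xs ys} → xs ↭ ys → concat (map f xs) ↭ concat (map f ys)
concat-map-↭ f refl = refl
concat-map-↭ f (prep x p) = Permₚ.++⁺ˡ (f x) (concat-map-↭ f p)
concat-map-↭ f (swap x y p) = ↭-trans (Permₚ.shifts (f x) (f y)) (Permₚ.++⁺ˡ (f y) (Permₚ.++⁺ˡ (f x) (concat-map-↭ f p)))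
concat-map-↭ f (trans p q) = trans (concat-map-↭ f p) (concat-map-↭ f q)

module _ {n : ℕ} {α : List (Fin n)} (u : Unique α) (s : Fin (length α)) where

  private
    unique∷ : Unique (lookup α s ∷ circulation α s)
    unique∷ = unique-resp-↭ (circulation-↭ α s) u

  circulation-unique : Unique (circulation α s)
  circulation-unique with unique∷
  ... | _ ∷ v = v

  ∈-circulation⁻ : ∀ {b} → b ∈ circulation α s → b ∈ α × b ≢ lookup α s
  ∈-circulation⁻ b∈ with unique∷
  ... | r∉ ∷ _ = Permₚ.∈-resp-↭ (↭-sym (circulation-↭ α s)) (there b∈) , λ { refl → All.lookup r∉ b∈ refl }

  ∈-circulation⁺ : ∀ {b} → b ∈ α → b ≢ lookup α s → b ∈ circulation α s
  ∈-circulation⁺ b∈ b≢ with Permₚ.∈-resp-↭ (circulation-↭ α s) b∈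
  ... | here e = ⊥-elim (b≢ e)
  ... | there q = q

-- Makes the product of generators over a circulation central, so that reordering the blocks costs
-- no sign.
even-circulation : ∀ {n} (α : List (Fin n)) s → Odd (length α) → oddᵇ (length (circulation α s)) ≡ false
even-circulation α s o = not-true (≡.trans (≡.sym (≡.trans (cong oddᵇ (Permₚ.↭-length (circulation-↭ α s)))
    (oddᵇ-suc (length (circulation α s))))) o)
  where
  not-true : ∀ {b} → not b ≡ true → b ≡ false
  not-true {false} _ = refl

-- Evaluating the product of hyperedge factors along a growth.

module GrowthAlgebra {c ℓ : Level} (K : CommutativeRing c ℓ) (φ : ℚ → CommutativeRing.Carrier K)
    {n : ℕ} (𝒜 : List (Subset n)) (i : Fin n) (seq : Fin (length 𝒜) → List (Fin n))
    (seq-unique : ∀ p → Unique (seq p)) (seq-odd : ∀ p → Odd (length (seq p)))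
    (∈-seq⁺ : ∀ {p b} → b Sub.∈ lookup 𝒜 p → b ∈ seq p) (∈-seq⁻ : ∀ {p b} → b ∈ seq p → b Sub.∈ lookup 𝒜 p) where

  open OverRing K φ renaming (gadd to infixl 6 _⊕_; gmul to infixl 7 _⊗_)
  open GrassRing K φ
  open Derivation K φ
  open GrassProducts K φ
  open TopCoefficient K φ
  open Growth 𝒜 i
  private
    module K = CommutativeRing K
    module A {n : ℕ} where
      open Relation.Binary.Reasoning.Setoid (gsetoid n) public
  open CommutativeRing K using (Carrier; _+_; _*_; -_; 0#; 1#)

  -- The ordering `seq p` of each hyperedge is left open: increasing order is used for families that
  -- may contribute zero, the order of a given refined cactus for the value.
  S : Fin m → Grass n
  S p = ∂ (χs (seq p))

  S-even : ∀ p → Even′ (S p)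
  S-even p = ∂-χs-even (seq p) (seq-odd p)

  S-circulation : ∀ p s → S p ≈ᵍ θs (lookup (seq p) s) (circulation (seq p) s)
  S-circulation p s = ≈ᵍ-trans (≡⇒≈ᵍ (cong (∂ ∘ χs) eq))
    (∂-χs-rotate (take (toℕ s) (seq p)) _ _ (≡.trans (cong (oddᵇ ∘ length) (≡.sym eq)) (seq-odd p)))
    where
    eq = decompose (seq p) s

  private
    at : ∀ {p r} → r Sub.∈ A p → Fin (length (seq p))
    at r∈ = Any.index (∈-seq⁺ r∈)

    rest : ∀ {p r} → r Sub.∈ A p → List (Fin n)
    rest {p} r∈ = circulation (seq p) (at r∈)

    lookup-at : ∀ {p r} (r∈ : r Sub.∈ A p) → lookup (seq p) (at r∈) ≡ r
    lookup-at {p} r∈ = ≡.sym (lookup-index (∈-seq⁺ r∈))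

    S-rest : ∀ {p r} (r∈ : r Sub.∈ A p) → S p ≈ᵍ θs r (rest r∈)
    S-rest {p} r∈ = ≈ᵍ-trans (S-circulation p (at r∈)) (≡⇒≈ᵍ (cong (λ r → θs r (rest r∈)) (lookup-at r∈)))

    ∈-rest⁺ : ∀ {p r b} (r∈ : r Sub.∈ A p) → b Sub.∈ A p → b ≢ r → b ∈ rest r∈
    ∈-rest⁺ {p} r∈ b∈ b≢r = ∈-circulation⁺ (seq-unique p) (at r∈) (∈-seq⁺ b∈) (λ e → b≢r (≡.trans e (lookup-at r∈)))

    ∈-rest⁻ : ∀ {p r b} (r∈ : r Sub.∈ A p) → b ∈ rest r∈ → b Sub.∈ A p
    ∈-rest⁻ {p} r∈ b∈ = ∈-seq⁻ (proj₁ (∈-circulation⁻ (seq-unique p) (at r∈) b∈))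

  prefix : List (Fin m × Fin n) → Grass n
  prefix ps = χ i ⊗ gprod (map S (used ps))

  prefix-∷ : ∀ p r ps → prefix ((p , r) ∷ ps) ≈ᵍ prefix ps ⊗ S p
  prefix-∷ p r ps = ≈ᵍ-trans (gmul-cong ≈ᵍ-refl (even-comm (S-even p) _)) (≈ᵍ-sym (gmul-assoc _ _ _))

  -- For a vertex reached earlier the property survives multiplication by a further factor. A new
  -- vertex is one of the generators into which `θs⇒χs` turns that factor.
  prefix-kill : ∀ {R ps} → Grown R ps → ∀ {v} → v Sub.∈ R → prefix ps ⊗ χ v ≈ᵍ gzero
  prefix-kill base v∈ with Subₚ.x∈⁅y⁆⇒x≡y i v∈
  ... | refl = kill-extend (χ-square i) gone
  prefix-kill (grow {R} {ps} g p r r∈ r∈A _ _) {v} v∈ = ≈ᵍ-trans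
    (gmul-cong (≈ᵍ-trans (prefix-∷ p r ps) (≈ᵍ-trans (gmul-cong ≈ᵍ-refl (S-rest r∈A)) (θs⇒χs (prefix-kill g r∈) (rest r∈A)))) ≈ᵍ-refl)
    killed
    where
    killed : (prefix ps ⊗ χs (rest r∈A)) ⊗ χ v ≈ᵍ gzero
    killed with v ∈? R
    ... | yes v∈R = kill-extend (prefix-kill g v∈R) _
    ... | no v∉R = ≈ᵍ-trans (gmul-assoc _ _ _) (≈ᵍ-trans (gmul-cong ≈ᵍ-refl
            (χs-kill (∈-rest⁺ r∈A (∈-grow⁻ {R} v∈ v∉R) (λ { refl → v∉R r∈ })))) (gmul-zeroʳ _))

  total : Grass n
  total = χ i ⊗ gprod (map S (allFin m))

  -- Rooted at a, the factor of `A p` becomes a product of generators that contains χ b, and the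
  -- prefix is already killed by χ b.
  excess⇒0 : Excess → berezin total ≈ 0#
  excess⇒0 x = K.trans (berezin-cong vanish) (berezin-gzero {n})
    where
    open Excess x
    M⊗Sp : prefix ps ⊗ S p ≈ᵍ gzero
    M⊗Sp = ≈ᵍ-trans (gmul-cong ≈ᵍ-refl (S-rest a∈A)) (≈ᵍ-trans (θs⇒χs (prefix-kill grown a∈R) (rest a∈A))
      (kill-χs (prefix-kill grown b∈R) (∈-rest⁺ a∈A b∈A b≢a)))
    vanish : total ≈ᵍ gzero
    vanish = A.begin
      χ i ⊗ gprod (map S (allFin m))
        A.≈⟨ gmul-cong ≈ᵍ-refl (gprod-↭ S S-even (↭-sym cover)) ⟩
      χ i ⊗ gprod (map S (used ps ++ p ∷ todo))
        A.≈⟨ gmul-cong ≈ᵍ-refl (≈ᵍ-trans (≡⇒≈ᵍ (cong gprod (map-++ S (used ps) (p ∷ todo)))) (gprod-++ (map S (used ps)) _)) ⟩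
      χ i ⊗ (gprod (map S (used ps)) ⊗ (S p ⊗ gprod (map S todo)))
        A.≈⟨ ≈ᵍ-trans (≈ᵍ-sym (gmul-assoc _ _ _)) (≈ᵍ-sym (gmul-assoc _ _ _)) ⟩
      (prefix ps ⊗ S p) ⊗ gprod (map S todo)
        A.≈⟨ ≈ᵍ-trans (gmul-cong M⊗Sp ≈ᵍ-refl) (gmul-zeroˡ _) ⟩
      gzero A.∎

  -- The derivation along the complement of R kills χ i and every factor S p.
  closed⇒0 : (∀ p → Nonempty (A p)) → Closed → berezin total ≈ 0#
  closed⇒0 nonempty x = berezin-closed w {v} {total} (w-out v∉R)
    (D-gmul-closed w (≈ᵍ-trans (D-χ w i) (gconst-cong (w-in (root∈ grown)))) (D-gprod-closed w S D-S (allFin m)))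
    where
    open Closed x
    w : Fin n → Carrier
    w v = if does (v ∈? R) then 0# else 1#
    w-in : ∀ {v} → v Sub.∈ R → w v ≈ 0#
    w-in {v} v∈ with v ∈? R
    ... | yes _ = K.refl
    ... | no v∉ = ⊥-elim (v∉ v∈)
    w-out : ∀ {v} → v Sub.∉ R → w v ≈ 1#
    w-out {v} v∉ with v ∈? R
    ... | yes v∈ = ⊥-elim (v∉ v∈)
    ... | no _ = K.refl
    D-S : ∀ p → D w (S p) ≈ᵍ gzero
    D-S p with nonempty p
    ... | r , r∈ = ≈ᵍ-trans (D-cong w (S-rest r∈)) (D-θs w (rest r∈)
            (λ b∈ → constant (∈-++⁻ (used ps) (Permₚ.∈-resp-↭ (↭-sym cover) (∈-allFin p))) (∈-rest⁻ r∈ b∈)))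
      where
      constant : ∀ {b} → p ∈ used ps ⊎ p ∈ todo → b Sub.∈ A p → w b ≈ w r
      constant (inj₁ q) b∈ = K.trans (w-in (used⊆ grown q b∈)) (K.sym (w-in (used⊆ grown q r∈)))
      constant (inj₂ q) b∈ = K.trans (w-out (apart q b∈)) (K.sym (w-out (apart q r∈)))

  module Value {ps} (g : Grown ⊤ ps) (cover : used ps ↭ allFin m) (root : ∀ p → Fin (length (seq p)))
      (root-attached : ∀ {p r} → (p , r) ∈ ps → lookup (seq p) (root p) ≡ r) where

    circ : Fin m → List (Fin n)
    circ p = circulation (seq p) (root p)

    circs : List (Fin m × Fin n) → List (Fin n)
    circs qs = concat (map circ (used qs))

    circ-even : ∀ p → Even′ (χs (circ p))
    circ-even p = subst (λ b → HasParity b (χs (circ p))) (even-circulation (seq p) (root p) (seq-odd p))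
      (gprod-parity χ χ-odd (circ p))

    prefix-value : ∀ {R qs} → Grown R qs → (∀ {p r} → (p , r) ∈ qs → lookup (seq p) (root p) ≡ r) →
      prefix qs ≈ᵍ χs (i ∷ circs qs)
    prefix-value base _ = ≈ᵍ-refl
    prefix-value (grow {R} {qs} h p r r∈ _ _ _) att = A.begin
      prefix ((p , r) ∷ qs)                A.≈⟨ prefix-∷ p r qs ⟩
      prefix qs ⊗ S p                      A.≈⟨ gmul-cong ≈ᵍ-refl (≈ᵍ-trans (S-circulation p (root p))
                                                (≡⇒≈ᵍ (cong (λ r → θs r (circ p)) (att (here refl))))) ⟩
      prefix qs ⊗ θs r (circ p)            A.≈⟨ θs⇒χs (prefix-kill h r∈) (circ p) ⟩
      prefix qs ⊗ χs (circ p)              A.≈⟨ gmul-cong (prefix-value h (att ∘ there)) ≈ᵍ-refl ⟩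
      (χ i ⊗ χs (circs qs)) ⊗ χs (circ p)  A.≈⟨ gmul-assoc _ _ _ ⟩
      χ i ⊗ (χs (circs qs) ⊗ χs (circ p))  A.≈⟨ gmul-cong ≈ᵍ-refl (≈ᵍ-sym (even-comm (circ-even p) _)) ⟩
      χ i ⊗ (χs (circ p) ⊗ χs (circs qs))  A.≈⟨ gmul-cong ≈ᵍ-refl (≈ᵍ-sym (χs-++ (circ p) (circs qs))) ⟩
      χs (i ∷ circs ((p , r) ∷ qs)) A.∎

    circs⊆ : ∀ {R qs} → Grown R qs → ∀ {v} → v ∈ i ∷ circs qs → v Sub.∈ R
    circs⊆ h (here refl) = root∈ h
    circs⊆ (grow {R} {qs} h p r _ _ _ _) (there v∈) with ∈-++⁻ (circ p) v∈
    ... | inj₁ q = Subₚ.x∈p∪q⁺ (inj₂ (∈-seq⁻ (proj₁ (∈-circulation⁻ (seq-unique p) (root p) q))))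
    ... | inj₂ q = Subₚ.x∈p∪q⁺ (inj₁ (circs⊆ h (there q)))

    circs-full : ∀ {R qs} → Grown R qs → (∀ {p r} → (p , r) ∈ qs → lookup (seq p) (root p) ≡ r) →
      ∀ {v} → v Sub.∈ R → v ∈ i ∷ circs qs
    circs-full base _ v∈ = here (Subₚ.x∈⁅y⁆⇒x≡y i v∈)
    circs-full (grow {R} {qs} h p r r∈ _ _ _) att {v} v∈ with v ∈? R
    ... | yes v∈R = ∷-++⁺ʳ (circs-full h (att ∘ there) v∈R)
      where
      ∷-++⁺ʳ : ∀ {v} → v ∈ i ∷ circs qs → v ∈ i ∷ circ p ++ circs qs
      ∷-++⁺ʳ (here e) = here e
      ∷-++⁺ʳ (there q) = there (∈-++⁺ʳ (circ p) q)
    ... | no v∉R = there (∈-++⁺ˡ (∈-circulation⁺ (seq-unique p) (root p) (∈-seq⁺ (∈-grow⁻ {R} v∈ v∉R))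
            (λ e → v∉R (subst (Sub._∈ R) (≡.sym (≡.trans e (att (here refl)))) r∈))))

    -- The circulation of a new hyperedge omits its attachment vertex, the only one of its vertices
    -- in R, so it is disjoint from i and all earlier circulations.
    circs-unique : ∀ {R qs} → Grown R qs → (∀ {p r} → (p , r) ∈ qs → lookup (seq p) (root p) ≡ r) →
      Unique (i ∷ circs qs)
    circs-unique base _ = [] ∷ []
    circs-unique (grow {R} {qs} h p r r∈ _ only _) att with circs-unique h (att ∘ there)
    ... | i∉ ∷ u = All.tabulate i-new ∷ Uniqueₚ.++⁺ (circulation-unique (seq-unique p) (root p)) u
            (λ { (q , q′) → circ-new q (circs⊆ h (there q′)) })
      where
      circ-new : ∀ {v} → v ∈ circ p → v Sub.∉ R
      circ-new v∈ v∈R with ∈-circulation⁻ (seq-unique p) (root p) v∈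
      ... | v∈seq , v≢ = v≢ (≡.trans (only _ (∈-seq⁻ v∈seq) v∈R) (≡.sym (att (here refl))))
      i-new : ∀ {v} → v ∈ circ p ++ circs qs → i ≢ v
      i-new v∈ refl with ∈-++⁻ (circ p) v∈
      ... | inj₁ q = circ-new q (root∈ h)
      ... | inj₂ q = All.lookup i∉ q refl

    π : List (Fin n)
    π = i ∷ concat (map circ (allFin m))

    π-↭ : i ∷ circs ps ↭ π
    π-↭ = prep i (concat-map-↭ circ cover)

    χs-concat : ∀ qs → χs (concat (map circ qs)) ≈ᵍ gprod (map (χs ∘ circ) qs)
    χs-concat [] = ≈ᵍ-refl
    χs-concat (q ∷ qs) = ≈ᵍ-trans (χs-++ (circ q) _) (gmul-cong ≈ᵍ-refl (χs-concat qs))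

    -- The order of growth differs from the order of the list. The even factors are first brought
    -- into the order of growth, evaluated there, and the even blocks of generators are then brought
    -- back.
    total-value : total ≈ᵍ χs π
    total-value = A.begin
      χ i ⊗ gprod (map S (allFin m))             A.≈⟨ gmul-cong ≈ᵍ-refl (gprod-↭ S S-even (↭-sym cover)) ⟩
      prefix ps                                  A.≈⟨ prefix-value g root-attached ⟩
      χ i ⊗ χs (circs ps)                        A.≈⟨ gmul-cong ≈ᵍ-refl (χs-concat (used ps)) ⟩
      χ i ⊗ gprod (map (χs ∘ circ) (used ps))    A.≈⟨ gmul-cong ≈ᵍ-refl (gprod-↭ (χs ∘ circ) circ-even cover) ⟩
      χ i ⊗ gprod (map (χs ∘ circ) (allFin m))   A.≈⟨ gmul-cong ≈ᵍ-refl (≈ᵍ-sym (χs-concat (allFin m))) ⟩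
      χs π A.∎

    berezin-total : berezin total ≈ signK (inversions π)
    berezin-total = K.trans (berezin-cong total-value) (berezin-χs (unique-resp-↭ π-↭ (circs-unique g root-attached))
      (λ v → Permₚ.∈-resp-↭ π-↭ (circs-full g root-attached Subₚ.∈⊤)))

  gprod-gscale : ∀ {a} {X : Set a} (t : X → Carrier) (f : X → Grass n) xs →
    gprod (map (λ x → gscale (t x) (f x)) xs) ≈ᵍ gscale (productK (map t xs)) (gprod (map f xs))
  gprod-gscale t f [] = ≈ᵍ-sym (gscale-identity _)
  gprod-gscale t f (x ∷ xs) = ≈ᵍ-trans (gmul-gscaleˡ _ _ _) (≈ᵍ-trans
    (gscale-cong K.refl (≈ᵍ-trans (gmul-cong ≈ᵍ-refl (gprod-gscale t f xs)) (gmul-gscaleʳ _ _ _)))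
    (gscale-gscale _ _ _))

  berezin-weighted : ∀ (t : Fin m → Carrier) →
    berezin (χ i ⊗ gprod (map (λ p → gscale (t p) (S p)) (allFin m))) ≈ productK (map t (allFin m)) * berezin total
  berezin-weighted t = K.trans
    (berezin-cong (≈ᵍ-trans (gmul-cong {f = χ i} ≈ᵍ-refl (gprod-gscale t S (allFin m))) (gmul-gscaleʳ _ (χ i) _)))
    (berezin-gscale (productK (map t (allFin m))) total)

-- Enumerating odd sets and families of them.

-- A member determines by its `size` the piece it comes from, so different pieces are disjoint.
concatMap-unique : ∀ {a b} {X : Set a} {Y : Set b} (size : Y → X) (f : X → List Y) →
  (∀ x → Unique (f x)) → (∀ {x y} → y ∈ f x → size y ≡ x) → ∀ {xs} → Unique xs → Unique (concatMap f xs)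
concatMap-unique size f u sized {xs} v = Uniqueₚ.concat⁺ (Allₚ.map⁺ (All.universal u xs))
  (AllPairsₚ.map⁺ (AllPairs.map (λ x≢x′ → λ { (p , q) → x≢x′ (≡.trans (≡.sym (sized p)) (sized q)) }) v))

∈-subsets⁺ : ∀ {n} (A : Subset n) → A ∈ subsets n ∣ A ∣
∈-subsets⁺ [] = here refl
∈-subsets⁺ (true ∷ A) = ∈-++⁺ʳ (map (Vec._∷_ outside) (subsets _ (suc ∣ A ∣))) (∈-map⁺ (Vec._∷_ inside) (∈-subsets⁺ A))
∈-subsets⁺ {suc n} (false ∷ A) with ∣ A ∣ | ∈-subsets⁺ A
... | zero | p = ∈-map⁺ (Vec._∷_ outside) p
... | suc k | p = ∈-++⁺ˡ (∈-map⁺ (Vec._∷_ outside) p)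

∈-subsets⁻ : ∀ {n} k {A : Subset n} → A ∈ subsets n k → ∣ A ∣ ≡ k
∈-subsets⁻ {zero} zero (here refl) = refl
∈-subsets⁻ {suc n} zero p with ∈-map⁻ _ p
... | A , q , refl = ∈-subsets⁻ zero q
∈-subsets⁻ {suc n} (suc k) p with ∈-++⁻ (map (Vec._∷_ outside) (subsets n (suc k))) p
... | inj₁ q with ∈-map⁻ _ q
...   | A , r , refl = ∈-subsets⁻ (suc k) r
∈-subsets⁻ {suc n} (suc k) p | inj₂ q with ∈-map⁻ _ q
...   | A , r , refl = cong suc (∈-subsets⁻ k r)

subsets-unique : ∀ n k → Unique (subsets n k)
subsets-unique zero zero = [] ∷ []
subsets-unique zero (suc k) = []
subsets-unique (suc n) zero = Uniqueₚ.map⁺ Vecₚ.∷-injectiveʳ (subsets-unique n zero)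
subsets-unique (suc n) (suc k) = Uniqueₚ.++⁺
  (Uniqueₚ.map⁺ Vecₚ.∷-injectiveʳ (subsets-unique n (suc k))) (Uniqueₚ.map⁺ Vecₚ.∷-injectiveʳ (subsets-unique n k))
  disjoint
  where
  disjoint : Disjoint (map (Vec._∷_ outside) (subsets n (suc k))) (map (Vec._∷_ inside) (subsets n k))
  disjoint (p , q) with ∈-map⁻ _ p | ∈-map⁻ _ q
  ... | _ , _ , refl | _ , _ , ()

∈-oddSubsets⁻ : ∀ {n} k {A : Subset n} → A ∈ oddSubsets n k → ∣ A ∣ ≡ k × InÕ A
∈-oddSubsets⁻ k {A} p with oddᵇ k in o | 3 ≤ᵇ k in l
... | true | true with ∈-subsets⁻ k p
...   | refl = refl , o , ℕₚ.≤ᵇ⇒≤ 3 ∣ A ∣ (subst Data.Bool.T (≡.sym l) _)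

∈-candidates⁻ : ∀ {n} {A : Subset n} → A ∈ candidates n → InÕ A
∈-candidates⁻ {n} p with Any.satisfied (∈-concatMap⁻ (oddSubsets n) {xs = upTo (suc n)} p)
... | k , q = proj₂ (∈-oddSubsets⁻ k q)

∈-candidates⁺ : ∀ {n} {A : Subset n} → InÕ A → A ∈ candidates n
∈-candidates⁺ {n} {A} (o , l) =
  ∈-concatMap⁺ (oddSubsets n) (Any.map (λ { refl → member o (ℕₚ.≤⇒≤ᵇ l) }) (∈-upTo⁺ (s≤s (Subₚ.∣p∣≤n A))))
  where
  member : Odd ∣ A ∣ → Data.Bool.T (3 ≤ᵇ ∣ A ∣) → A ∈ oddSubsets n ∣ A ∣
  member o l with oddᵇ ∣ A ∣ | 3 ≤ᵇ ∣ A ∣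
  ... | true | true = ∈-subsets⁺ A

oddSubsets-unique : ∀ n k → Unique (oddSubsets n k)
oddSubsets-unique n k with oddᵇ k ∧ (3 ≤ᵇ k)
... | true = subsets-unique n k
... | false = []

candidates-unique : ∀ n → Unique (candidates n)
candidates-unique n = concatMap-unique ∣_∣ (oddSubsets n) (oddSubsets-unique n)
  (λ {k} p → proj₁ (∈-oddSubsets⁻ k p)) (Uniqueₚ.upTo⁺ (suc n))

module _ {a : Level} {X : Set a} where

  ∈-choose⁻ : ∀ p {xs s : List X} → s ∈ choose p xs → length s ≡ p × s ⊆ xs
  ∈-choose⁻ zero (here refl) = refl , minimum _
  ∈-choose⁻ (suc p) {x ∷ xs} s∈ with ∈-++⁻ (choose (suc p) xs) s∈
  ... | inj₁ q = let l , τ = ∈-choose⁻ (suc p) q in l , x ∷ʳ τ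
  ... | inj₂ q with ∈-map⁻ _ q
  ...   | t , r , refl = let l , τ = ∈-choose⁻ p r in cong suc l , refl ∷ τ

  ∈-choose⁺ : ∀ {xs s : List X} → s ⊆ xs → s ∈ choose (length s) xs
  ∈-choose⁺ {s = []} τ = here refl
  ∈-choose⁺ {s = y ∷ s} (x ∷ʳ τ) = ∈-++⁺ˡ (∈-choose⁺ τ)
  ∈-choose⁺ {x ∷ xs} {y ∷ s} (refl ∷ τ) = ∈-++⁺ʳ (choose (suc (length s)) xs) (∈-map⁺ (x ∷_) (∈-choose⁺ τ))

  choose-unique : ∀ p {xs : List X} → Unique xs → Unique (choose p xs)
  choose-unique zero u = [] ∷ []
  choose-unique (suc p) [] = []
  choose-unique (suc p) {x ∷ xs} (x∉ ∷ u) = Uniqueₚ.++⁺ (choose-unique (suc p) u)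
    (Uniqueₚ.map⁺ (λ { refl → refl }) (choose-unique p u)) disjoint
    where
    disjoint : Disjoint (choose (suc p) xs) (map (x ∷_) (choose p xs))
    disjoint (q , r) with ∈-map⁻ _ r
    ... | t , _ , refl = All.lookup x∉ (Sublist.lookup (proj₂ (∈-choose⁻ (suc p) q)) (here refl)) refl

  sublists-unique : ∀ n {xs : List X} → Unique xs → Unique (sublists n xs)
  sublists-unique n {xs} u = concatMap-unique length (λ p → choose p xs) (λ p → choose-unique p u)
    (λ {p} q → proj₁ (∈-choose⁻ p q)) (Uniqueₚ.upTo⁺ (suc n))

  ∈-sublists⁻ : ∀ n {xs s : List X} → s ∈ sublists n xs → s ⊆ xs
  ∈-sublists⁻ n {xs} p with Any.satisfied (∈-concatMap⁻ (λ p → choose p xs) {xs = upTo (suc n)} p)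
  ... | k , q = proj₂ (∈-choose⁻ k q)

  ∈-sublists⁺ : ∀ n {xs s : List X} → s ⊆ xs → length s ≤ n → s ∈ sublists n xs
  ∈-sublists⁺ n {xs} τ l = ∈-concatMap⁺ (λ p → choose p xs) (Any.map (λ { refl → ∈-choose⁺ τ }) (∈-upTo⁺ (s≤s l)))

  sublist-unique : ∀ {xs s : List X} → s ⊆ xs → Unique xs → Unique s
  sublist-unique [] u = []
  sublist-unique (x ∷ʳ τ) (_ ∷ u) = sublist-unique τ u
  sublist-unique (refl ∷ τ) (x∉ ∷ u) =
    All.tabulate (λ p → λ { refl → All.lookup x∉ (Sublist.lookup τ p) refl }) ∷ sublist-unique τ u

  -- Sublists inherit their order from `xs`, which has no repetitions; so they represent finite
  -- families uniquely.
  sublist-extensional : ∀ {xs s t : List X} → Unique xs → s ⊆ xs → t ⊆ xs →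
    (∀ {x} → x ∈ s → x ∈ t) → (∀ {x} → x ∈ t → x ∈ s) → s ≡ t
  sublist-extensional u [] [] f g = refl
  sublist-extensional (_ ∷ u) (x ∷ʳ σ) (.x ∷ʳ τ) f g = sublist-extensional u σ τ f g
  sublist-extensional (x∉ ∷ u) (x ∷ʳ σ) (refl ∷ τ) f g = ⊥-elim (All.lookup x∉ (Sublist.lookup σ (g (here refl))) refl)
  sublist-extensional (x∉ ∷ u) (refl ∷ σ) (x ∷ʳ τ) f g = ⊥-elim (All.lookup x∉ (Sublist.lookup τ (f (here refl))) refl)
  sublist-extensional {x ∷ xs} (x∉ ∷ u) (refl ∷ σ) (refl ∷ τ) f g =
    cong (x ∷_) (sublist-extensional u σ τ (strip σ f) (strip τ g))
    where
    strip : ∀ {s t} → s ⊆ xs → (∀ {y} → y ∈ x ∷ s → y ∈ x ∷ t) → ∀ {y} → y ∈ s → y ∈ t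
    strip σ h y∈ with h (there y∈)
    ... | here refl = ⊥-elim (All.lookup x∉ (Sublist.lookup σ y∈) refl)
    ... | there q = q

map-cast-allFin : ∀ {k m} (e : k ≡ m) → map (cast e) (allFin k) ≡ allFin m
map-cast-allFin {k} refl = ≡.trans (map-cong (Finₚ.cast-is-id refl) (allFin k)) (map-id (allFin k))

map-lookup-allFin : ∀ {a} {X : Set a} (xs : List X) → map (lookup xs) (allFin (length xs)) ≡ xs
map-lookup-allFin xs = ≡.trans (map-tabulate (λ p → p) (lookup xs)) (tabulate-lookup xs)

subset-≟ : ∀ {n} → DecidableEquality (Subset n)
subset-≟ = Vecₚ.≡-dec Boolₚ._≟_

module _ {n : ℕ} where

  open import Data.List.Membership.DecPropositional (subset-≟ {n}) using () renaming (_∈?_ to _∈ˡ?_)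

  -- A representative chosen among the sublists of `candidates n`; on families of odd sets it turns
  -- `≋` into equality of lists.
  canonical : List (Subset n) → List (Subset n)
  canonical 𝒜 = filter (_∈ˡ? 𝒜) (candidates n)

  canonical-⊆ : ∀ 𝒜 → canonical 𝒜 ⊆ candidates n
  canonical-⊆ 𝒜 = filter-⊆ (_∈ˡ? 𝒜) (candidates n)

  ∈-canonical⁻ : ∀ {𝒜 A} → A ∈ canonical 𝒜 → A ∈ 𝒜
  ∈-canonical⁻ {𝒜} p = proj₂ (∈-filter⁻ (_∈ˡ? 𝒜) {xs = candidates n} p)

  ∈-canonical⁺ : ∀ {𝒜 A} → All InÕ 𝒜 → A ∈ 𝒜 → A ∈ canonical 𝒜
  ∈-canonical⁺ {𝒜} os p = ∈-filter⁺ (_∈ˡ? 𝒜) (∈-candidates⁺ (All.lookup os p)) p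

  canonical-≋ : ∀ {𝒜 s} → All InÕ 𝒜 → s ⊆ candidates n → 𝒜 ≋ s → canonical 𝒜 ≡ s
  canonical-≋ {𝒜} {s} os τ eq = sublist-extensional (candidates-unique n) (canonical-⊆ 𝒜) τ
    (λ p → proj₁ (eq _) (∈-canonical⁻ p)) (λ p → ∈-canonical⁺ os (proj₂ (eq _) p))

-- Injectivity is asked of positions and not of entries, since the uniqueness clause of
-- `EnumeratesOddCacti` speaks of positions in `L`.
map-unique : ∀ {a b} {X : Set a} {Y : Set b} (f : X → Y) (xs : List X) →
  (∀ p q → f (lookup xs p) ≡ f (lookup xs q) → p ≡ q) → Unique (map f xs)
map-unique f [] inj = []
map-unique f (x ∷ xs) inj = All.tabulate fresh ∷ map-unique f xs (λ p q e → Finₚ.suc-injective (inj (suc p) (suc q) e))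
  where
  fresh : ∀ {y} → y ∈ map f xs → f x ≢ y
  fresh y∈ refl with ∈-map⁻ f y∈
  ... | z , z∈ , e with inj zero (suc (Any.index z∈)) (≡.trans e (cong f (lookup-index z∈)))
  ...   | ()

≋-refl : ∀ {n} (𝒜 : List (Subset n)) → 𝒜 ≋ 𝒜
≋-refl 𝒜 A = (λ p → p) , (λ p → p)

-- Matching the expansion of the integral with the enumerated cacti.

module Assembly {c ℓ : Level} (K : CommutativeRing c ℓ) (φ : ℚ → CommutativeRing.Carrier K)
    (φ-mono : IsRingMonomorphism +-*-rawRing (CommutativeRing.rawRing K) φ)
    {n : ℕ} (y : OverRing.Tensors K φ n)
    (y-antisym : ∀ k → Odd k → 3 ≤ k → k ≤ n → OverRing.Antisymmetric K φ k (y k)) where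

  open OverRing K φ renaming (gadd to infixl 6 _⊕_; gmul to infixl 7 _⊗_)
  open GrassRing K φ
  open Derivation K φ
  open GrassProducts K φ
  open Alternating K φ
  open Exponential K φ φ-mono
  open EdgeSymmetry K φ φ-mono y y-antisym
  private
    module K = CommutativeRing K
    module KR = Relation.Binary.Reasoning.Setoid K.setoid
    module KA = Algebra.Properties.CommutativeSemigroup K.+-commutativeSemigroup
  open CommutativeRing K using (Carrier; _+_; _*_; -_; 0#; 1#)

  sumK-↭ : ∀ {a} {X : Set a} (f : X → Carrier) {xs ys} → xs ↭ ys → sumK (map f xs) ≈ sumK (map f ys)
  sumK-↭ f refl = K.refl
  sumK-↭ f (prep x p) = K.+-cong K.refl (sumK-↭ f p)
  sumK-↭ f (swap x y p) = K.trans (K.+-cong K.refl (K.+-cong K.refl (sumK-↭ f p))) (KA.x∙yz≈y∙xz _ _ _)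
  sumK-↭ f (trans p q) = K.trans (sumK-↭ f p) (sumK-↭ f q)

  sumK-cong : ∀ {a} {X : Set a} {f g : X → Carrier} → (∀ x → f x ≈ g x) → ∀ xs → sumK (map f xs) ≈ sumK (map g xs)
  sumK-cong p [] = K.refl
  sumK-cong p (x ∷ xs) = K.+-cong (p x) (sumK-cong p xs)

  open import Data.List.Membership.DecPropositional (≡-dec (subset-≟ {n})) using () renaming (_∈?_ to _∈ˡ?_)

  -- Walks through `ss`: a term missing from `ts` vanishes, and a term found in `ts` is moved to its
  -- front and removed from both lists.
  sumK-support : (f : List (Subset n) → Carrier) → ∀ {ss ts} → Unique ss → Unique ts →
    (∀ {t} → t ∈ ts → t ∈ ss) → (∀ {s} → s ∈ ss → s ∈ ts ⊎ f s ≈ 0#) → sumK (map f ss) ≈ sumK (map f ts)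
  sumK-support f {[]} {[]} u v sub zeros = K.refl
  sumK-support f {[]} {t ∷ ts} u v sub zeros with sub (here refl)
  ... | ()
  sumK-support f {s ∷ ss} {ts} (s∉ ∷ u) v sub zeros with s ∈ˡ? ts
  ... | no s∉ts = K.trans (K.+-cong fs≈0 (sumK-support f u v sub′ (zeros ∘ there))) (K.+-identityˡ _)
    where
    fs≈0 : f s ≈ 0#
    fs≈0 with zeros (here refl)
    ... | inj₁ p = ⊥-elim (s∉ts p)
    ... | inj₂ p = p
    sub′ : ∀ {t} → t ∈ ts → t ∈ ss
    sub′ p with sub p
    ... | here refl = ⊥-elim (s∉ts p)
    ... | there q = q
  ... | yes s∈ts with ∈-∃++ s∈ts
  ...   | us , ws , refl = K.trans (K.+-cong K.refl (sumK-support f u v′ sub′ zeros′)) (K.sym (sumK-↭ f perm))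
    where
    perm : us ++ s ∷ ws ↭ s ∷ us ++ ws
    perm = Permₚ.shift s us ws
    uniq : Unique (s ∷ us ++ ws)
    uniq = unique-resp-↭ perm v
    v′ : Unique (us ++ ws)
    v′ with uniq
    ... | _ ∷ w = w
    sub′ : ∀ {t} → t ∈ us ++ ws → t ∈ ss
    sub′ p with sub (Permₚ.∈-resp-↭ (↭-sym perm) (there p)) | uniq
    ... | here refl | s∉′ ∷ _ = ⊥-elim (All.lookup s∉′ p refl)
    ... | there q | _ = q
    zeros′ : ∀ {t} → t ∈ ss → t ∈ us ++ ws ⊎ f t ≈ 0#
    zeros′ p with zeros (there p)
    ... | inj₂ q = inj₂ q
    ... | inj₁ q with Permₚ.∈-resp-↭ perm q
    ...   | here refl = ⊥-elim (All.lookup s∉ p refl)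
    ...   | there r = inj₁ r

  InÕ⇒InRange : ∀ (A : Subset n) → InÕ A → InRange (length (elems A))
  InÕ⇒InRange A (o , l) rewrite length-elems A = o , l , Subₚ.∣p∣≤n A

  Q : Subset n → Grass n
  Q A = hyperedge (elems A)

  Q-even : ∀ A → InÕ A → Even′ (Q A)
  Q-even A o = Even′-gscale _ (∂-χs-even (elems A) (proj₁ (InÕ⇒InRange A o)))

  Q-square : ∀ A → InÕ A → Q A ⊗ Q A ≈ᵍ gzero
  Q-square A o with elems A | InÕ⇒InRange A o
  ... | [] | () , _
  ... | _ ∷ [] | _ , s≤s () , _
  ... | a ∷ b ∷ l | odd , _ = ≈ᵍ-trans (gmul-gscaleˡ w d (gscale w d)) (≈ᵍ-trans (gscale-cong K.refl
        (≈ᵍ-trans (gmul-gscaleʳ w d d) (≈ᵍ-trans (gscale-cong K.refl (∂-χs-square a b l odd)) (gscale-zeroʳ w)))) (gscale-zeroʳ w))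
    where
    w = wt (a ∷ b ∷ l)
    d = ∂ (χs (a ∷ b ∷ l))

  contribution : Fin n → List (Subset n) → Carrier
  contribution j s = berezin (χ j ⊗ gprod (map Q s))

  integral-sublists : ∀ j → integral y j ≈ sumK (map (contribution j) (sublists n (candidates n)))
  integral-sublists j = KR.begin
    berezin (χ j ⊗ gexp (action y))
      KR.≈⟨ berezin-cong (gmul-cong {f = χ j} ≈ᵍ-refl (≈ᵍ-trans (gexp-cong (action-edges y y-antisym))
              (gexp-gsum Q (All.tabulate (λ {A} A∈ → Q-even A (∈-candidates⁻ A∈))) (All.tabulate (λ {A} A∈ → Q-square A (∈-candidates⁻ A∈)))))) ⟩
    berezin (χ j ⊗ gsum (map (λ s → gprod (map Q s)) Ss))
      KR.≈⟨ berezin-cong (gmul-gsumˡ (χ j) (λ s → gprod (map Q s)) Ss) ⟩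
    berezin (gsum (map (λ s → χ j ⊗ gprod (map Q s)) Ss))
      KR.≈⟨ berezin-gsum (λ s → χ j ⊗ gprod (map Q s)) Ss ⟩
    sumK (map (contribution j) Ss) KR.∎
    where
    Ss = sublists n (candidates n)

  InÕ-nonempty : ∀ (A : Subset n) → InÕ A → Nonempty A
  InÕ-nonempty A (_ , l) = let a , _ , a∈ , _ = two-elements A (ℕₚ.≤-trans (s≤s (s≤s z≤n)) l) in a , a∈

  module Sorted (j : Fin n) {s : List (Subset n)} (os : All InÕ s) = GrowthAlgebra K φ s j
    (λ p → elems (lookup s p)) (λ p → elems-unique (lookup s p))
    (λ p → proj₁ (InÕ⇒InRange (lookup s p) (All.lookup os (∈-lookup p)))) ∈-elems⁺ ∈-elems⁻

  contribution-zero : ∀ j {s} (os : All InÕ s) → berezin (Sorted.total j os) ≈ 0# → contribution j s ≈ 0#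
  contribution-zero j {s} os z = K.trans
    (K.reflexive (cong (λ l → berezin (χ j ⊗ gprod l))
      (≡.trans (cong (map Q) (≡.sym (map-lookup-allFin s))) (≡.sym (map-∘ {g = Q} {f = lookup s} (allFin (length s)))))))
    (K.trans (Sorted.berezin-weighted j os (λ p → wt (elems (lookup s p)))) (K.trans (K.*-cong K.refl z) (K.zeroʳ _)))

  cactus-or-zero : ∀ j {s} → Unique s → All InÕ s → IsOddCactus s ⊎ contribution j s ≈ 0#
  cactus-or-zero j {s} u os = go (Growth.outcome s j nonempty)
    where
    nonempty : ∀ p → Nonempty (lookup s p)
    nonempty p = InÕ-nonempty (lookup s p) (All.lookup os (∈-lookup p))
    go : Growth.Outcome s j → IsOddCactus s ⊎ contribution j s ≈ 0#
    go (Growth.full (ps , g , cover)) = inj₁ (u , os , Growth.FullyGrownTree.isTree s j g cover)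
    go (Growth.excess x) = inj₂ (contribution-zero j os (Sorted.excess⇒0 j os x))
    go (Growth.closed x) = inj₂ (contribution-zero j os (Sorted.closed⇒0 j os nonempty x))

  gprod-cong-All : ∀ {a} {X : Set a} {f g : X → Grass n} {xs} → All (λ x → f x ≈ᵍ g x) xs →
    gprod (map f xs) ≈ᵍ gprod (map g xs)
  gprod-cong-All [] = ≈ᵍ-refl
  gprod-cong-All (p ∷ ps) = gmul-cong p (gprod-cong-All ps)

  module Entry {j : Fin n} (𝑅 : RootedRefinedCactus n j) where

    open RootedRefinedCactus 𝑅

    𝒜 : List (Subset n)
    𝒜 = underlying cactus

    inO : All InO cactus
    inO = proj₁ isRefined

    𝒜-cactus : IsOddCactus 𝒜
    𝒜-cactus = proj₂ isRefined

    inÕ : All InÕ 𝒜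
    inÕ = proj₁ (proj₂ 𝒜-cactus)

    len : length 𝒜 ≡ length cactus
    len = length-map toSubset cactus

    -- The lengths of `𝒜` and `cactus` agree only up to a proof, hence the casts between positions.
    pos : Fin (length 𝒜) → Fin (length cactus)
    pos = cast len

    seq : Fin (length 𝒜) → List (Fin n)
    seq p = lookup cactus (pos p)

    seq-inO : ∀ p → InO (seq p)
    seq-inO p = All.lookup inO (∈-lookup (pos p))

    lookup-seq : ∀ p → lookup 𝒜 p ≡ toSubset (seq p)
    lookup-seq = go cactus
      where
      go : ∀ (C : List (List (Fin n))) p → lookup (underlying C) p ≡ toSubset (lookup C (cast (length-map toSubset C) p))
      go (α ∷ C) zero = refl
      go (α ∷ C) (suc p) = go C p

    map-seq : map seq (allFin (length 𝒜)) ≡ cactus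
    map-seq = ≡.trans (map-∘ (allFin (length 𝒜)))
      (≡.trans (cong (map (lookup cactus)) (map-cast-allFin len)) (map-lookup-allFin cactus))

    open Growth 𝒜 j

    grown : FullyGrown
    grown = tree⇒fullyGrown (λ p → InÕ-nonempty (lookup 𝒜 p) (All.lookup inÕ (∈-lookup p))) (proj₂ (proj₂ 𝒜-cactus))

    ps : List (Fin m × Fin n)
    ps = proj₁ grown

    full-growth : Grown Sub.⊤ ps
    full-growth = proj₁ (proj₂ grown)

    cover : used ps ↭ allFin m
    cover = proj₂ (proj₂ grown)

    length-𝒜 : length 𝒜 ≤ n
    length-𝒜 = ℕₚ.≤-trans (ℕₚ.≤-reflexive (≡.sym lengths)) (ℕₚ.≤-trans (ℕₚ.n≤1+n _) (ℕₚ.≤-trans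
      (size-grown (λ p → ℕₚ.≤-trans (s≤s (s≤s z≤n)) (proj₂ (All.lookup inÕ (∈-lookup p)))) full-growth)
      (Subₚ.∣p∣≤n Sub.⊤)))
      where
      lengths : length ps ≡ length 𝒜
      lengths = ≡.trans (≡.sym (length-map proj₁ ps)) (≡.trans (Permₚ.↭-length cover) (length-tabulate {n = m} (λ p → p)))

    canonical-↭ : canonical 𝒜 ↭ 𝒜
    canonical-↭ = unique-set⇒↭ (sublist-unique (canonical-⊆ 𝒜) (candidates-unique n)) (proj₁ 𝒜-cactus)
      ∈-canonical⁻ (∈-canonical⁺ inÕ)

    -- By `length-𝒜` the cactus lies within the truncation of the exponential.
    canonical∈sublists : canonical 𝒜 ∈ sublists n (candidates n)
    canonical∈sublists = ∈-sublists⁺ n (canonical-⊆ 𝒜) (ℕₚ.≤-trans (ℕₚ.≤-reflexive (Permₚ.↭-length canonical-↭)) length-𝒜)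

    module GA = GrowthAlgebra K φ 𝒜 j seq (proj₁ ∘ seq-inO) (λ p → proj₁ (proj₂ (seq-inO p)))
      (λ {p} b∈ → ∈-toSubset⁻ (subst (_ Sub.∈_) (lookup-seq p) b∈))
      (λ {p} b∈ → subst (_ Sub.∈_) (≡.sym (lookup-seq p)) (∈-toSubset⁺ b∈))

    root : ∀ p → Fin (length (seq p))
    root p = localRoot (pos p)

    root-attached : ∀ {p r} → (p , r) ∈ ps → lookup (seq p) (root p) ≡ r
    root-attached {p} e = FullyGrownTree.localRoot≡attached full-growth cover e
      (subst (λ q → Graph.FirstOnShortestPath (GEdge 𝒜) (inj₁ q) (inj₂ j) (inj₂ (lookup (seq p) (root p))))
        (Finₚ.cast-involutive (≡.sym len) len p) (localRootOK (pos p)))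

    module V = GA.Value full-growth cover root root-attached

    π≡ : V.π ≡ rootPermutation 𝑅
    π≡ = cong (λ l → j ∷ concat l) (≡.trans (map-∘ {g = circ} {f = pos} (allFin m))
      (cong (map circ) (map-cast-allFin len)))
      where
      circ : Fin (length cactus) → List (Fin n)
      circ p = circulation (seqAt cactus p) (localRoot p)

    Q-toSubset : ∀ α → InO α → Q (toSubset α) ≈ᵍ hyperedge α
    Q-toSubset α (u , r) = ≈ᵍ-sym (hyperedge-↭ (↭-elems-toSubset u) r)

    -- The given refined cactus differs from the canonical family in the order of its hyperedges,
    -- which is immaterial for even factors, and in the order within each, which `hyperedge-↭`
    -- removes. What remains is evaluated along the growth.
    contribution-value : 𝒴 y 𝑅 ≈ contribution j (canonical 𝒜)
    contribution-value = K.sym (KR.begin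
      berezin (χ j ⊗ gprod (map Q (canonical 𝒜)))
        KR.≈⟨ berezin-cong (gmul-cong {f = χ j} ≈ᵍ-refl (gprod-↭-All Q
                (All.tabulate (λ {A} p → Q-even A (All.lookup inÕ (∈-canonical⁻ {𝒜 = 𝒜} p)))) canonical-↭)) ⟩
      berezin (χ j ⊗ gprod (map Q 𝒜))
        KR.≈⟨ berezin-cong (gmul-cong {f = χ j} ≈ᵍ-refl (≈ᵍ-trans
                (≡⇒≈ᵍ (cong gprod (≡.sym (map-∘ {g = Q} {f = toSubset} cactus)))) (gprod-cong-All (All.map (λ {α} → Q-toSubset α) inO)))) ⟩
      berezin (χ j ⊗ gprod (map hyperedge cactus))
        KR.≡⟨ cong (λ l → berezin (χ j ⊗ gprod l)) (≡.trans (cong (map hyperedge) (≡.sym map-seq))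
                (≡.sym (map-∘ {g = hyperedge} {f = seq} (allFin m)))) ⟩
      berezin (χ j ⊗ gprod (map (hyperedge ∘ seq) (allFin m)))
        KR.≈⟨ GA.berezin-weighted (wt ∘ seq) ⟩
      productK (map (wt ∘ seq) (allFin m)) * berezin GA.total
        KR.≈⟨ K.*-comm _ _ ⟩
      berezin GA.total * productK (map (wt ∘ seq) (allFin m))
        KR.≈⟨ K.*-cong (K.trans V.berezin-total (K.reflexive (cong (signK ∘ inversions) π≡)))
                (K.reflexive (cong productK (≡.trans (map-∘ {g = wt} {f = seq} (allFin m)) (cong (map wt) map-seq)))) ⟩
      signK (inversions (rootPermutation 𝑅)) * productK (map wt cactus) KR.∎)

  module _ {j : Fin n} (L : List (RootedRefinedCactus n j)) (enumerates : EnumeratesOddCacti L) where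

    support : RootedRefinedCactus n j → List (Subset n)
    support 𝑅 = canonical (underlying (RootedRefinedCactus.cactus 𝑅))

    -- Equal canonical forms come from the same cactus, for which the enumeration has only one
    -- position.
    support-injective : ∀ p q → support (lookup L p) ≡ support (lookup L q) → p ≡ q
    support-injective p q e = ≡.trans (unique p p≋q) (≡.sym (unique q (≋-refl _)))
      where
      open Entry
      entry = enumerates (𝒜 (lookup L q)) (𝒜-cactus (lookup L q))
      unique = proj₂ (proj₂ entry)
      p≋q : 𝒜 (lookup L p) ≋ 𝒜 (lookup L q)
      p≋q A = (λ a → ∈-canonical⁻ (subst (A ∈_) e (∈-canonical⁺ (inÕ (lookup L p)) a)))
            , (λ a → ∈-canonical⁻ (subst (A ∈_) (≡.sym e) (∈-canonical⁺ (inÕ (lookup L q)) a)))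

    supported-or-zero : ∀ {s} → s ∈ sublists n (candidates n) → s ∈ map support L ⊎ contribution j s ≈ 0#
    supported-or-zero {s} s∈ with cactus-or-zero j (sublist-unique τ (candidates-unique n))
        (All.tabulate (λ p → ∈-candidates⁻ (Sublist.lookup τ p)))
      where τ = ∈-sublists⁻ n s∈
    ... | inj₂ z = inj₂ z
    ... | inj₁ cac with enumerates s cac
    ...   | p , eq , _ = inj₁ (subst (_∈ map support L)
              (canonical-≋ (Entry.inÕ (lookup L p)) (∈-sublists⁻ n s∈) eq) (∈-map⁺ support (∈-lookup p)))

    support∈sublists : ∀ {t} → t ∈ map support L → t ∈ sublists n (candidates n)
    support∈sublists t∈ with ∈-map⁻ support t∈
    ... | 𝑅 , _ , refl = Entry.canonical∈sublists 𝑅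

    integral-cacti : integral y j ≈ sumK (map (𝒴 y) L)
    integral-cacti = KR.begin
      integral y j
        KR.≈⟨ integral-sublists j ⟩
      sumK (map (contribution j) (sublists n (candidates n)))
        KR.≈⟨ sumK-support (contribution j) (sublists-unique n (candidates-unique n)) (map-unique support L support-injective)
                support∈sublists supported-or-zero ⟩
      sumK (map (contribution j) (map support L))
        KR.≡⟨ cong sumK (≡.sym (map-∘ L)) ⟩
      sumK (map (contribution j ∘ support) L)
        KR.≈⟨ sumK-cong (λ 𝑅 → K.sym (Entry.contribution-value 𝑅)) L ⟩
      sumK (map (𝒴 y) L) KR.∎

theorem2 : ∀ {c ℓ : Level} (K : CommutativeRing c ℓ)
  -- K contains ℚ: an injective unital ring homomorphism ℚ → K
  (φ : ℚ → CommutativeRing.Carrier K)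
  → IsRingMonomorphism +-*-rawRing (CommutativeRing.rawRing K) φ
  → (n : ℕ) → Odd n
  → (y : OverRing.Tensors K φ n)
  → (∀ k → Odd k → 3 ≤ k → k ≤ n → OverRing.Antisymmetric K φ k (y k))
  → let open OverRing K φ in
    (∀ (i i' : Fin n) → integral y i ≈ integral y i')
    × (∀ (i j : Fin n) (L : List (RootedRefinedCactus n j))
         → EnumeratesOddCacti L
         → integral y i ≈ sumK (map (𝒴 y) L))
theorem2 K φ φ-mono n _ y y-antisym = independent
  -- The entries of `L` are rooted at j, so the cactus formula is obtained at j and carried over to
  -- i by independence.
  , λ i j L enumerates → CommutativeRing.trans K (independent i j)
      (Assembly.integral-cacti K φ φ-mono y y-antisym L enumerates)
  where
  independent = Exponential.integral-independent K φ φ-mono y y-antisym
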